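{- The translation $W:L_{LR}\to L_{name}$, which is the identity on expressions and contexts, is an isomorphism: for all $s,t\in\mathbb{E}_{\mathcal L}$, $s\le_{LR}t\iff W(s)\le_{name}W(t)$, and $W$ induces a bijection on the quotients $\mathbb{E}_{\mathcal L}/{\sim_{LR}}\to\mathbb{E}_{\mathcal L}/{\sim_{name}}$.
   Context: **Syntax.** Fix a set of data constructors partitioned into types; each constructor $c$ has an arity $\mathrm{ar}(c)\ge 0$; the constructors of type $T$ are enumerated as $c_{T,1},\dots,c_{T,|T|}$; there is a type Bool with nullary constructors True, False. Constructors occur only fully saturated. Expressions $\mathbb{E}_{\mathcal L}$: $s,t ::= x \mid (s\ t)\mid (\lambda x.s)\mid (\mathtt{letrec}\ x_1=s_1,\dots,x_n=s_n\ \mathtt{in}\ t)\mid (c\ s_1\dots s_{\mathrm{ar}(c)})\mid(\mathtt{seq}\ s\ t)\mid(\mathtt{case}_T\ s\ \mathtt{of}\ alts)$, where $alts$ has exactly one alternative $((c\ y_1\dots y_{\mathrm{ar}(c)})\to r)$ for each constructor $c$ of type $T$ (the $y_i$ are distinct variables bound in $r$). In letrec, $n\ge1$, the $x_i$ are distinct, the bindings are recursive (the scope of each $x_j$ is $s_1,\dots,s_n,t$) and are identified up to reordering. Expressions are taken up to $\alpha$-equivalence; bound variables are assumed distinct from each other and from free variables, and reductions rename implicitly if necessary. $Env$ denotes a group of letrec-bindings (possibly empty if other bindings are displayed). Contexts $C$ are expressions with one hole $[\cdot]$ in place of a subexpression; $\mathbb{C}_{\mathcal L}$ is the set of all of them.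 A value $v$ is an abstraction or a constructor application. **The calculus $L_{LR}$.** A normal-order step $\xrightarrow{LR}$ on $\mathbb{E}_{\mathcal L}$ is defined in two stages. *Stage 1 (labelling)* with labels $S,T,V,W$: start with $s^T$ and no other labels, and exhaustively apply (subterms may carry more labels than displayed; $a^{S\vee T}$ means label $S$ or $T$; the fail rules take precedence): - $(\mathtt{letrec}\ Env\ \mathtt{in}\ s)^T\leadsto(\mathtt{letrec}\ Env\ \mathtt{in}\ s^S)^V$; - $(s\ t)^{S\vee T}\leadsto(s^S\ t)^V$; $(\mathtt{seq}\ s\ t)^{S\vee T}\leadsto(\mathtt{seq}\ s^S\ t)^V$; $(\mathtt{case}_T\ s\ \mathtt{of}\ alts)^{S\vee T}\leadsto(\mathtt{case}_T\ s^S\ \mathtt{of}\ alts)^V$; - $\mathtt{letrec}\ x=s,Env\ \mathtt{in}\ C[x^S]\leadsto\mathtt{letrec}\ x=s^S,Env\ \mathtt{in}\ C[x^V]$; - $\mathtt{letrec}\ x=s^{V\vee W},y=C[x^S],Env\ \mathtt{in}\ t\leadsto$ fail; $\mathtt{letrec}\ x=C[x^S],Env\ \mathtt{in}\ s\leadsto$ fail; - $\mathtt{letrec}\ x=s,y=C[x^S],Env\ \mathtt{in}\ t\leadsto\mathtt{letrec}\ x=s^S,y=C[x^V],Env\ \mathtt{in}\ t$ if $C[x]\neq x$; - $\mathtt{letrec}\ x=s,y=x^S,Env\ \mathtt{in}\ t\leadsto\mathtt{letrec}\ x=s^S,y=x^W,Env\ \mathtt{in}\ t$. *Stage 2*: if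 labelling does not fail, apply one of the following rules, if possible, where the displayed labels $S,V$ must match. $Ch$ denotes a chain $x_2=x_1,\dots,x_m=x_{m-1}$ (empty if $m=1$). - (lbeta) $C[((\lambda x.s)^S\ t)]\to C[\mathtt{letrec}\ x=t\ \mathtt{in}\ s]$. - (cp-in) $\mathtt{letrec}\ x_1=(\lambda x.s)^S,Ch,Env\ \mathtt{in}\ C[x_m^V]\to\mathtt{letrec}\ x_1=\lambda x.s,Ch,Env\ \mathtt{in}\ C[\lambda x.s]$. - (cp-e) $\mathtt{letrec}\ x_1=(\lambda x.s)^S,Ch,Env,y=C[x_m^V]\ \mathtt{in}\ t\to\mathtt{letrec}\ x_1=\lambda x.s,Ch,Env,y=C[\lambda x.s]\ \mathtt{in}\ t$. - (lapp) $C[((\mathtt{letrec}\ Env\ \mathtt{in}\ s)^S\ t)]\to C[\mathtt{letrec}\ Env\ \mathtt{in}\ (s\ t)]$; (lcase) $C[\mathtt{case}_T\ (\mathtt{letrec}\ Env\ \mathtt{in}\ s)^S\ \mathtt{of}\ alts]\to C[\mathtt{letrec}\ Env\ \mathtt{in}\ (\mathtt{case}_T\ s\ \mathtt{of}\ alts)]$; (lseq) $C[\mathtt{seq}\ (\mathtt{letrec}\ Env\ \mathtt{in}\ s)^S\ t]\to C[\mathtt{letrec}\ Env\ \mathtt{in}\ (\mathtt{seq}\ s\ t)]$. - (llet-in) $\mathtt{letrec}\ Env_1\ \mathtt{in}\ (\mathtt{letrec}\ Env_2\ \mathtt{in}\ s)^S\to\mathtt{letrec}\ Env_1,Env_2\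 \mathtt{in}\ s$; (llet-e) $\mathtt{letrec}\ Env_1,x=(\mathtt{letrec}\ Env_2\ \mathtt{in}\ s)^S\ \mathtt{in}\ t\to\mathtt{letrec}\ Env_1,Env_2,x=s\ \mathtt{in}\ t$. - (seq-c) $C[(\mathtt{seq}\ v^S\ s)]\to C[s]$ for a value $v$; (seq-in) $\mathtt{letrec}\ x_1=v^S,Ch,Env\ \mathtt{in}\ C[(\mathtt{seq}\ x_m^V\ s)]\to\mathtt{letrec}\ x_1=v,Ch,Env\ \mathtt{in}\ C[s]$ and (seq-e) $\mathtt{letrec}\ x_1=v^S,Ch,Env,y=C[(\mathtt{seq}\ x_m^V\ s)]\ \mathtt{in}\ t\to\mathtt{letrec}\ x_1=v,Ch,Env,y=C[s]\ \mathtt{in}\ t$, both for a constructor application $v$. - (case-c) $C[\mathtt{case}_T\ (c\ s_1\dots s_k)^S\ \mathtt{of}\dots((c\ y_1\dots y_k)\to t)\dots]\to C[\mathtt{letrec}\ y_1=s_1,\dots,y_k=s_k\ \mathtt{in}\ t]$ if $k=\mathrm{ar}(c)\ge1$, and $\to C[t]$ if $k=0$. - (case-in) $\mathtt{letrec}\ x_1=(c\ s_1\dots s_k)^S,Ch,Env\ \mathtt{in}\ C[\mathtt{case}_T\ x_m^V\ \mathtt{of}\dots((c\ z_1\dots z_k)\to t)\dots]\to\mathtt{letrec}\ x_1=(c\ y_1\dots y_k),y_1=s_1,\dots,y_k=s_k,Ch,Env\ \mathtt{in}\ C[\mathtt{letrec}\ z_1=y_1,\dots,z_k=y_k\ \mathtt{in}\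 t]$ with fresh $y_i$ if $k=\mathrm{ar}(c)\ge1$; if $k=0$ the result is $\mathtt{letrec}\ x_1=c,Ch,Env\ \mathtt{in}\ C[t]$. - (case-e) the same with the case-expression inside a binding: $\mathtt{letrec}\ x_1=(c\ s_1\dots s_k)^S,Ch,u=C[\mathtt{case}_T\ x_m^V\ \mathtt{of}\dots((c\ z_1\dots z_k)\to t)\dots],Env\ \mathtt{in}\ r\to\mathtt{letrec}\ x_1=(c\ y_1\dots y_k),y_1=s_1,\dots,y_k=s_k,Ch,u=C[\mathtt{letrec}\ z_1=y_1,\dots,z_k=y_k\ \mathtt{in}\ t],Env\ \mathtt{in}\ r$ with fresh $y_i$ if $k\ge1$; if $k=0$ the result is $\mathtt{letrec}\ x_1=c,Ch,u=C[t],Env\ \mathtt{in}\ r$. The $L_{LR}$-WHNFs (answers) are: abstractions; constructor applications; $\mathtt{letrec}\ Env\ \mathtt{in}\ v$ with $v$ a value; and $\mathtt{letrec}\ x_1=v,Ch,Env\ \mathtt{in}\ x_m$ with $v$ a constructor application. **The calculus $L_{name}$** on $\mathbb{E}_{\mathcal L}$: let $L::=[\cdot]\mid\mathtt{letrec}\ Env\ \mathtt{in}\ L$ and $A::=[\cdot]\mid(A\ s)\mid(\mathtt{case}_T\ A\ \mathtt{of}\ alts)\mid(\mathtt{seq}\ A\ s)$; reduction contexts are $R=L[A]$. $\xrightarrow{name}$ is given by: (beta) $R[(\lambda x.s)\ t]\to R[s[t/x]]$; (gcp) $L[\mathtt{letrec}\ Env,x=s\ \mathtt{in}\ R[x]]\to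 L[\mathtt{letrec}\ Env,x=s\ \mathtt{in}\ R[s]]$ (with $x$ the displayed bound variable); (lapp) $R[((\mathtt{letrec}\ Env\ \mathtt{in}\ s)\ t)]\to R[\mathtt{letrec}\ Env\ \mathtt{in}\ (s\ t)]$; (lcase) $R[\mathtt{case}_T\ (\mathtt{letrec}\ Env\ \mathtt{in}\ s)\ \mathtt{of}\ alts]\to R[\mathtt{letrec}\ Env\ \mathtt{in}\ (\mathtt{case}_T\ s\ \mathtt{of}\ alts)]$; (lseq) $R[\mathtt{seq}\ (\mathtt{letrec}\ Env\ \mathtt{in}\ s)\ t]\to R[\mathtt{letrec}\ Env\ \mathtt{in}\ (\mathtt{seq}\ s\ t)]$; (seq) $R[\mathtt{seq}\ v\ s]\to R[s]$ for a value $v$; (case) $R[\mathtt{case}_T\ (c\ s_1\dots s_k)\ \mathtt{of}\dots((c\ x_1\dots x_k)\to t)\dots]\to R[t[s_1/x_1,\dots,s_k/x_k]]$. The $L_{name}$-WHNFs (answers) are the expressions $L[v]$ with $v$ a value. **Contextual preorders.** For $D\in\{LR,name\}$, $s\downarrow_D$ means $s\xrightarrow{D,*}v$ for some answer $v$ of the calculus, $s\le_Dt$ iff for all $C\in\mathbb{C}_{\mathcal L}$: $C[s]\downarrow_D\Rightarrow C[t]\downarrow_D$, and $\sim_D\,=\,\le_D\cap\ge_D$. -}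

module Defs where

open import Data.Bool.Base using (if_then_else_)
open import Data.Fin.Base using (Fin; zero; suc; toℕ; _↑ʳ_)
open import Data.Fin.Patterns using (0F; 1F; 2F; 3F)
open import Data.Fin.Subset using (Subset; ⁅_⁆; _∪_; _-_; _∈_) renaming (⊥ to ∅)
open import Data.List.Base using (List; []; _∷_)
open import Data.List.Membership.Propositional using () renaming (_∉_ to _∉ᴸ_)
open import Data.Nat.Base using (ℕ; zero; suc; _+_; NonZero)
open import Data.Nat.Properties using (_≟_)
open import Data.Product.Base using (_×_; ∃; ∃₂)
open import Data.Sum.Base using (_⊎_)
open import Data.Unit.Base using (⊤; tt)
open import Data.Vec.Base using (Vec; []; _∷_; _++_; lookup; tabulate; updateAt; _[_]≔_)
open import Data.Vec.Relation.Unary.Unique.Propositional using (Unique)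
open import Relation.Binary.Construct.Closure.ReflexiveTransitive using (Star)
open import Relation.Binary.PropositionalEquality.Core using (_≡_; _≢_)
open import Relation.Nullary.Decidable.Core using (does)
open import Relation.Nullary.Negation.Core using (¬_)

-- The i-th constructor of type T is i : Fin (size T).
record Signature : Set₁ where
  field
    Ty           : Set
    size         : Ty → ℕ
    size-nonZero : ∀ T → NonZero (size T)
    ar           : ∀ T → Fin (size T) → ℕ
    Bool         : Ty
    Bool-size    : size Bool ≡ 2
    Bool-nullary : ∀ c → ar Bool c ≡ 0

module Calculi (𝒮 : Signature) where
  open Signature 𝒮

  -- α-equivalence classes of expressions, as de Bruijn terms over infinitely
  -- many free variables: below d binders, index i < d is bound and index d + x
  -- is the free variable named x.  Every node carries an annotation from A:
  -- ⊤ for plain expressions, a set of labels during labelling.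
  --
  -- A letrec with n ≥ 1 bindings binds indices 0 … n-1 in all its bindings and
  -- in its body; an alternative for c binds 0 … ar c - 1, where index i stands
  -- for the (i+1)-st argument.  A letrec environment is stored as a vector, but
  -- every rule below selects its bindings at arbitrary positions, so the order
  -- of the bindings is immaterial.
  data Exp (A : Set) : Set where
    var^    : A → ℕ → Exp A
    app^    : A → Exp A → Exp A → Exp A
    lam^    : A → Exp A → Exp A
    letrec^ : ∀ {k} → A → Vec (Exp A) (suc k) → Exp A → Exp A
    con^    : A → ∀ T (c : Fin (size T)) → Vec (Exp A) (ar T c) → Exp A
    seq^    : A → Exp A → Exp A → Exp A
    case^   : A → ∀ T → Exp A → Vec (Exp A) (size T) → Exp A

  𝔼 : Set
  𝔼 = Exp ⊤

  pattern var x         = var^ tt x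
  pattern app s t       = app^ tt s t
  pattern lam s         = lam^ tt s
  pattern letrec bs t   = letrec^ tt bs t
  pattern con T c ss    = con^ tt T c ss
  pattern seq s t       = seq^ tt s t
  pattern case T s alts = case^ tt T s alts

  infix  4 _⇝ʳ_ _⇝_ _▷_ _⟶ᴸᴿ_ _⟶ⁿ_
  infixl 8 _[_] _⟪_⟫ _⟦_⟧ _⟦_⟧ᴸ _⟦_⟧ᴬ _⟦_⟧ᴿ

  data Value {A : Set} : Exp A → Set where
    abstraction : ∀ {a s} → Value (lam^ a s)
    application : ∀ {a T c ss} → Value (con^ a T c ss)

  annotation : ∀ {A} → Exp A → A
  annotation (var^ a _)      = a
  annotation (app^ a _ _)    = a
  annotation (lam^ a _)      = a
  annotation (letrec^ a _ _) = a
  annotation (con^ a _ _ _)  = a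
  annotation (seq^ a _ _)    = a
  annotation (case^ a _ _ _) = a

  reannotate : ∀ {A} → (A → A) → Exp A → Exp A
  reannotate f (var^ a x)         = var^ (f a) x
  reannotate f (app^ a s t)       = app^ (f a) s t
  reannotate f (lam^ a s)         = lam^ (f a) s
  reannotate f (letrec^ a bs t)   = letrec^ (f a) bs t
  reannotate f (con^ a T c ss)    = con^ (f a) T c ss
  reannotate f (seq^ a s t)       = seq^ (f a) s t
  reannotate f (case^ a T s alts) = case^ (f a) T s alts

  mutual
    mapAnn : ∀ {A B} → (A → B) → Exp A → Exp B
    mapAnn f (var^ a x)         = var^ (f a) x
    mapAnn f (app^ a s t)       = app^ (f a) (mapAnn f s) (mapAnn f t)
    mapAnn f (lam^ a s)         = lam^ (f a) (mapAnn f s)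
    mapAnn f (letrec^ a bs t)   = letrec^ (f a) (mapAnn* f bs) (mapAnn f t)
    mapAnn f (con^ a T c ss)    = con^ (f a) T c (mapAnn* f ss)
    mapAnn f (seq^ a s t)       = seq^ (f a) (mapAnn f s) (mapAnn f t)
    mapAnn f (case^ a T s alts) = case^ (f a) T (mapAnn f s) (mapAnn* f alts)

    mapAnn* : ∀ {A B n} → (A → B) → Vec (Exp A) n → Vec (Exp B) n
    mapAnn* f []       = []
    mapAnn* f (s ∷ ss) = mapAnn f s ∷ mapAnn* f ss

  ext₁ : (ℕ → ℕ) → ℕ → ℕ
  ext₁ ρ zero    = zero
  ext₁ ρ (suc x) = suc (ρ x)

  ext : ℕ → (ℕ → ℕ) → ℕ → ℕ
  ext zero    ρ = ρ
  ext (suc k) ρ = ext₁ (ext k ρ)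

  mutual
    rename : ∀ {A} → (ℕ → ℕ) → Exp A → Exp A
    rename ρ (var^ a x)             = var^ a (ρ x)
    rename ρ (app^ a s t)           = app^ a (rename ρ s) (rename ρ t)
    rename ρ (lam^ a s)             = lam^ a (rename (ext 1 ρ) s)
    rename ρ (letrec^ {k} a bs t)   = letrec^ a (rename* (ext (suc k) ρ) bs) (rename (ext (suc k) ρ) t)
    rename ρ (con^ a T c ss)        = con^ a T c (rename* ρ ss)
    rename ρ (seq^ a s t)           = seq^ a (rename ρ s) (rename ρ t)
    rename ρ (case^ a T s alts)     = case^ a T (rename ρ s) (renameAlts (ar T) ρ alts)

    rename* : ∀ {A n} → (ℕ → ℕ) → Vec (Exp A) n → Vec (Exp A) n
    rename* ρ []       = []
    rename* ρ (s ∷ ss) = rename ρ s ∷ rename* ρ ss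

    renameAlts : ∀ {A n} → (Fin n → ℕ) → (ℕ → ℕ) → Vec (Exp A) n → Vec (Exp A) n
    renameAlts ars ρ []       = []
    renameAlts ars ρ (s ∷ ss) = rename (ext (ars zero) ρ) s ∷ renameAlts (λ i → ars (suc i)) ρ ss

  shift : ∀ {A} → ℕ → Exp A → Exp A
  shift d = rename (d +_)

  shift* : ∀ {A n} → ℕ → Vec (Exp A) n → Vec (Exp A) n
  shift* d = rename* (d +_)

  shiftAlts : ∀ {A} T → ℕ → Vec (Exp A) (size T) → Vec (Exp A) (size T)
  shiftAlts T d = renameAlts (ar T) (d +_)

  exts₁ : (ℕ → 𝔼) → ℕ → 𝔼
  exts₁ σ zero    = var zero
  exts₁ σ (suc x) = shift 1 (σ x)

  exts : ℕ → (ℕ → 𝔼) → ℕ → 𝔼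
  exts zero    σ = σ
  exts (suc k) σ = exts₁ (exts k σ)

  mutual
    subst : (ℕ → 𝔼) → 𝔼 → 𝔼
    subst σ (var x)                  = σ x
    subst σ (app s t)                = app (subst σ s) (subst σ t)
    subst σ (lam s)                  = lam (subst (exts 1 σ) s)
    subst σ (letrec^ {k} tt bs t)    = letrec (subst* (exts (suc k) σ) bs) (subst (exts (suc k) σ) t)
    subst σ (con T c ss)             = con T c (subst* σ ss)
    subst σ (seq s t)                = seq (subst σ s) (subst σ t)
    subst σ (case T s alts)          = case T (subst σ s) (substAlts (ar T) σ alts)

    subst* : ∀ {n} → (ℕ → 𝔼) → Vec 𝔼 n → Vec 𝔼 n
    subst* σ []       = []
    subst* σ (s ∷ ss) = subst σ s ∷ subst* σ ss

    substAlts : ∀ {n} → (Fin n → ℕ) → (ℕ → 𝔼) → Vec 𝔼 n → Vec 𝔼 n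
    substAlts ars σ []       = []
    substAlts ars σ (s ∷ ss) = subst (exts (ars zero) σ) s ∷ substAlts (λ i → ars (suc i)) σ ss

  instantiate : ∀ {k} → Vec 𝔼 k → ℕ → 𝔼
  instantiate []       x       = var x
  instantiate (s ∷ ss) zero    = s
  instantiate (s ∷ ss) (suc x) = instantiate ss x

  -- t [ ss ] simultaneously replaces the indices 0 … k-1 of t by ss and lowers
  -- the indices above by k.
  _[_] : ∀ {k} → 𝔼 → Vec 𝔼 k → 𝔼
  t [ ss ] = subst (instantiate ss) t

  ------------------------------------------------------------------------
  -- The contexts ℂ of the contextual preorders.  They bind variables by name,
  -- and C ⟪ s ⟫ captures the free variables of s that C binds above its hole.

  -- The named variables xs become the bound indices 0 … k-1; any other free
  -- variable keeps its name, that is, y becomes the index k + y.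
  close : ∀ {k} → Vec ℕ k → ℕ → ℕ
  close []       y = y
  close (x ∷ xs) y = if does (y ≟ x) then zero else suc (close xs y)

  -- In letrecᵇ, conᵃ and caseᵃ the hole is at position i of the vector, whose
  -- own entry at i is ignored.  The other alternatives in caseᵃ are
  -- α-equivalence classes, so only the one with the hole has named variables.
  data ℂ : Set where
    hole    : ℂ
    appˡ    : ℂ → 𝔼 → ℂ
    appʳ    : 𝔼 → ℂ → ℂ
    lamᵇ    : ℕ → ℂ → ℂ
    letrecⁱ : ∀ {k} (xs : Vec ℕ (suc k)) → Unique xs → Vec 𝔼 (suc k) → ℂ → ℂ
    letrecᵇ : ∀ {k} (xs : Vec ℕ (suc k)) → Unique xs → Vec 𝔼 (suc k) → (i : Fin (suc k)) → ℂ → 𝔼 → ℂ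
    conᵃ    : ∀ T c → Vec 𝔼 (ar T c) → (i : Fin (ar T c)) → ℂ → ℂ
    seqˡ    : ℂ → 𝔼 → ℂ
    seqʳ    : 𝔼 → ℂ → ℂ
    caseˢ   : ∀ T → ℂ → Vec 𝔼 (size T) → ℂ
    caseᵃ   : ∀ T → 𝔼 → Vec 𝔼 (size T) → ∀ i (ys : Vec ℕ (ar T i)) → Unique ys → ℂ → ℂ

  _⟪_⟫ : ℂ → 𝔼 → 𝔼
  hole                    ⟪ s ⟫ = s
  appˡ C t                ⟪ s ⟫ = app (C ⟪ s ⟫) t
  appʳ t C                ⟪ s ⟫ = app t (C ⟪ s ⟫)
  lamᵇ x C                ⟪ s ⟫ = lam (rename (close (x ∷ [])) (C ⟪ s ⟫))
  letrecⁱ xs _ bs C       ⟪ s ⟫ = letrec (rename* (close xs) bs) (rename (close xs) (C ⟪ s ⟫))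
  letrecᵇ xs _ bs i C t   ⟪ s ⟫ = letrec (rename* (close xs) (bs [ i ]≔ C ⟪ s ⟫)) (rename (close xs) t)
  conᵃ T c ss i C         ⟪ s ⟫ = con T c (ss [ i ]≔ C ⟪ s ⟫)
  seqˡ C t                ⟪ s ⟫ = seq (C ⟪ s ⟫) t
  seqʳ t C                ⟪ s ⟫ = seq t (C ⟪ s ⟫)
  caseˢ T C alts          ⟪ s ⟫ = case T (C ⟪ s ⟫) alts
  caseᵃ T t alts i ys _ C ⟪ s ⟫ = case T t (alts [ i ]≔ rename (close ys) (C ⟪ s ⟫))

  ------------------------------------------------------------------------
  -- The contexts C[·] displayed in reduction rules, as de Bruijn contexts:
  -- C ⟦ s ⟧ leaves the indices of s untouched, so a variable that has index x
  -- outside C has index depth C + x at the hole.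

  data Ctx (A : Set) : Set where
    hole    : Ctx A
    appˡ    : A → Ctx A → Exp A → Ctx A
    appʳ    : A → Exp A → Ctx A → Ctx A
    lamᵇ    : A → Ctx A → Ctx A
    letrecⁱ : ∀ {k} → A → Vec (Exp A) (suc k) → Ctx A → Ctx A
    letrecᵇ : ∀ {k} → A → Vec (Exp A) (suc k) → (i : Fin (suc k)) → Ctx A → Exp A → Ctx A
    conᵃ    : A → ∀ T c → Vec (Exp A) (ar T c) → (i : Fin (ar T c)) → Ctx A → Ctx A
    seqˡ    : A → Ctx A → Exp A → Ctx A
    seqʳ    : A → Exp A → Ctx A → Ctx A
    caseˢ   : A → ∀ T → Ctx A → Vec (Exp A) (size T) → Ctx A
    caseᵃ   : A → ∀ T → Exp A → Vec (Exp A) (size T) → (i : Fin (size T)) → Ctx A → Ctx A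

  _⟦_⟧ : ∀ {A} → Ctx A → Exp A → Exp A
  hole                 ⟦ s ⟧ = s
  appˡ a C t           ⟦ s ⟧ = app^ a (C ⟦ s ⟧) t
  appʳ a t C           ⟦ s ⟧ = app^ a t (C ⟦ s ⟧)
  lamᵇ a C             ⟦ s ⟧ = lam^ a (C ⟦ s ⟧)
  letrecⁱ a bs C       ⟦ s ⟧ = letrec^ a bs (C ⟦ s ⟧)
  letrecᵇ a bs i C t   ⟦ s ⟧ = letrec^ a (bs [ i ]≔ C ⟦ s ⟧) t
  conᵃ a T c ss i C    ⟦ s ⟧ = con^ a T c (ss [ i ]≔ C ⟦ s ⟧)
  seqˡ a C t           ⟦ s ⟧ = seq^ a (C ⟦ s ⟧) t
  seqʳ a t C           ⟦ s ⟧ = seq^ a t (C ⟦ s ⟧)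
  caseˢ a T C alts     ⟦ s ⟧ = case^ a T (C ⟦ s ⟧) alts
  caseᵃ a T t alts i C ⟦ s ⟧ = case^ a T t (alts [ i ]≔ C ⟦ s ⟧)

  depth : ∀ {A} → Ctx A → ℕ
  depth hole                    = 0
  depth (appˡ _ C _)            = depth C
  depth (appʳ _ _ C)            = depth C
  depth (lamᵇ _ C)              = depth C + 1
  depth (letrecⁱ {k} _ _ C)     = depth C + suc k
  depth (letrecᵇ {k} _ _ _ C _) = depth C + suc k
  depth (conᵃ _ _ _ _ _ C)      = depth C
  depth (seqˡ _ C _)            = depth C
  depth (seqʳ _ _ C)            = depth C
  depth (caseˢ _ _ C _)         = depth C
  depth (caseᵃ _ T _ _ i C)     = depth C + ar T i

  renameᶜ : ∀ {A} → (ℕ → ℕ) → Ctx A → Ctx A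
  renameᶜ ρ hole                     = hole
  renameᶜ ρ (appˡ a C t)             = appˡ a (renameᶜ ρ C) (rename ρ t)
  renameᶜ ρ (appʳ a t C)             = appʳ a (rename ρ t) (renameᶜ ρ C)
  renameᶜ ρ (lamᵇ a C)               = lamᵇ a (renameᶜ (ext 1 ρ) C)
  renameᶜ ρ (letrecⁱ {k} a bs C)     =
    letrecⁱ a (rename* (ext (suc k) ρ) bs) (renameᶜ (ext (suc k) ρ) C)
  renameᶜ ρ (letrecᵇ {k} a bs i C t) =
    letrecᵇ a (rename* (ext (suc k) ρ) bs) i (renameᶜ (ext (suc k) ρ) C) (rename (ext (suc k) ρ) t)
  renameᶜ ρ (conᵃ a T c ss i C)      = conᵃ a T c (rename* ρ ss) i (renameᶜ ρ C)
  renameᶜ ρ (seqˡ a C t)             = seqˡ a (renameᶜ ρ C) (rename ρ t)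
  renameᶜ ρ (seqʳ a t C)             = seqʳ a (rename ρ t) (renameᶜ ρ C)
  renameᶜ ρ (caseˢ a T C alts)       = caseˢ a T (renameᶜ ρ C) (renameAlts (ar T) ρ alts)
  renameᶜ ρ (caseᵃ a T t alts i C)   =
    caseᵃ a T (rename ρ t) (renameAlts (ar T) ρ alts) i (renameᶜ (ext (ar T i) ρ) C)

  -- Chain bs x₁ xₘ xs: bs contains the bindings x₂ = x₁, …, xₘ = xₘ₋₁, and
  -- xs = xₘ, …, x₁.
  data Chain {A : Set} {k} (bs : Vec (Exp A) k) (x₁ : Fin k) : Fin k → List (Fin k) → Set where
    start : Chain bs x₁ x₁ (x₁ ∷ [])
    next  : ∀ {a x y xs} → Chain bs x₁ x xs → lookup bs y ≡ var^ a (toℕ x) → Chain bs x₁ y (y ∷ xs)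

  ------------------------------------------------------------------------
  -- The calculus L_LR, stage 1: labelling

  Label Labels : Set
  Label  = Fin 4
  Labels = Subset 4

  pattern 𝐒 = 0F
  pattern 𝐓 = 1F
  pattern 𝐕 = 2F
  pattern 𝐖 = 3F

  LExp LCtx : Set
  LExp = Exp Labels
  LCtx = Ctx Labels

  _⟨_↦_⟩ : Labels → Label → Label → Labels
  ℓ ⟨ a ↦ b ⟩ = (ℓ - a) ∪ ⁅ b ⁆

  mark : Label → LExp → LExp
  mark a = reannotate (_∪ ⁅ a ⁆)

  unlabelled : 𝔼 → LExp
  unlabelled = mapAnn (λ _ → ∅)

  erase : LExp → 𝔼
  erase = mapAnn (λ _ → tt)

  data S∨T : Label → Set where
    isS : S∨T 𝐒
    isT : S∨T 𝐓

  data Failʳ : LExp → Set where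
    fail-visited : ∀ {k m ℓ t} {bs : Vec LExp (suc k)} {x y} C → x ≢ y →
      𝐕 ∈ annotation (lookup bs x) ⊎ 𝐖 ∈ annotation (lookup bs x) →
      𝐒 ∈ ℓ → lookup bs y ≡ C ⟦ var^ ℓ (depth C + toℕ x) ⟧ →
      Failʳ (letrec^ m bs t)
    fail-self : ∀ {k m ℓ t} {bs : Vec LExp (suc k)} {x} C →
      𝐒 ∈ ℓ → lookup bs x ≡ C ⟦ var^ ℓ (depth C + toℕ x) ⟧ →
      Failʳ (letrec^ m bs t)

  data Fail : LExp → Set where
    inside : ∀ (C : LCtx) {s} → Failʳ s → Fail (C ⟦ s ⟧)

  data _⇝ʳ_ : LExp → LExp → Set where
    top-letrec : ∀ {k ℓ s} {bs : Vec LExp (suc k)} → 𝐓 ∈ ℓ →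
      letrec^ ℓ bs s ⇝ʳ letrec^ (ℓ ⟨ 𝐓 ↦ 𝐕 ⟩) bs (mark 𝐒 s)
    into-app : ∀ {a ℓ s t} → S∨T a → a ∈ ℓ →
      app^ ℓ s t ⇝ʳ app^ (ℓ ⟨ a ↦ 𝐕 ⟩) (mark 𝐒 s) t
    into-seq : ∀ {a ℓ s t} → S∨T a → a ∈ ℓ →
      seq^ ℓ s t ⇝ʳ seq^ (ℓ ⟨ a ↦ 𝐕 ⟩) (mark 𝐒 s) t
    into-case : ∀ {a ℓ T s alts} → S∨T a → a ∈ ℓ →
      case^ ℓ T s alts ⇝ʳ case^ (ℓ ⟨ a ↦ 𝐕 ⟩) T (mark 𝐒 s) alts
    var-in : ∀ {k m ℓ} {bs : Vec LExp (suc k)} {x} C → 𝐒 ∈ ℓ →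
      letrec^ m bs (C ⟦ var^ ℓ (depth C + toℕ x) ⟧) ⇝ʳ
      letrec^ m (updateAt bs x (mark 𝐒)) (C ⟦ var^ (ℓ ⟨ 𝐒 ↦ 𝐕 ⟩) (depth C + toℕ x) ⟧)
    var-e : ∀ {k m ℓ t} {bs : Vec LExp (suc k)} {x y} C → C ≢ hole → x ≢ y → 𝐒 ∈ ℓ →
      lookup bs y ≡ C ⟦ var^ ℓ (depth C + toℕ x) ⟧ →
      letrec^ m bs t ⇝ʳ
      letrec^ m (updateAt (bs [ y ]≔ C ⟦ var^ (ℓ ⟨ 𝐒 ↦ 𝐕 ⟩) (depth C + toℕ x) ⟧) x (mark 𝐒)) t
    var-chain : ∀ {k m ℓ t} {bs : Vec LExp (suc k)} {x y} → x ≢ y → 𝐒 ∈ ℓ →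
      lookup bs y ≡ var^ ℓ (toℕ x) →
      letrec^ m bs t ⇝ʳ
      letrec^ m (updateAt (bs [ y ]≔ var^ (ℓ ⟨ 𝐒 ↦ 𝐖 ⟩) (toℕ x)) x (mark 𝐒)) t

  data _⇝_ : LExp → LExp → Set where
    inside : ∀ (C : LCtx) {s t} → ¬ Fail (C ⟦ s ⟧) → s ⇝ʳ t → C ⟦ s ⟧ ⇝ C ⟦ t ⟧

  -- Labelling s terminates without failure in the labelled expression l.
  Labelling : 𝔼 → LExp → Set
  Labelling s l = Star _⇝_ (mark 𝐓 (unlabelled s)) l × ¬ Fail l × (∀ l′ → ¬ (l ⇝ l′))

  ------------------------------------------------------------------------
  -- Stage 2.  Labels of the result are irrelevant: they are erased afterwards.

  letrec* : ∀ {k} → Labels → Vec LExp k → LExp → LExp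
  letrec* {zero}  a _  t = t
  letrec* {suc k} a bs t = letrec^ a bs t

  -- The new environment of (case-in) and (case-e).  The fresh y₁ … y_K are put
  -- in front of the environment bs′, which is already shifted by K = ar T c.
  open-con : ∀ {k} T c → Vec LExp (ar T c) → Vec LExp k → Fin k → Vec LExp (ar T c + k)
  open-con T c ss bs′ x₁ =
    shift* (ar T c) ss ++ (bs′ [ x₁ ]≔ con^ ∅ T c (tabulate λ i → var^ ∅ (toℕ i)))

  -- C[letrec z₁ = y₁, …, z_K = y_K in t], with C and t shifted by K = ar T c to
  -- make room for the fresh y₁ … y_K.
  select : ∀ T c → LCtx → Vec LExp (size T) → LExp
  select T c C alts = renameᶜ (K +_) C ⟦
      letrec* ∅ (tabulate {n = K} λ i → var^ ∅ (K + (depth C + toℕ i)))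
                (rename (ext (K + depth C) (K +_)) (lookup alts c)) ⟧
    where K = ar T c

  data _▷_ : LExp → LExp → Set where
    lbeta : ∀ {a ℓ s t} C → 𝐒 ∈ ℓ →
      (C ⟦ app^ a (lam^ ℓ s) t ⟧) ▷ (C ⟦ letrec^ ∅ (shift 1 t ∷ []) s ⟧)

    cp-in : ∀ {k a ℓ m s xs} {bs : Vec LExp (suc k)} {x₁ xₘ} C →
      lookup bs x₁ ≡ lam^ ℓ s → 𝐒 ∈ ℓ → Chain bs x₁ xₘ xs → 𝐕 ∈ m →
      letrec^ a bs (C ⟦ var^ m (depth C + toℕ xₘ) ⟧) ▷
      letrec^ a bs (C ⟦ shift (depth C) (lam^ ℓ s) ⟧)
    cp-e : ∀ {k a ℓ m s t xs} {bs : Vec LExp (suc k)} {x₁ xₘ y} C →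
      lookup bs x₁ ≡ lam^ ℓ s → 𝐒 ∈ ℓ → Chain bs x₁ xₘ xs → 𝐕 ∈ m → y ∉ᴸ xs →
      lookup bs y ≡ C ⟦ var^ m (depth C + toℕ xₘ) ⟧ →
      letrec^ a bs t ▷
      letrec^ a (bs [ y ]≔ C ⟦ shift (depth C) (lam^ ℓ s) ⟧) t

    lapp : ∀ {k a ℓ s t} {bs : Vec LExp (suc k)} C → 𝐒 ∈ ℓ →
      (C ⟦ app^ a (letrec^ ℓ bs s) t ⟧) ▷ (C ⟦ letrec^ ℓ bs (app^ a s (shift (suc k) t)) ⟧)
    lcase : ∀ {k a ℓ T s alts} {bs : Vec LExp (suc k)} C → 𝐒 ∈ ℓ →
      (C ⟦ case^ a T (letrec^ ℓ bs s) alts ⟧) ▷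
      (C ⟦ letrec^ ℓ bs (case^ a T s (shiftAlts T (suc k) alts)) ⟧)
    lseq : ∀ {k a ℓ s t} {bs : Vec LExp (suc k)} C → 𝐒 ∈ ℓ →
      (C ⟦ seq^ a (letrec^ ℓ bs s) t ⟧) ▷ (C ⟦ letrec^ ℓ bs (seq^ a s (shift (suc k) t)) ⟧)

    llet-in : ∀ {k₁ k₂ a ℓ s} {bs₁ : Vec LExp (suc k₁)} {bs₂ : Vec LExp (suc k₂)} → 𝐒 ∈ ℓ →
      letrec^ a bs₁ (letrec^ ℓ bs₂ s) ▷ letrec^ a (bs₂ ++ shift* (suc k₂) bs₁) s
    llet-e : ∀ {k₁ k₂ a ℓ s t} {bs₁ : Vec LExp (suc k₁)} {bs₂ : Vec LExp (suc k₂)} {x} →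
      lookup bs₁ x ≡ letrec^ ℓ bs₂ s → 𝐒 ∈ ℓ →
      letrec^ a bs₁ t ▷
      letrec^ a (bs₂ ++ (shift* (suc k₂) bs₁ [ x ]≔ s)) (shift (suc k₂) t)

    seq-c : ∀ {a v s} C → Value v → 𝐒 ∈ annotation v →
      (C ⟦ seq^ a v s ⟧) ▷ (C ⟦ s ⟧)
    seq-in : ∀ {k a b ℓ m T c ss s xs} {bs : Vec LExp (suc k)} {x₁ xₘ} C →
      lookup bs x₁ ≡ con^ ℓ T c ss → 𝐒 ∈ ℓ → Chain bs x₁ xₘ xs → 𝐕 ∈ m →
      letrec^ a bs (C ⟦ seq^ b (var^ m (depth C + toℕ xₘ)) s ⟧) ▷
      letrec^ a bs (C ⟦ s ⟧)
    seq-e : ∀ {k a b ℓ m T c ss s t xs} {bs : Vec LExp (suc k)} {x₁ xₘ y} C →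
      lookup bs x₁ ≡ con^ ℓ T c ss → 𝐒 ∈ ℓ → Chain bs x₁ xₘ xs → 𝐕 ∈ m → y ∉ᴸ xs →
      lookup bs y ≡ C ⟦ seq^ b (var^ m (depth C + toℕ xₘ)) s ⟧ →
      letrec^ a bs t ▷
      letrec^ a (bs [ y ]≔ C ⟦ s ⟧) t

    case-c : ∀ {a ℓ T c ss alts} C → 𝐒 ∈ ℓ →
      (C ⟦ case^ a T (con^ ℓ T c ss) alts ⟧) ▷
      (C ⟦ letrec* ∅ (shift* (ar T c) ss) (lookup alts c) ⟧)
    case-in : ∀ {k a b ℓ m T c ss alts xs} {bs : Vec LExp (suc k)} {x₁ xₘ} C →
      lookup bs x₁ ≡ con^ ℓ T c ss → 𝐒 ∈ ℓ → Chain bs x₁ xₘ xs → 𝐕 ∈ m →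
      letrec^ a bs (C ⟦ case^ b T (var^ m (depth C + toℕ xₘ)) alts ⟧) ▷
      letrec* a (open-con T c ss (shift* (ar T c) bs) x₁) (select T c C alts)
    case-e : ∀ {k a b ℓ m T c ss alts r xs} {bs : Vec LExp (suc k)} {x₁ xₘ u} C →
      lookup bs x₁ ≡ con^ ℓ T c ss → 𝐒 ∈ ℓ → Chain bs x₁ xₘ xs → 𝐕 ∈ m → u ∉ᴸ xs →
      lookup bs u ≡ C ⟦ case^ b T (var^ m (depth C + toℕ xₘ)) alts ⟧ →
      letrec^ a bs r ▷
      letrec* a (open-con T c ss (shift* (ar T c) bs [ u ]≔ select T c C alts) x₁)
                (shift (ar T c) r)

  _⟶ᴸᴿ_ : 𝔼 → 𝔼 → Set
  s ⟶ᴸᴿ t = ∃₂ λ l l′ → Labelling s l × l ▷ l′ × erase l′ ≡ t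

  data Answerᴸᴿ : 𝔼 → Set where
    value        : ∀ {v} → Value v → Answerᴸᴿ v
    letrec-value : ∀ {k} {bs : Vec 𝔼 (suc k)} {v} → Value v → Answerᴸᴿ (letrec bs v)
    letrec-con   : ∀ {k} {bs : Vec 𝔼 (suc k)} {T c ss x₁ xₘ xs} →
      lookup bs x₁ ≡ con T c ss → Chain bs x₁ xₘ xs → Answerᴸᴿ (letrec bs (var (toℕ xₘ)))

  ------------------------------------------------------------------------
  -- The calculus L_name

  data LetCtx : Set where
    holeᴸ   : LetCtx
    letrecᴸ : ∀ {k} → Vec 𝔼 (suc k) → LetCtx → LetCtx

  data AppCtx : Set where
    holeᴬ : AppCtx
    appᴬ  : AppCtx → 𝔼 → AppCtx
    caseᴬ : ∀ T → AppCtx → Vec 𝔼 (size T) → AppCtx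
    seqᴬ  : AppCtx → 𝔼 → AppCtx

  infix 5 _∘ᴿ_
  data RedCtx : Set where
    _∘ᴿ_ : LetCtx → AppCtx → RedCtx

  _⟦_⟧ᴸ : LetCtx → 𝔼 → 𝔼
  holeᴸ        ⟦ s ⟧ᴸ = s
  letrecᴸ bs L ⟦ s ⟧ᴸ = letrec bs (L ⟦ s ⟧ᴸ)

  _⟦_⟧ᴬ : AppCtx → 𝔼 → 𝔼
  holeᴬ          ⟦ s ⟧ᴬ = s
  appᴬ A t       ⟦ s ⟧ᴬ = app (A ⟦ s ⟧ᴬ) t
  caseᴬ T A alts ⟦ s ⟧ᴬ = case T (A ⟦ s ⟧ᴬ) alts
  seqᴬ A t       ⟦ s ⟧ᴬ = seq (A ⟦ s ⟧ᴬ) t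

  _⟦_⟧ᴿ : RedCtx → 𝔼 → 𝔼
  (L ∘ᴿ A) ⟦ s ⟧ᴿ = L ⟦ A ⟦ s ⟧ᴬ ⟧ᴸ

  depthᴸ : LetCtx → ℕ
  depthᴸ holeᴸ             = 0
  depthᴸ (letrecᴸ {k} _ L) = depthᴸ L + suc k

  depthᴿ : RedCtx → ℕ
  depthᴿ (L ∘ᴿ A) = depthᴸ L

  data _⟶ⁿ_ : 𝔼 → 𝔼 → Set where
    betaⁿ : ∀ {s t} R → (R ⟦ app (lam s) t ⟧ᴿ) ⟶ⁿ (R ⟦ s [ t ∷ [] ] ⟧ᴿ)
    gcpⁿ : ∀ {k} {bs : Vec 𝔼 (suc k)} {x} L R →
      (L ⟦ letrec bs (R ⟦ var (depthᴿ R + toℕ x) ⟧ᴿ) ⟧ᴸ) ⟶ⁿ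
      (L ⟦ letrec bs (R ⟦ shift (depthᴿ R) (lookup bs x) ⟧ᴿ) ⟧ᴸ)
    lappⁿ : ∀ {k s t} {bs : Vec 𝔼 (suc k)} R →
      (R ⟦ app (letrec bs s) t ⟧ᴿ) ⟶ⁿ (R ⟦ letrec bs (app s (shift (suc k) t)) ⟧ᴿ)
    lcaseⁿ : ∀ {k T s alts} {bs : Vec 𝔼 (suc k)} R →
      (R ⟦ case T (letrec bs s) alts ⟧ᴿ) ⟶ⁿ
      (R ⟦ letrec bs (case T s (shiftAlts T (suc k) alts)) ⟧ᴿ)
    lseqⁿ : ∀ {k s t} {bs : Vec 𝔼 (suc k)} R →
      (R ⟦ seq (letrec bs s) t ⟧ᴿ) ⟶ⁿ (R ⟦ letrec bs (seq s (shift (suc k) t)) ⟧ᴿ)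
    seqⁿ : ∀ {v s} R → Value v → (R ⟦ seq v s ⟧ᴿ) ⟶ⁿ (R ⟦ s ⟧ᴿ)
    caseⁿ : ∀ {T c ss alts} R →
      (R ⟦ case T (con T c ss) alts ⟧ᴿ) ⟶ⁿ (R ⟦ lookup alts c [ ss ] ⟧ᴿ)

  data Answerⁿ : 𝔼 → Set where
    answer : ∀ L {v} → Value v → Answerⁿ (L ⟦ v ⟧ᴸ)

  module Contextual (_⟶_ : 𝔼 → 𝔼 → Set) (Answer : 𝔼 → Set) where
    infix 4 _↓ _≤_ _∼_

    _↓ : 𝔼 → Set
    s ↓ = ∃ λ v → Star _⟶_ s v × Answer v

    _≤_ : 𝔼 → 𝔼 → Set
    s ≤ t = ∀ (C : ℂ) → C ⟪ s ⟫ ↓ → C ⟪ t ⟫ ↓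

    _∼_ : 𝔼 → 𝔼 → Set
    s ∼ t = s ≤ t × t ≤ s

  open Contextual _⟶ᴸᴿ_ Answerᴸᴿ public
    renaming (_↓ to _↓ᴸᴿ; _≤_ to _≤ᴸᴿ_; _∼_ to _∼ᴸᴿ_)
  open Contextual _⟶ⁿ_ Answerⁿ public
    renaming (_↓ to _↓ⁿ; _≤_ to _≤ⁿ_; _∼_ to _∼ⁿ_)

  -- Both calculi have the expressions 𝔼 and the contexts ℂ; the translation is
  -- the identity on both.
  W : 𝔼 → 𝔼
  W s = s

  Wᶜ : ℂ → ℂ
  Wᶜ C = C

{-# OPTIONS --safe #-}
module Submission where

open import Defs
open import Data.Product.Base using (_×_)
open import Function.Bundles using (_⇔_)
open import Function.Structures using (IsBijection)

open import Data.Empty using (⊥; ⊥-elim)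
open import Data.Fin.Base using (Fin; zero; suc; toℕ; fromℕ<; _↑ʳ_; _↑ˡ_)
open import Data.Fin.Properties using (toℕ<n; toℕ-fromℕ<; toℕ-↑ʳ; toℕ-↑ˡ; ↑ʳ-injective; toℕ-injective)
  renaming (_≟_ to _≟ᶠ_)
open import Data.Fin.Subset using (⁅_⁆; _∪_) renaming (⊥ to ∅; _∈_ to _∈ˢ_; _∉_ to _∉ˢ_)
open import Data.Fin.Subset.Properties using (∉⊥)
open import Data.List.Base using (List; []; _∷_) renaming (_++_ to _++ᴸ_)
open import Data.List.Membership.Propositional using (_∈_; _∉_)
open import Data.List.Membership.Propositional.Properties using (∈-++⁺ˡ; ∈-++⁺ʳ; ∈-++⁻)
open import Data.List.Relation.Unary.Any using (here; there)
open import Data.Nat.Base using (ℕ; zero; suc; _+_; _≤_; _<_; z≤n; s≤s)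
open import Data.Nat.Induction using (<-wellFounded)
open import Data.Nat.Properties
open import Data.Product.Base using (∃; ∃₂; Σ; _,_; proj₁; proj₂)
open import Data.Sum.Base using (_⊎_; inj₁; inj₂)
open import Data.Unit.Base using (⊤; tt)
open import Data.Vec.Base using (Vec; []; _∷_; here; there; lookup; _++_; _[_]≔_; tabulate; updateAt)
open import Data.Vec.Properties using (lookup∘update; lookup∘update′; lookup∘updateAt; lookup∘updateAt′;
  lookup∘tabulate; lookup-++ʳ; lookup-++ˡ; []≔-commutes; []≔-++-↑ʳ; []≔-lookup)
open import Function.Base using (_∘_; id)
open import Function.Bundles using (mk⇔)
open import Induction.WellFounded using (Acc; acc; acc⇒asym)
open import Level using (Lift; lift) renaming (suc to lsuc; zero to lzero)
open import Relation.Binary.Construct.Closure.ReflexiveTransitive using (Star; ε; _◅_; _◅◅_; gmap)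
open import Relation.Binary.Construct.Closure.Transitive using (TransClosure; _∷_; accessible)
  renaming ([_] to single)
open import Relation.Binary.PropositionalEquality
  using (_≡_; _≢_; refl; sym; trans; cong; cong₂; module ≡-Reasoning) renaming (subst to ≡-subst)
open import Relation.Nullary.Decidable.Core using (Dec; yes; no)
open import Relation.Nullary.Negation.Core using (¬_)

-- Both calculi are compared with one denotational model of expressions.  A
-- denotation is an upward closed set of pairs (observation, cost); observations
-- are idempotent intersection types in which every assumption on an argument
-- carries the cost of evaluating that argument by name, so that the cost of a
-- derivation is a call-by-name cost.  A letrec is a least fixpoint.
--
-- If nothing costs anything, every rule of both calculi is an equation that is
-- preserved by all contexts, so a converging expression has an observation.  A
-- logical relation turns this observation into one of finite cost when app, seq,
-- case (and, for L_name, a variable lookup) cost 1.  Under those costs an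
-- expression with an observation is an answer or takes a normal-order step which
-- lowers the cost, or keeps it and lowers a weight.  For L_LR the step reduces a
-- shared binding; the cost drops because the evaluation of the body is strict
-- in every binding that labelling reaches, and labelling does not fail because
-- such bindings cannot depend on themselves in a least fixpoint.

-- The costs 1 1 for `L_name` and 1 0 for `L_LR` reflect what each calculus duplicates. (gcp) copies
-- an arbitrary expression, so the weight may grow and the lookup itself has to cost 1; (beta) and
-- (case) of `L_name` substitute, hence create no new lookups that would raise the cost. In `L_LR`,
-- (lbeta) and the case rules bind arguments to variables and thus add lookups. There a lookup has
-- to be free, and copying stays under control because only abstractions are copied, which weigh
-- less than the variable they replace. A by-name cost suits a calculus with sharing because sharing
-- only saves: a shared redex is paid for at each use, so reducing it once lowers the cost as soon
-- as it is used at all. The cost-free model is where the two calculi meet: convergence in either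
-- one yields an observation there, and each calculus is then reached through its own costed model.
-- No reduction sequence of one calculus is translated into a sequence of the other.

module Adequacy (𝒮 : Signature) where
  open Signature 𝒮
  open Calculi 𝒮

  private variable A B : Set

  -- An entry (x , τ , m) of a fragment F says that the variable x can be observed as τ
  -- at cost m.  In F ⇒ τ the argument is variable 0, in conᵒ T c F the i-th component is
  -- variable i; entries for further variables only add constraints.
  data Obs : Set where
    fun  : Obs
    _⇒_  : List (ℕ × Obs × ℕ) → Obs → Obs
    conᵒ : ∀ T → Fin (size T) → List (ℕ × Obs × ℕ) → Obs

  Fragment : Set
  Fragment = List (ℕ × Obs × ℕ)

  -- Denotations, environments and their order

  record D : Set₁ where
    no-eta-equality
    field
      has : Obs → ℕ → Set
      up  : ∀ {τ m n} → m ≤ n → has τ m → has τ n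
  open D

  Env : Set₁
  Env = ℕ → D

  infix 4 _⊆_ _⊑_ _≈_ _≋_

  record _⊆_ (d e : D) : Set where
    constructor incl
    field to : ∀ {τ n} → has d τ n → has e τ n
  open _⊆_

  record _≈_ (d e : D) : Set where
    constructor _,_
    field
      fwd : d ⊆ e
      bwd : e ⊆ d
  open _≈_

  _⊑_ _≋_ : Env → Env → Set
  ρ ⊑ ρ′ = ∀ x → ρ x ⊆ ρ′ x
  ρ ≋ ρ′ = ∀ x → ρ x ≈ ρ′ x

  ⊆-refl : ∀ {d} → d ⊆ d
  ⊆-refl = incl id

  ⊆-trans : ∀ {d e f} → d ⊆ e → e ⊆ f → d ⊆ f
  ⊆-trans p q = incl (to q ∘ to p)

  ⊆-reflexive : ∀ {d e} → d ≡ e → d ⊆ e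
  ⊆-reflexive refl = ⊆-refl

  ≈-refl : ∀ {d} → d ≈ d
  ≈-refl = ⊆-refl , ⊆-refl

  ≈-sym : ∀ {d e} → d ≈ e → e ≈ d
  ≈-sym (p , q) = q , p

  ≈-trans : ∀ {d e f} → d ≈ e → e ≈ f → d ≈ f
  ≈-trans (p , q) (p′ , q′) = ⊆-trans p p′ , ⊆-trans q′ q

  ≈-reflexive : ∀ {d e} → d ≡ e → d ≈ e
  ≈-reflexive refl = ≈-refl

  ∅ᴰ : D
  has ∅ᴰ _ _ = ⊥
  up ∅ᴰ _ ()

  -- The finite elements of the domain of environments: a fragment generates the least environment
  -- that contains it and is upward closed in the cost.
  entries : Fragment → Env
  has (entries F x) τ n = ∃ λ m → m ≤ n × (x , τ , m) ∈ F
  up (entries F x) p (m , q , i) = m , ≤-trans q p , i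

  entries-⊑ : ∀ {F ρ} → (∀ {x τ n} → (x , τ , n) ∈ F → has (ρ x) τ n) → entries F ⊑ ρ
  entries-⊑ {ρ = ρ} f x = incl λ (m , p , i) → up (ρ x) p (f i)

  later : D → D
  has (later d) τ zero    = ⊥
  has (later d) τ (suc n) = has d τ n
  up (later d) {m = suc m} {suc n} (s≤s p) = up d p

  delay : ℕ → D → D
  delay zero    d = d
  delay (suc k) d = later (delay k d)

  later-mono : ∀ {d e} → d ⊆ e → later d ⊆ later e
  later-mono p = incl λ { {n = suc n} → to p }

  later-⊆ : ∀ {d} → later d ⊆ d
  later-⊆ {d} = incl λ { {n = suc n} → up d (n≤1+n n) }

  delay-mono : ∀ k {d e} → d ⊆ e → delay k d ⊆ delay k e
  delay-mono zero    p = p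
  delay-mono (suc k) p = later-mono (delay-mono k p)

  delay-cong : ∀ k {d e} → d ≈ e → delay k d ≈ delay k e
  delay-cong k (p , q) = delay-mono k p , delay-mono k q

  delay-intro : ∀ k d {τ n} → has d τ n → has (delay k d) τ (k + n)
  delay-intro zero    d p = p
  delay-intro (suc k) d p = delay-intro k d p

  delay-elim : ∀ k d {τ n} → has (delay k d) τ n → ∃ λ m → n ≡ k + m × has d τ m
  delay-elim zero    d p = _ , refl , p
  delay-elim (suc k) d {n = suc n} p with m , refl , q ← delay-elim k d p = m , refl , q

  splice : ℕ → Env → Env → Env
  splice zero    δ ρ x       = ρ x
  splice (suc k) δ ρ zero    = δ zero
  splice (suc k) δ ρ (suc x) = splice k (δ ∘ suc) ρ x

  splice-tail : ∀ k {δ ρ} x → splice k δ ρ (k + x) ≡ ρ x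
  splice-tail zero    x = refl
  splice-tail (suc k) x = splice-tail k x

  splice-head : ∀ k {δ ρ} x → x < k → splice k δ ρ x ≡ δ x
  splice-head (suc k) zero    _       = refl
  splice-head (suc k) (suc x) (s≤s p) = splice-head k x p

  splice-⊑ : ∀ k {δ ρ E} → (∀ x → x < k → δ x ⊆ E x) → (∀ x → ρ x ⊆ E (k + x)) → splice k δ ρ ⊑ E
  splice-⊑ zero    p q x       = q x
  splice-⊑ (suc k) p q zero    = p zero (s≤s z≤n)
  splice-⊑ (suc k) p q (suc x) = splice-⊑ k (λ y y<k → p (suc y) (s≤s y<k)) q x

  ⊑-splice : ∀ k {δ ρ E} → (∀ x → x < k → E x ⊆ δ x) → (∀ x → E (k + x) ⊆ ρ x) → E ⊑ splice k δ ρ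
  ⊑-splice zero    p q x       = q x
  ⊑-splice (suc k) p q zero    = p zero (s≤s z≤n)
  ⊑-splice (suc k) p q (suc x) = ⊑-splice k (λ y y<k → p (suc y) (s≤s y<k)) q x

  splice-≋ : ∀ k {δ ρ E} → (∀ x → x < k → δ x ≈ E x) → (∀ x → ρ x ≈ E (k + x)) → splice k δ ρ ≋ E
  splice-≋ k p q x =
    splice-⊑ k (λ y l → fwd (p y l)) (fwd ∘ q) x , ⊑-splice k (λ y l → bwd (p y l)) (bwd ∘ q) x

  splice-cong : ∀ k {δ δ′ ρ ρ′} → δ ≋ δ′ → ρ ≋ ρ′ → splice k δ ρ ≋ splice k δ′ ρ′
  splice-cong zero    p q x       = q x
  splice-cong (suc k) p q zero    = p zero
  splice-cong (suc k) p q (suc x) = splice-cong k (p ∘ suc) q x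

  splice-ext : ∀ k θ {δ ρ} x → splice k δ ρ (ext k θ x) ≡ splice k δ (ρ ∘ θ) x
  splice-ext zero    θ x       = refl
  splice-ext (suc k) θ zero    = refl
  splice-ext (suc k) θ (suc x) = splice-ext k θ x

  -- Denotations of the constructs

  -- The graph of `f`, tabulated on finite environments. An abstraction is evaluated at no cost, so
  -- `fun` holds at every `n`, and the cost recorded at `F ⇒ τ` is that of the body.
  Lam : (Env → D) → D
  has (Lam f) fun          n = ⊤
  has (Lam f) (F ⇒ τ)      n = has (f (entries F)) τ n
  has (Lam f) (conᵒ _ _ _) n = ⊥
  up (Lam f) {fun}   p _ = tt
  up (Lam f) {F ⇒ τ} p   = up (f (entries F)) p

  -- Nothing is added for the argument: the entries of `F` carry its cost into the body, which pays
  -- it at every use. This makes the cost a call-by-name cost.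
  Apply : D → D → D
  has (Apply d e) τ n = ∃ λ F → has d (F ⇒ τ) n × entries F ⊑ λ _ → e
  up (Apply d e) p (F , q , r) = F , up d p q , r

  Con : ∀ T → Fin (size T) → Env → D
  has (Con T c δ) fun           n = ⊥
  has (Con T c δ) (_ ⇒ _)       n = ⊥
  has (Con T c δ) (conᵒ T′ c′ F) n = (_≡_ {A = Σ Ty (Fin ∘ size)} (T , c) (T′ , c′)) × entries F ⊑ δ
  up (Con T c δ) {conᵒ _ _ _} _ p = p

  Seq : D → D → D
  has (Seq d e) τ n = ∃₂ λ a b → a + b ≤ n × (∃ λ σ → has d σ a) × has e τ b
  up (Seq d e) p (a , b , q , r) = a , b , ≤-trans q p , r

  Case : ∀ T → D → (Fin (size T) → Env → D) → D
  has (Case T d g) τ n = ∃₂ λ a b → a + b ≤ n × ∃₂ λ c F → has d (conᵒ T c F) a × has (g c (entries F)) τ b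
  up (Case T d g) p (a , b , q , r) = a , b , ≤-trans q p , r

  Lam-mono : ∀ {f g} → (∀ δ → f δ ⊆ g δ) → Lam f ⊆ Lam g
  Lam-mono p = incl λ { {fun} _ → tt ; {F ⇒ τ} → to (p (entries F)) }

  Apply-mono : ∀ {d d′ e e′} → d ⊆ d′ → e ⊆ e′ → Apply d e ⊆ Apply d′ e′
  Apply-mono p q = incl λ (F , r , s) → F , to p r , λ x → ⊆-trans (s x) q

  Con-mono : ∀ {T c δ δ′} → δ ⊑ δ′ → Con T c δ ⊆ Con T c δ′
  Con-mono p = incl λ { {conᵒ _ _ F} (q , r) → q , λ x → ⊆-trans (r x) (p x) }

  Seq-mono : ∀ {d d′ e e′} → d ⊆ d′ → e ⊆ e′ → Seq d e ⊆ Seq d′ e′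
  Seq-mono p q = incl λ (a , b , r , (σ , s) , t) → a , b , r , (σ , to p s) , to q t

  Case-mono : ∀ {T d d′ g g′} → d ⊆ d′ → (∀ c δ → g c δ ⊆ g′ c δ) → Case T d g ⊆ Case T d′ g′
  Case-mono p q = incl λ (a , b , r , c , F , s , t) → a , b , r , c , F , to p s , to (q c (entries F)) t

  -- Continuity

  -- Scott continuity, with finite fragments in place of directed suprema.
  record Continuous (f : Env → D) : Set₁ where
    field
      mono   : ∀ {ρ ρ′} → ρ ⊑ ρ′ → f ρ ⊆ f ρ′
      approx : ∀ {ρ τ n} → has (f ρ) τ n → ∃ λ F → entries F ⊑ ρ × has (f (entries F)) τ n
  open Continuous

  Continuous* : (Env → Env) → Set₁
  Continuous* f = ∀ x → Continuous (λ ρ → f ρ x)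

  cong-≋ : ∀ {f} → Continuous f → ∀ {ρ ρ′} → ρ ≋ ρ′ → f ρ ≈ f ρ′
  cong-≋ c p = mono c (fwd ∘ p) , mono c (bwd ∘ p)

  ++-⊑ : ∀ {F G ρ} → entries F ⊑ ρ → entries G ⊑ ρ → entries (F ++ᴸ G) ⊑ ρ
  ++-⊑ {F} {G} {ρ} p q = entries-⊑ {ρ = ρ} λ i → both (∈-++⁻ F i)
    where
    both : ∀ {x τ n} → (x , τ , n) ∈ F ⊎ (x , τ , n) ∈ G → has (ρ x) τ n
    both (inj₁ i) = to (p _) (_ , ≤-refl , i)
    both (inj₂ i) = to (q _) (_ , ≤-refl , i)

  ⊑-++ˡ : ∀ F G → entries F ⊑ entries (F ++ᴸ G)
  ⊑-++ˡ F G x = incl λ (m , p , i) → m , p , ∈-++⁺ˡ i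

  ⊑-++ʳ : ∀ F G → entries G ⊑ entries (F ++ᴸ G)
  ⊑-++ʳ F G x = incl λ (m , p , i) → m , p , ∈-++⁺ʳ F i

  approx* : ∀ {f} → Continuous* f → ∀ F {ρ} → entries F ⊑ f ρ → ∃ λ G → entries G ⊑ ρ × entries F ⊑ f (entries G)
  approx* c [] p = [] , (λ x → incl λ { (_ , _ , ()) }) , λ x → incl λ { (_ , _ , ()) }
  approx* {f} c ((x , τ , n) ∷ F) p
    with G , G⊑ , q ← approx (c x) (to (p x) (n , ≤-refl , here refl))
       | H , H⊑ , r ← approx* c F (λ y → incl λ (m , l , i) → to (p y) (m , l , there i))
    = G ++ᴸ H , ++-⊑ G⊑ H⊑ , entries-⊑ {ρ = f (entries (G ++ᴸ H))} λ
      { (here refl) → to (mono (c x) (⊑-++ˡ G H)) q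
      ; (there i)   → to (mono (c _) (⊑-++ʳ G H)) (to (r _) (_ , ≤-refl , i)) }

  ∘-continuous : ∀ {f h} → Continuous f → Continuous* h → Continuous (f ∘ h)
  mono   (∘-continuous c d) p = mono c λ x → mono (d x) p
  approx (∘-continuous {f} c d) p
    with F , q , r ← approx c p with G , s , t ← approx* d F q = G , s , to (mono c t) r

  const-continuous : ∀ {d} → Continuous λ _ → d
  mono   const-continuous _ = ⊆-refl
  approx const-continuous p = [] , (λ x → incl λ { (_ , _ , ()) }) , p

  var-continuous : ∀ x → Continuous λ ρ → ρ x
  mono   (var-continuous x) p = p x
  approx (var-continuous x) {ρ} {τ} {n} p =
    (x , τ , n) ∷ [] , entries-⊑ {ρ = ρ} (λ { (here refl) → p }) , (n , ≤-refl , here refl)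

  splice-continuous : ∀ k {δ r} → Continuous* δ → Continuous* r → Continuous* λ ρ → splice k (δ ρ) (r ρ)
  splice-continuous zero    c d x       = d x
  splice-continuous (suc k) c d zero    = c zero
  splice-continuous (suc k) c d (suc x) = splice-continuous k (c ∘ suc) d x

  spliceʳ-continuous : ∀ k {δ} → Continuous* (splice k δ)
  spliceʳ-continuous k = splice-continuous k (λ _ → const-continuous) var-continuous

  spliceˡ-continuous : ∀ k {ρ} → Continuous* λ δ → splice k δ ρ
  spliceˡ-continuous k = splice-continuous k var-continuous (λ _ → const-continuous)

  later-continuous : ∀ {f} → Continuous f → Continuous (later ∘ f)
  mono   (later-continuous c) p = later-mono (mono c p)
  approx (later-continuous c) {n = suc n} p = approx c p

  delay-continuous : ∀ k {f} → Continuous f → Continuous (delay k ∘ f)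
  delay-continuous zero    c = c
  delay-continuous (suc k) c = later-continuous (delay-continuous k c)

  Lam-continuous : ∀ {g : Env → Env → D} → (∀ δ → Continuous (g δ)) → Continuous λ ρ → Lam λ δ → g δ ρ
  mono   (Lam-continuous c) p = Lam-mono λ δ → mono (c δ) p
  approx (Lam-continuous c) {τ = fun}   p = [] , (λ x → incl λ { (_ , _ , ()) }) , tt
  approx (Lam-continuous c) {τ = F ⇒ τ} p = approx (c (entries F)) p

  Apply-continuous : ∀ {f g} → Continuous f → Continuous g → Continuous λ ρ → Apply (f ρ) (g ρ)
  mono   (Apply-continuous c d) p = Apply-mono (mono c p) (mono d p)
  approx (Apply-continuous c d) (F , p , q)
    with G , G⊑ , p′ ← approx c p | H , H⊑ , q′ ← approx* (λ _ → d) F q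
    = G ++ᴸ H , ++-⊑ G⊑ H⊑ , F , to (mono c (⊑-++ˡ G H)) p′ , λ x → ⊆-trans (q′ x) (mono d (⊑-++ʳ G H))

  Con-continuous : ∀ {T c f} → Continuous* f → Continuous λ ρ → Con T c (f ρ)
  mono   (Con-continuous d) p = Con-mono λ x → mono (d x) p
  approx (Con-continuous d) {τ = conᵒ T c F} (e , p) with G , G⊑ , q ← approx* d F p = G , G⊑ , e , q

  Seq-continuous : ∀ {f g} → Continuous f → Continuous g → Continuous λ ρ → Seq (f ρ) (g ρ)
  mono   (Seq-continuous c d) p = Seq-mono (mono c p) (mono d p)
  approx (Seq-continuous c d) (a , b , l , (σ , p) , q)
    with G , G⊑ , p′ ← approx c p | H , H⊑ , q′ ← approx d q
    = G ++ᴸ H , ++-⊑ G⊑ H⊑ , a , b , l , (σ , to (mono c (⊑-++ˡ G H)) p′) , to (mono d (⊑-++ʳ G H)) q′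

  Case-continuous : ∀ {T f} {g : Env → Fin (size T) → Env → D} → Continuous f → (∀ c δ → Continuous λ ρ → g ρ c δ) →
    Continuous λ ρ → Case T (f ρ) (g ρ)
  mono   (Case-continuous c d) p = Case-mono (mono c p) λ i δ → mono (d i δ) p
  approx (Case-continuous c d) (a , b , l , i , F , p , q)
    with G , G⊑ , p′ ← approx c p | H , H⊑ , q′ ← approx (d i (entries F)) q
    = G ++ᴸ H , ++-⊑ G⊑ H⊑ , a , b , l , i , F
    , to (mono c (⊑-++ˡ G H)) p′ , to (mono (d i (entries F)) (⊑-++ʳ G H)) q′

  -- The β-law. Left to right is monotonicity; right to left needs `approx`, which turns the full
  -- argument into a fragment that can index `_⇒_`.
  Apply-Lam : ∀ {f} → Continuous f → ∀ {e} → Apply (Lam f) e ≈ f (λ _ → e)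
  Apply-Lam c = incl (λ (F , p , q) → to (mono c q) p)
              , incl (λ p → let F , q , r = approx c p in F , r , q)

  Case-Con : ∀ {T c g} → Continuous (g c) → ∀ {δ} → Case T (Con T c δ) g ≈ g c δ
  Case-Con {T} {c} {g} d {δ} = incl fw , incl bw
    where
    fw : ∀ {τ n} → has (Case T (Con T c δ) g) τ n → has (g c δ) τ n
    fw (a , b , l , _ , F , (refl , p) , q) = up (g c δ) (≤-trans (m≤n+m b a) l) (to (mono d p) q)
    bw : ∀ {τ n} → has (g c δ) τ n → has (Case T (Con T c δ) g) τ n
    bw p = let F , q , r = approx d p in 0 , _ , ≤-refl , c , F , (refl , q) , r

  Seq-inhabited : ∀ {d e} → (∃ λ σ → has d σ 0) → Seq d e ≈ e
  Seq-inhabited {d} {e} v = incl (λ (a , b , l , _ , q) → up e (≤-trans (m≤n+m b a) l) q)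
                          , incl (λ p → 0 , _ , ≤-refl , v , p)

  -- The function part is evaluated exactly once, so its cost is a summand of the total. `Seq` and
  -- `Case` behave alike; this lets a cost at a redex travel outwards along evaluation positions.
  Apply-delay : ∀ k {d e} → Apply (delay k d) e ≈ delay k (Apply d e)
  Apply-delay zero    = ≈-refl
  Apply-delay (suc k) {d} {e} = ≈-trans lemma (delay-cong 1 (Apply-delay k))
    where
    lemma : Apply (later (delay k d)) e ≈ later (Apply (delay k d) e)
    lemma = incl (λ { {n = suc n} p → p }) , incl (λ { {n = suc n} p → p })

  Seq-delay : ∀ k {d e} → Seq (delay k d) e ≈ delay k (Seq d e)
  Seq-delay zero    = ≈-refl
  Seq-delay (suc k) {d} {e} = ≈-trans lemma (delay-cong 1 (Seq-delay k))
    where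
    lemma : Seq (later (delay k d)) e ≈ later (Seq (delay k d) e)
    lemma = incl (λ { {n = suc n} (suc a , b , s≤s l , p) → a , b , l , p })
          , incl (λ { {n = suc n} (a , b , l , p) → suc a , b , s≤s l , p })

  Case-delay : ∀ k {T d g} → Case T (delay k d) g ≈ delay k (Case T d g)
  Case-delay zero    = ≈-refl
  Case-delay (suc k) {T} {d} {g} = ≈-trans lemma (delay-cong 1 (Case-delay k))
    where
    lemma : Case T (later (delay k d)) g ≈ later (Case T (delay k d) g)
    lemma = incl (λ { {n = suc n} (suc a , b , s≤s l , p) → a , b , l , p })
          , incl (λ { {n = suc n} (a , b , l , p) → suc a , b , s≤s l , p })

  delay-comm : ∀ j k {d} → delay j (delay k d) ≈ delay k (delay j d)
  delay-comm zero    k = ≈-refl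
  delay-comm (suc j) k {d} = ≈-trans (delay-cong 1 (delay-comm j k)) (lemma k)
    where
    lemma : ∀ k {d} → later (delay k d) ≈ delay k (later d)
    lemma zero    = ≈-refl
    lemma (suc k) = delay-cong 1 (lemma k)

  -- Least fixpoints: the meaning of recursive bindings

  module Fixpoint (lookupTick : ℕ) where

    -- Kleene iterates. The charge sits on the unfolding, so each lookup of a letrec-bound variable
    -- costs `lookupTick`, while variables bound by abstractions and alternatives are read for free.
    iter : (Env → Env) → ℕ → Env
    iter f zero    x = ∅ᴰ
    iter f (suc j) x = delay lookupTick (f (iter f j) x)

    Lfp : (Env → Env) → Env
    has (Lfp f x) τ n = ∃ λ j → has (iter f j x) τ n
    up (Lfp f x) p (j , q) = j , up (iter f j x) p q

    scope : ℕ → (Env → Env) → Env → Env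
    scope k f ρ = splice k (Lfp λ δ → f (splice k δ ρ)) ρ

    Lfp-cong : ∀ {f g} → (∀ {δ δ′} → δ ≋ δ′ → f δ ≋ g δ′) → Lfp f ≋ Lfp g
    Lfp-cong {f} {g} p x = incl (λ (j , q) → j , to (fwd (lemma j x)) q) , incl (λ (j , q) → j , to (bwd (lemma j x)) q)
      where
      lemma : ∀ j → iter f j ≋ iter g j
      lemma zero    x = ≈-refl
      lemma (suc j) x = delay-cong lookupTick (p (lemma j) x)

    scope-continuous : ∀ k {f} → Continuous* f → Continuous* (scope k f)
    scope-continuous k {f} c = splice-continuous k Lfp-c var-continuous
      where
      iter-c : ∀ j → Continuous* λ ρ → iter (λ δ → f (splice k δ ρ)) j
      iter-c zero    x = const-continuous
      iter-c (suc j) x =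
        delay-continuous lookupTick (∘-continuous (c x) (splice-continuous k (iter-c j) var-continuous))
      Lfp-c : Continuous* λ ρ → Lfp (λ δ → f (splice k δ ρ))
      mono   (Lfp-c x) p = incl λ (j , q) → j , to (mono (iter-c j x) p) q
      approx (Lfp-c x) (j , q) = let F , r , s = approx (iter-c j x) q in F , r , j , s

    scope-tail : ∀ k {f ρ} x → scope k f ρ (k + x) ≡ ρ x
    scope-tail k = splice-tail k

    -- Park induction, the main tool for comparing letrecs: an equation between two of them follows
    -- once each solution is closed under the bindings of the other. `E` covers the bound indices
    -- and the outer ones at once.
    scope-least : ∀ k {f ρ E} → Continuous* f →
      (∀ x → x < k → delay lookupTick (f E x) ⊆ E x) → (∀ x → ρ x ⊆ E (k + x)) → scope k f ρ ⊑ E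
    scope-least k {f} {ρ} {E} c p q = splice-⊑ k (λ x x<k → incl λ (j , r) → to (lemma j x x<k) r) q
      where
      lemma : ∀ j x → x < k → iter (λ δ → f (splice k δ ρ)) j x ⊆ E x
      lemma zero    x x<k = incl λ ()
      lemma (suc j) x x<k =
        ⊆-trans (delay-mono lookupTick (mono (c x) (splice-⊑ k (lemma j) q))) (p x x<k)

    iter-chain : ∀ {f} → (∀ {δ δ′} → δ ⊑ δ′ → f δ ⊑ f δ′) → ∀ {i j} → i ≤ j → iter f i ⊑ iter f j
    iter-chain p z≤n     x = incl λ ()
    iter-chain p (s≤s l) x = delay-mono lookupTick (p (iter-chain p l) x)

    -- Compactness of finite fragments: each entry appears at some stage, and the sum of these
    -- stages bounds them all because the iterates increase.
    bounded : ∀ {f} → (∀ {δ δ′} → δ ⊑ δ′ → f δ ⊑ f δ′) → ∀ F → entries F ⊑ Lfp f → ∃ λ j → entries F ⊑ iter f j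
    bounded p [] q = 0 , λ x → incl λ { (_ , _ , ()) }
    bounded {f} p ((x , τ , n) ∷ F) q
      with i , r ← to (q x) (n , ≤-refl , here refl)
         | j , s ← bounded p F (λ y → incl λ (m , l , e) → to (q y) (m , l , there e))
      = i + j , entries-⊑ {ρ = iter f (i + j)} λ
        { (here refl) → to (iter-chain p (m≤m+n i j) x) r
        ; (there e)   → to (iter-chain p (m≤n+m j i) _) (to (s _) (_ , ≤-refl , e)) }

    Lfp-unfold : ∀ {f} → Continuous* f → ∀ x → Lfp f x ≈ delay lookupTick (f (Lfp f) x)
    Lfp-unfold {f} c x = incl fw , incl bw
      where
      f-mono : ∀ {δ δ′} → δ ⊑ δ′ → f δ ⊑ f δ′
      f-mono p y = mono (c y) p
      fw : ∀ {τ n} → has (Lfp f x) τ n → has (delay lookupTick (f (Lfp f) x)) τ n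
      fw (suc j , p) = to (delay-mono lookupTick (f-mono (λ y → incl λ q → j , q) x)) p
      bw : ∀ {τ n} → has (delay lookupTick (f (Lfp f) x)) τ n → has (Lfp f x) τ n
      -- One more unfolding uses only a fragment of the fixpoint. A single stage `j` contains this
      -- fragment, so stage `suc j` has the observation.
      bw p with F , q , r ← approx (delay-continuous lookupTick (c x)) p with j , s ← bounded f-mono F q
        = suc j , to (delay-mono lookupTick (f-mono s x)) r

    scope-unfold : ∀ k {f ρ} → Continuous* f → ∀ x → x < k →
      scope k f ρ x ≈ delay lookupTick (f (scope k f ρ) x)
    scope-unfold k c x x<k =
      ≈-trans (≈-reflexive (splice-head k x x<k)) (Lfp-unfold (λ y → ∘-continuous (c y) (spliceˡ-continuous k)) x)

    scope-cong : ∀ k {f g ρ ρ′} → (∀ {δ δ′} → δ ≋ δ′ → f (splice k δ ρ) ≋ g (splice k δ′ ρ′)) → ρ ≋ ρ′ →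
      scope k f ρ ≋ scope k g ρ′
    scope-cong k p q = splice-cong k (Lfp-cong p) q

  -- Denotational semantics

  module Semantics (tick lookupTick : ℕ) where
    open Fixpoint lookupTick public

    mutual
      ⦅_⦆ : Exp A → Env → D
      ⦅ var^ _ x ⦆ ρ         = ρ x
      ⦅ app^ _ s t ⦆ ρ       = delay tick (Apply (⦅ s ⦆ ρ) (⦅ t ⦆ ρ))
      ⦅ lam^ _ s ⦆ ρ         = Lam λ δ → ⦅ s ⦆ (splice 1 δ ρ)
      ⦅ letrec^ {k} _ bs t ⦆ ρ = ⦅ t ⦆ (scope (suc k) ⦅ bs ⦆* ρ)
      ⦅ con^ _ T c ss ⦆ ρ    = Con T c (⦅ ss ⦆* ρ)
      ⦅ seq^ _ s t ⦆ ρ       = delay tick (Seq (⦅ s ⦆ ρ) (⦅ t ⦆ ρ))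
      ⦅ case^ _ T s alts ⦆ ρ = delay tick (Case T (⦅ s ⦆ ρ) (⦅ alts ⦆ᵃ (ar T) ρ))

      ⦅_⦆* : ∀ {n} → Vec (Exp A) n → Env → Env
      ⦅ [] ⦆*     ρ x       = ∅ᴰ
      ⦅ s ∷ ss ⦆* ρ zero    = ⦅ s ⦆ ρ
      ⦅ s ∷ ss ⦆* ρ (suc x) = ⦅ ss ⦆* ρ x

      ⦅_⦆ᵃ : ∀ {n} → Vec (Exp A) n → (Fin n → ℕ) → Env → Fin n → Env → D
      ⦅ s ∷ ss ⦆ᵃ ars ρ zero    δ = ⦅ s ⦆ (splice (ars zero) δ ρ)
      ⦅ s ∷ ss ⦆ᵃ ars ρ (suc i) δ = ⦅ ss ⦆ᵃ (ars ∘ suc) ρ i δ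

    mutual
      continuous : ∀ (s : Exp A) → Continuous ⦅ s ⦆
      continuous (var^ _ x)         = var-continuous x
      continuous (app^ _ s t)       = delay-continuous tick (Apply-continuous (continuous s) (continuous t))
      continuous (lam^ _ s)         =
        Lam-continuous λ δ → ∘-continuous (continuous s) (spliceʳ-continuous 1)
      continuous (letrec^ {k} _ bs t) =
        ∘-continuous (continuous t) (scope-continuous (suc k) (continuous* bs))
      continuous (con^ _ T c ss)    = Con-continuous (continuous* ss)
      continuous (seq^ _ s t)       = delay-continuous tick (Seq-continuous (continuous s) (continuous t))
      continuous (case^ _ T s alts) =
        delay-continuous tick (Case-continuous (continuous s) (λ c δ → continuousᵃ alts (ar T) c))

      continuous* : ∀ {n} (ss : Vec (Exp A) n) → Continuous* ⦅ ss ⦆*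
      continuous* []       x       = const-continuous
      continuous* (s ∷ ss) zero    = continuous s
      continuous* (s ∷ ss) (suc x) = continuous* ss x

      continuousᵃ : ∀ {n} (ss : Vec (Exp A) n) ars i {δ} → Continuous λ ρ → ⦅ ss ⦆ᵃ ars ρ i δ
      continuousᵃ (s ∷ ss) ars zero    = ∘-continuous (continuous s) (spliceʳ-continuous (ars zero))
      continuousᵃ (s ∷ ss) ars (suc i) = continuousᵃ ss (ars ∘ suc) i

    ⦅⦆-cong : ∀ (s : Exp A) {ρ ρ′} → ρ ≋ ρ′ → ⦅ s ⦆ ρ ≈ ⦅ s ⦆ ρ′
    ⦅⦆-cong s = cong-≋ (continuous s)

    ⦅⦆*-cong : ∀ {n} (ss : Vec (Exp A) n) {ρ ρ′} → ρ ≋ ρ′ → ⦅ ss ⦆* ρ ≋ ⦅ ss ⦆* ρ′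
    ⦅⦆*-cong ss p x = cong-≋ (continuous* ss x) p

    ⦅⦆ᵃ-lookup : ∀ {n} (ss : Vec (Exp A) n) {ars ρ} i {δ} → ⦅ ss ⦆ᵃ ars ρ i δ ≡ ⦅ lookup ss i ⦆ (splice (ars i) δ ρ)
    ⦅⦆ᵃ-lookup (s ∷ ss) zero    = refl
    ⦅⦆ᵃ-lookup (s ∷ ss) (suc i) = ⦅⦆ᵃ-lookup ss i

    ⦅⦆*-lookup : ∀ {n} (ss : Vec (Exp A) n) {ρ} i → ⦅ ss ⦆* ρ (toℕ i) ≡ ⦅ lookup ss i ⦆ ρ
    ⦅⦆*-lookup (s ∷ ss) zero    = refl
    ⦅⦆*-lookup (s ∷ ss) (suc i) = ⦅⦆*-lookup ss i

    ⦅⦆*-⊑ : ∀ {n} (ss : Vec (Exp A) n) {ρ E} → (∀ i → ⦅ lookup ss i ⦆ ρ ⊆ E (toℕ i)) → ⦅ ss ⦆* ρ ⊑ E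
    ⦅⦆*-⊑ []       p x       = incl λ ()
    ⦅⦆*-⊑ (s ∷ ss) p zero    = p zero
    ⦅⦆*-⊑ (s ∷ ss) p (suc x) = ⦅⦆*-⊑ ss (p ∘ suc) x

    ⦅⦆*-++ : ∀ {m n} (ss : Vec (Exp A) m) (ts : Vec (Exp A) n) {ρ} x →
      ⦅ ss ++ ts ⦆* ρ x ≡ splice m (⦅ ss ⦆* ρ) (⦅ ts ⦆* ρ) x
    ⦅⦆*-++ []       ts x       = refl
    ⦅⦆*-++ (s ∷ ss) ts zero    = refl
    ⦅⦆*-++ (s ∷ ss) ts (suc x) = ⦅⦆*-++ ss ts x

    Apply-cong : ∀ {d d′ e e′} → d ≈ d′ → e ≈ e′ → Apply d e ≈ Apply d′ e′
    Apply-cong (p , q) (p′ , q′) = Apply-mono p p′ , Apply-mono q q′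

    Seq-cong : ∀ {d d′ e e′} → d ≈ d′ → e ≈ e′ → Seq d e ≈ Seq d′ e′
    Seq-cong (p , q) (p′ , q′) = Seq-mono p p′ , Seq-mono q q′

    Case-cong : ∀ {T d d′ g g′} → d ≈ d′ → (∀ c δ → g c δ ≈ g′ c δ) → Case T d g ≈ Case T d′ g′
    Case-cong (p , q) r = Case-mono p (λ c δ → fwd (r c δ)) , Case-mono q (λ c δ → bwd (r c δ))

    Lam-cong : ∀ {f g} → (∀ δ → f δ ≈ g δ) → Lam f ≈ Lam g
    Lam-cong p = Lam-mono (fwd ∘ p) , Lam-mono (bwd ∘ p)

    Con-cong : ∀ {T c δ δ′} → δ ≋ δ′ → Con T c δ ≈ Con T c δ′
    Con-cong p = Con-mono (fwd ∘ p) , Con-mono (bwd ∘ p)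

    mutual
      mapAnn-≈ : ∀ (f : A → B) s {ρ ρ′} → ρ ≋ ρ′ → ⦅ mapAnn f s ⦆ ρ ≈ ⦅ s ⦆ ρ′
      mapAnn-≈ f (var^ _ x) p         = p x
      mapAnn-≈ f (app^ _ s t) p       = delay-cong tick (Apply-cong (mapAnn-≈ f s p) (mapAnn-≈ f t p))
      mapAnn-≈ f (lam^ _ s) p         = Lam-cong λ δ → mapAnn-≈ f s (splice-cong 1 (λ _ → ≈-refl) p)
      mapAnn-≈ f (letrec^ {k} _ bs t) p =
        mapAnn-≈ f t (scope-cong (suc k) {⦅ mapAnn* f bs ⦆*} {⦅ bs ⦆*} (λ q → mapAnn*-≈ f bs (splice-cong (suc k) q p)) p)
      mapAnn-≈ f (con^ _ T c ss) p    = Con-cong (mapAnn*-≈ f ss p)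
      mapAnn-≈ f (seq^ _ s t) p       = delay-cong tick (Seq-cong (mapAnn-≈ f s p) (mapAnn-≈ f t p))
      mapAnn-≈ f (case^ _ T s alts) p =
        delay-cong tick (Case-cong (mapAnn-≈ f s p) (λ c δ → mapAnnᵃ-≈ f alts (ar T) c p))

      mapAnn*-≈ : ∀ {n} (f : A → B) (ss : Vec (Exp A) n) {ρ ρ′} → ρ ≋ ρ′ → ⦅ mapAnn* f ss ⦆* ρ ≋ ⦅ ss ⦆* ρ′
      mapAnn*-≈ f []       p x       = ≈-refl
      mapAnn*-≈ f (s ∷ ss) p zero    = mapAnn-≈ f s p
      mapAnn*-≈ f (s ∷ ss) p (suc x) = mapAnn*-≈ f ss p x

      mapAnnᵃ-≈ : ∀ {n} (f : A → B) (ss : Vec (Exp A) n) ars i {ρ ρ′ δ} → ρ ≋ ρ′ →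
        ⦅ mapAnn* f ss ⦆ᵃ ars ρ i δ ≈ ⦅ ss ⦆ᵃ ars ρ′ i δ
      mapAnnᵃ-≈ f (s ∷ ss) ars zero    p = mapAnn-≈ f s (splice-cong (ars zero) (λ _ → ≈-refl) p)
      mapAnnᵃ-≈ f (s ∷ ss) ars (suc i) p = mapAnnᵃ-≈ f ss (ars ∘ suc) i p

    erase-≈ : ∀ (l : LExp) {ρ} → ⦅ erase l ⦆ ρ ≈ ⦅ l ⦆ ρ
    erase-≈ l = mapAnn-≈ _ l λ _ → ≈-refl

    splice-ext-≋ : ∀ k θ {δ δ′ ρ ρ′} → δ′ ≋ δ → (ρ′ ∘ θ) ≋ ρ → (splice k δ′ ρ′ ∘ ext k θ) ≋ splice k δ ρ
    splice-ext-≋ k θ p q x = ≈-trans (≈-reflexive (splice-ext k θ x)) (splice-cong k p q x)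

    mutual
      rename-≈ : ∀ θ (s : Exp A) {ρ ρ′} → (ρ′ ∘ θ) ≋ ρ → ⦅ rename θ s ⦆ ρ′ ≈ ⦅ s ⦆ ρ
      rename-≈ θ (var^ _ x) p         = p x
      rename-≈ θ (app^ _ s t) p       = delay-cong tick (Apply-cong (rename-≈ θ s p) (rename-≈ θ t p))
      rename-≈ θ (lam^ _ s) p         = Lam-cong λ δ → rename-≈ (ext 1 θ) s (splice-ext-≋ 1 θ (λ _ → ≈-refl) p)
      rename-≈ θ (letrec^ {k} _ bs t) {ρ} {ρ′} p =
        rename-≈ (ext (suc k) θ) t (splice-ext-≋ (suc k) θ rec≋ p)
        where
        rec≋ = Lfp-cong λ q → rename*-≈ (ext (suc k) θ) bs (splice-ext-≋ (suc k) θ q p)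
      rename-≈ θ (con^ _ T c ss) p    = Con-cong (rename*-≈ θ ss p)
      rename-≈ θ (seq^ _ s t) p       = delay-cong tick (Seq-cong (rename-≈ θ s p) (rename-≈ θ t p))
      rename-≈ θ (case^ _ T s alts) p =
        delay-cong tick (Case-cong (rename-≈ θ s p) (λ c δ → renameAlts-≈ θ alts (ar T) c p))

      rename*-≈ : ∀ {n} θ (ss : Vec (Exp A) n) {ρ ρ′} → (ρ′ ∘ θ) ≋ ρ → ⦅ rename* θ ss ⦆* ρ′ ≋ ⦅ ss ⦆* ρ
      rename*-≈ θ []       p x       = ≈-refl
      rename*-≈ θ (s ∷ ss) p zero    = rename-≈ θ s p
      rename*-≈ θ (s ∷ ss) p (suc x) = rename*-≈ θ ss p x

      renameAlts-≈ : ∀ {n} θ (ss : Vec (Exp A) n) ars i {ρ ρ′ δ} → (ρ′ ∘ θ) ≋ ρ →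
        ⦅ renameAlts ars θ ss ⦆ᵃ ars ρ′ i δ ≈ ⦅ ss ⦆ᵃ ars ρ i δ
      renameAlts-≈ θ (s ∷ ss) ars zero    p =
        rename-≈ (ext (ars zero) θ) s (splice-ext-≋ (ars zero) θ (λ _ → ≈-refl) p)
      renameAlts-≈ θ (s ∷ ss) ars (suc i) p = renameAlts-≈ θ ss (ars ∘ suc) i p

    shift-≈ : ∀ k (s : Exp A) {ρ ρ′} → (∀ x → ρ′ (k + x) ≡ ρ x) → ⦅ shift k s ⦆ ρ′ ≈ ⦅ s ⦆ ρ
    shift-≈ k s p = rename-≈ (k +_) s λ x → ≈-reflexive (p x)

    exts-≋ : ∀ k σ {δ δ′ ρ ρ′} → δ′ ≋ δ → (∀ x → ⦅ σ x ⦆ ρ′ ≈ ρ x) →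
      ∀ x → ⦅ exts k σ x ⦆ (splice k δ′ ρ′) ≈ splice k δ ρ x
    exts-≋ zero    σ p q x       = q x
    exts-≋ (suc k) σ p q zero    = p zero
    exts-≋ (suc k) σ p q (suc x) =
      ≈-trans (shift-≈ 1 (exts k σ x) (λ _ → refl)) (exts-≋ k σ (p ∘ suc) q x)

    mutual
      subst-≈ : ∀ σ s {ρ ρ′} → (∀ x → ⦅ σ x ⦆ ρ′ ≈ ρ x) → ⦅ subst σ s ⦆ ρ′ ≈ ⦅ s ⦆ ρ
      subst-≈ σ (var x) p         = p x
      subst-≈ σ (app s t) p       = delay-cong tick (Apply-cong (subst-≈ σ s p) (subst-≈ σ t p))
      subst-≈ σ (lam s) p         = Lam-cong λ δ → subst-≈ (exts 1 σ) s (exts-≋ 1 σ (λ _ → ≈-refl) p)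
      subst-≈ σ (letrec^ {k} tt bs t) p =
        subst-≈ (exts (suc k) σ) t (exts-≋ (suc k) σ rec≋ p)
        where
        rec≋ = Lfp-cong λ q → subst*-≈ (exts (suc k) σ) bs (exts-≋ (suc k) σ q p)
      subst-≈ σ (con T c ss) p    = Con-cong (subst*-≈ σ ss p)
      subst-≈ σ (seq s t) p       = delay-cong tick (Seq-cong (subst-≈ σ s p) (subst-≈ σ t p))
      subst-≈ σ (case T s alts) p =
        delay-cong tick (Case-cong (subst-≈ σ s p) (λ c δ → substAlts-≈ σ alts (ar T) c p))

      subst*-≈ : ∀ {n} σ (ss : Vec 𝔼 n) {ρ ρ′} → (∀ x → ⦅ σ x ⦆ ρ′ ≈ ρ x) → ⦅ subst* σ ss ⦆* ρ′ ≋ ⦅ ss ⦆* ρ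
      subst*-≈ σ []       p x       = ≈-refl
      subst*-≈ σ (s ∷ ss) p zero    = subst-≈ σ s p
      subst*-≈ σ (s ∷ ss) p (suc x) = subst*-≈ σ ss p x

      substAlts-≈ : ∀ {n} σ (ss : Vec 𝔼 n) ars i {ρ ρ′ δ} → (∀ x → ⦅ σ x ⦆ ρ′ ≈ ρ x) →
        ⦅ substAlts ars σ ss ⦆ᵃ ars ρ′ i δ ≈ ⦅ ss ⦆ᵃ ars ρ i δ
      substAlts-≈ σ (s ∷ ss) ars zero    p =
        subst-≈ (exts (ars zero) σ) s (exts-≋ (ars zero) σ (λ _ → ≈-refl) p)
      substAlts-≈ σ (s ∷ ss) ars (suc i) p = substAlts-≈ σ ss (ars ∘ suc) i p

    instantiate-≈ : ∀ {k} (ss : Vec 𝔼 k) {ρ} x → ⦅ instantiate ss x ⦆ ρ ≈ splice k (⦅ ss ⦆* ρ) ρ x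
    instantiate-≈ []       x       = ≈-refl
    instantiate-≈ (s ∷ ss) zero    = ≈-refl
    instantiate-≈ (s ∷ ss) (suc x) = instantiate-≈ ss x

    β-≈ : ∀ a ℓ (s : Exp A) t {ρ} → ⦅ app^ a (lam^ ℓ s) t ⦆ ρ ≈ delay tick (⦅ s ⦆ (splice 1 (λ _ → ⦅ t ⦆ ρ) ρ))
    β-≈ a ℓ s t = delay-cong tick (Apply-Lam (∘-continuous (continuous s) (spliceˡ-continuous 1)))

    alternative-continuous : ∀ {n} (ss : Vec (Exp A) n) ars i {ρ} → Continuous (⦅ ss ⦆ᵃ ars ρ i)
    alternative-continuous (s ∷ ss) ars zero    = ∘-continuous (continuous s) (spliceˡ-continuous (ars zero))
    alternative-continuous (s ∷ ss) ars (suc i) = alternative-continuous ss (ars ∘ suc) i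

    case-≈ : ∀ a b T c (ss : Vec (Exp A) (ar T c)) alts {ρ} →
      ⦅ case^ a T (con^ b T c ss) alts ⦆ ρ ≈ delay tick (⦅ lookup alts c ⦆ (splice (ar T c) (⦅ ss ⦆* ρ) ρ))
    case-≈ a b T c ss alts {ρ} = delay-cong tick
      (≈-trans (Case-Con (alternative-continuous alts (ar T) c)) (≈-reflexive (⦅⦆ᵃ-lookup alts c)))

    -- Cost 0 matters: (seq) discards the value, and the step must account for exactly one tick.
    value-inhabited : ∀ {v : Exp A} → Value v → ∀ {ρ} → ∃ λ σ → has (⦅ v ⦆ ρ) σ 0
    value-inhabited abstraction             = fun , tt
    value-inhabited (application {c = c}) = conᵒ _ c [] , refl , λ x → incl λ { (_ , _ , ()) }

    seq-≈ : ∀ a {v : Exp A} s → Value v → ∀ {ρ} → ⦅ seq^ a v s ⦆ ρ ≈ delay tick (⦅ s ⦆ ρ)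
    seq-≈ a s v = delay-cong tick (Seq-inhabited (value-inhabited v))

    lapp-≈ : ∀ {k a b} (bs : Vec (Exp A) (suc k)) s t {ρ} →
      ⦅ app^ a (letrec^ b bs s) t ⦆ ρ ≈ ⦅ letrec^ b bs (app^ a s (shift (suc k) t)) ⦆ ρ
    lapp-≈ {k = k} bs s t =
      delay-cong tick (Apply-cong ≈-refl (≈-sym (shift-≈ (suc k) t (scope-tail (suc k) {⦅ bs ⦆*}))))

    lseq-≈ : ∀ {k a b} (bs : Vec (Exp A) (suc k)) s t {ρ} →
      ⦅ seq^ a (letrec^ b bs s) t ⦆ ρ ≈ ⦅ letrec^ b bs (seq^ a s (shift (suc k) t)) ⦆ ρ
    lseq-≈ {k = k} bs s t =
      delay-cong tick (Seq-cong ≈-refl (≈-sym (shift-≈ (suc k) t (scope-tail (suc k) {⦅ bs ⦆*}))))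

    lcase-≈ : ∀ {k a b T} (bs : Vec (Exp A) (suc k)) s alts {ρ} →
      ⦅ case^ a T (letrec^ b bs s) alts ⦆ ρ ≈ ⦅ letrec^ b bs (case^ a T s (shiftAlts T (suc k) alts)) ⦆ ρ
    lcase-≈ {k = k} {T = T} bs s alts = delay-cong tick (Case-cong ≈-refl λ c δ →
      ≈-sym (renameAlts-≈ (suc k +_) alts (ar T) c λ x → ≈-reflexive (scope-tail (suc k) {⦅ bs ⦆*} x)))

    scope* : ∀ {n} → Vec (Exp A) n → Env → Env
    scope* {n = n} bs = scope n ⦅ bs ⦆*

    scope*-least : ∀ {n} (bs : Vec (Exp A) n) {ρ} E →
      (∀ i → delay lookupTick (⦅ lookup bs i ⦆ E) ⊆ E (toℕ i)) → (∀ x → ρ x ⊆ E (n + x)) → scope* bs ρ ⊑ E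
    scope*-least bs {ρ} E p = scope-least _ (continuous* bs) (lemma bs E p)
      where
      -- The bound `E′` is separated from the environment `E` of evaluation, because the recursion
      -- on `bs` shifts the former and keeps the latter.
      lemma : ∀ {n} (bs : Vec (Exp A) n) E′ → (∀ i → delay lookupTick (⦅ lookup bs i ⦆ E) ⊆ E′ (toℕ i)) →
        ∀ x → x < n → delay lookupTick (⦅ bs ⦆* E x) ⊆ E′ x
      lemma (b ∷ bs) E′ p zero    _       = p zero
      lemma (b ∷ bs) E′ p (suc x) (s≤s l) = lemma bs (λ y → E′ (suc y)) (λ i → p (suc i)) x l

    scope*-lookup : ∀ {n} (bs : Vec (Exp A) n) {ρ} i →
      scope* bs ρ (toℕ i) ≈ delay lookupTick (⦅ lookup bs i ⦆ (scope* bs ρ))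
    scope*-lookup {n = n} bs i =
      ≈-trans (scope-unfold n (continuous* bs) (toℕ i) (toℕ<n i))
              (delay-cong lookupTick (≈-reflexive (⦅⦆*-lookup bs i)))

  -- The logical relation between two cost models

  Inhabited : D → Set
  Inhabited d = ∃₂ λ τ n → has d τ n

  mutual
    -- Reducibility in the style of Tait. The function clause also asks for an observation of `d`,
    -- because `seq` may evaluate a function that is never applied. In the constructor clause the
    -- components `δ` and the cost `a` are fixed before `G`: evaluation to a constructor does not
    -- depend on what is asked of its components later.
    Computable : Obs → D → Set₁
    Computable fun          d = Lift _ (Inhabited d)
    Computable (F ⇒ τ)      d = Lift (lsuc lzero) (Inhabited d) × (∀ e → Computable* F (λ _ → e) → Computable τ (Apply d e))
    Computable (conᵒ T c F) d = ∃ λ δ → Computable* F δ × ∃ λ a → ∀ G → entries G ⊑ δ → has d (conᵒ T c G) a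

    Computable* : Fragment → Env → Set₁
    Computable* []                δ = Lift _ ⊤
    Computable* ((x , σ , _) ∷ F) δ = Computable σ (δ x) × Computable* F δ

  computable-inhabited : ∀ τ {d} → Computable τ d → Inhabited d
  computable-inhabited fun          (lift p)          = p
  computable-inhabited (F ⇒ τ)      (lift p , _)      = p
  computable-inhabited (conᵒ T c F) (δ , _ , a , p) = conᵒ T c [] , a , p [] λ x → incl λ { (_ , _ , ()) }

  -- Computability asserts only that some finite cost exists, so it survives a finite surcharge `k`
  -- as well as an enlargement of the denotation. The inclusion combines both, which absorbs the
  -- tick of each construct.
  computable-delay : ∀ k τ {d e} → delay k d ⊆ e → Computable τ d → Computable τ e
  computable-delay k fun     {d} p (lift (τ , n , q)) = lift (τ , k + n , to p (delay-intro k d q))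
  computable-delay k (F ⇒ τ) {d} p (lift (σ , n , q) , r) =
    lift (σ , k + n , to p (delay-intro k d q)) ,
    λ e s → computable-delay k τ (⊆-trans (bwd (Apply-delay k)) (Apply-mono p ⊆-refl)) (r e s)
  computable-delay k (conᵒ T c F) {d} p (δ , q , a , r) = δ , q , k + a , λ G s → to p (delay-intro k d (r G s))

  computable*-intro : ∀ F {δ} → (∀ {x σ m} → (x , σ , m) ∈ F → Computable σ (δ x)) → Computable* F δ
  computable*-intro []      p = lift tt
  computable*-intro (_ ∷ F) p = p (here refl) , computable*-intro F (p ∘ there)

  computable*-lookup : ∀ {F δ x σ m} → Computable* F δ → (x , σ , m) ∈ F → Computable σ (δ x)
  computable*-lookup (p , _) (here refl) = p
  computable*-lookup (_ , p) (there i)   = computable*-lookup p i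

  Related : Env → Env → Set₁
  Related ρ ρ′ = ∀ x {σ m} → has (ρ x) σ m → Computable σ (ρ′ x)

  splice-related : ∀ k {δ δ′ ρ ρ′} → Related δ δ′ → Related ρ ρ′ → Related (splice k δ ρ) (splice k δ′ ρ′)
  splice-related zero    p q x       = q x
  splice-related (suc k) p q zero    = p zero
  splice-related (suc k) p q (suc x) = splice-related k (λ y → p (suc y)) q x

  entries-related : ∀ {F δ} → Computable* F δ → Related (entries F) δ
  entries-related p x (_ , _ , i) = computable*-lookup p i

  related-computable* : ∀ {F ρ ρ′} → entries F ⊑ ρ → Related ρ ρ′ → Computable* F ρ′
  related-computable* {F} p q = computable*-intro F λ {x} i → q x (to (p x) (_ , ≤-refl , i))

  Seq-delay-⊆ : ∀ {d e σ a} → has d σ a → delay a e ⊆ Seq d e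
  Seq-delay-⊆ {e = e} {a = a} p = incl λ q → let b , r , s = delay-elim a e q in
    a , b , ≤-reflexive (sym r) , (_ , p) , s

  -- The alternative determines which fragment `G` of the components it uses, and only then is the
  -- scrutinee asked for `G`; hence `a` must be uniform in `G`.
  Case-delay-⊆ : ∀ {T d g c δ a} → Continuous (g c) → (∀ G → entries G ⊑ δ → has d (conᵒ T c G) a) →
    delay a (g c δ) ⊆ Case T d g
  Case-delay-⊆ {g = g} {c} {δ} {a} k p = incl λ q → let b , r , s = delay-elim a (g c δ) q
                                                        G , G⊑ , t = approx k s in
    a , b , ≤-reflexive (sym r) , c , G , p G G⊑ , t

  -- Costs in the first model are ignored, hence 0 0.
  module Transfer (tick lookupTick : ℕ) where
    private
      module S₀ = Semantics 0 0
      module S₁ = Semantics tick lookupTick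

    mutual
      fundamental : ∀ s {ρ ρ′} → Related ρ ρ′ → ∀ {τ n} → has (S₀.⦅ s ⦆ ρ) τ n → Computable τ (S₁.⦅ s ⦆ ρ′)
      fundamental (var x) r p = r x p
      fundamental (app s t) {ρ} {ρ′} r {τ} (F , p , q) =
        computable-delay tick τ ⊆-refl (proj₂ (fundamental s r p) (S₁.⦅ t ⦆ ρ′)
          (related-computable* q λ _ → fundamental t r))
      fundamental (lam s) r {fun}   p = lift (fun , 0 , tt)
      fundamental (lam s) r {F ⇒ τ} p = lift (fun , 0 , tt) , λ e q →
        computable-delay 0 τ
          (bwd (Apply-Lam (∘-continuous (S₁.continuous s) (spliceˡ-continuous 1))))
          (fundamental s (splice-related 1 (entries-related q) r) p)
      fundamental (letrec^ {k} tt bs t) {ρ} {ρ′} r p =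
        fundamental t (splice-related (suc k) (λ { x (j , q) → rec j x q }) r) p
        where
        -- Induction on the stage of the first fixpoint. The second fixpoint is taken as a whole and
        -- unfolded once per stage, at the price of one lookup.
        rec : ∀ j → Related (S₀.iter (λ δ → S₀.⦅ bs ⦆* (splice (suc k) δ ρ)) j)
                            (S₁.Lfp (λ δ → S₁.⦅ bs ⦆* (splice (suc k) δ ρ′)))
        rec (suc j) x {σ} q =
          computable-delay lookupTick σ
            (bwd (S₁.Lfp-unfold (λ y → ∘-continuous (S₁.continuous* bs y) (spliceˡ-continuous (suc k))) x))
            (fundamental* bs (splice-related (suc k) (rec j) r) x q)
      fundamental (con T c ss) r {conᵒ _ _ F} (refl , p) =
        _ , related-computable* p (fundamental* ss r) , 0 , λ G q → refl , q
      fundamental (seq s t) r {τ} (a , b , l , (σ , p) , q) =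
        let _ , a′ , p′ = computable-inhabited σ (fundamental s r p) in
        computable-delay tick τ ⊆-refl (computable-delay a′ τ (Seq-delay-⊆ p′) (fundamental t r q))
      fundamental (case T s alts) {ρ′ = ρ′} r {τ} (a , b , l , c , F , p , q) =
        let δ , p′ , a′ , h = fundamental s r p in
        computable-delay tick τ ⊆-refl
          (computable-delay a′ τ (Case-delay-⊆ (S₁.alternative-continuous alts (ar T) c) h)
            (fundamentalᵃ alts (ar T) c (entries-related p′) r q))

      fundamental* : ∀ {n} (ss : Vec 𝔼 n) {ρ ρ′} → Related ρ ρ′ → Related (S₀.⦅ ss ⦆* ρ) (S₁.⦅ ss ⦆* ρ′)
      fundamental* (s ∷ ss) r zero    p = fundamental s r p
      fundamental* (s ∷ ss) r (suc x) p = fundamental* ss r x p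

      fundamentalᵃ : ∀ {n} (ss : Vec 𝔼 n) ars i {δ δ′ ρ ρ′} → Related δ δ′ → Related ρ ρ′ →
        ∀ {τ n} → has (S₀.⦅ ss ⦆ᵃ ars ρ i δ) τ n → Computable τ (S₁.⦅ ss ⦆ᵃ ars ρ′ i δ′)
      fundamentalᵃ (s ∷ ss) ars zero    q r p = fundamental s (splice-related (ars zero) q r) p
      fundamentalᵃ (s ∷ ss) ars (suc i) q r p = fundamentalᵃ ss (ars ∘ suc) i q r p

  -- Termination of evaluation

  -- Copying an abstraction to a variable and moving a letrec outwards lower the weight:
  -- hence the values of var and lam, and the doubling along evaluation positions.
  mutual
    weight : Exp A → ℕ
    weight (var^ _ x)       = 1
    weight (app^ _ s t)     = weight s + weight s
    weight (lam^ _ s)       = 0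
    weight (letrec^ _ bs t) = suc (weight* bs + weight t)
    weight (con^ _ T c ss)  = 0
    weight (seq^ _ s t)     = weight s + weight s
    weight (case^ _ T s _)  = weight s + weight s

    weight* : ∀ {n} → Vec (Exp A) n → ℕ
    weight* []       = 0
    weight* (s ∷ ss) = weight s + weight* ss

  mutual
    weight-rename : ∀ θ (s : Exp A) → weight (rename θ s) ≡ weight s
    weight-rename θ (var^ _ x)         = refl
    weight-rename θ (app^ _ s t)       = cong₂ _+_ (weight-rename θ s) (weight-rename θ s)
    weight-rename θ (lam^ _ s)         = refl
    weight-rename θ (letrec^ {k} _ bs t) =
      cong suc (cong₂ _+_ (weight-rename* (ext (suc k) θ) bs) (weight-rename (ext (suc k) θ) t))
    weight-rename θ (con^ _ T c ss)    = refl
    weight-rename θ (seq^ _ s t)       = cong₂ _+_ (weight-rename θ s) (weight-rename θ s)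
    weight-rename θ (case^ _ T s alts) = cong₂ _+_ (weight-rename θ s) (weight-rename θ s)

    weight-rename* : ∀ {n} θ (ss : Vec (Exp A) n) → weight* (rename* θ ss) ≡ weight* ss
    weight-rename* θ []       = refl
    weight-rename* θ (s ∷ ss) = cong₂ _+_ (weight-rename θ s) (weight-rename* θ ss)

  -- Inside an evaluation position the bindings and the letrec node are counted twice, outside only
  -- once.
  extrusion-weight : ∀ b s → suc (b + (s + s)) < suc (b + s) + suc (b + s)
  extrusion-weight b s = begin-strict
    suc (b + (s + s))           ≡⟨ cong suc (sym (+-assoc b s s)) ⟩
    suc (b + s + s)             ≤⟨ s≤s (+-monoʳ-≤ (b + s) (m≤n+m s b)) ⟩
    suc (b + s) + (b + s)       <⟨ +-monoʳ-< (suc (b + s)) ≤-refl ⟩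
    suc (b + s) + suc (b + s)   ∎
    where open ≤-Reasoning

  double-< : ∀ {m n} → m < n → m + m < n + n
  double-< p = +-mono-< p p

  ∅ᴱ : Env
  ∅ᴱ _ = ∅ᴰ

  module Termination (tick lookupTick : ℕ) (_⟶_ : 𝔼 → 𝔼 → Set) (Answer : 𝔼 → Set) where
    open Semantics tick lookupTick
    open Contextual _⟶_ Answer using (_↓)

    -- `cheaper` leaves the weight unconstrained, since substituting or copying may enlarge the
    -- expression. The observation `τ` is the same before and after the step, so the cost is always
    -- measured for one fixed observation.
    data Decreasing (s : 𝔼) (τ : Obs) (n : ℕ) (s′ : 𝔼) : Set where
      cheaper : ∀ {m} → m < n → has (⦅ s′ ⦆ ∅ᴱ) τ m → Decreasing s τ n s′
      lighter : has (⦅ s′ ⦆ ∅ᴱ) τ n → weight s′ < weight s → Decreasing s τ n s′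

    Progress : 𝔼 → Obs → ℕ → Set
    Progress s τ n = Answer s ⊎ ∃ λ s′ → s ⟶ s′ × Decreasing s τ n s′

    terminates : (∀ {s τ n} → has (⦅ s ⦆ ∅ᴱ) τ n → Progress s τ n) → ∀ {s} → Inhabited (⦅ s ⦆ ∅ᴱ) → s ↓
    terminates progress {s} (τ , n , p) = go (<-wellFounded n) s (<-wellFounded (weight s)) p
      where
      mutual
        go : ∀ {n} → Acc _<_ n → ∀ s → Acc _<_ (weight s) → has (⦅ s ⦆ ∅ᴱ) τ n → s ↓
        go n-acc s s-acc p = continue n-acc s s-acc (progress p)

        continue : ∀ {n} → Acc _<_ n → ∀ s → Acc _<_ (weight s) → Progress s τ n → s ↓
        continue n-acc s s-acc (inj₁ a) = s , ε , a
        continue (acc n-acc) s s-acc (inj₂ (s′ , r , cheaper l q)) =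
          let v , rs , a = go (n-acc l) s′ (<-wellFounded (weight s′)) q in v , r ◅ rs , a
        continue n-acc s (acc s-acc) (inj₂ (s′ , r , lighter q l)) =
          let v , rs , a = go n-acc s′ (s-acc l) q in v , r ◅ rs , a

  -- Decomposition of expressions: heads, frames and binders

  data Head : 𝔼 → Set where
    varʰ    : ∀ x → Head (var x)
    lamʰ    : ∀ s → Head (lam s)
    conʰ    : ∀ T c ss → Head (con T c ss)
    letrecʰ : ∀ {k} (bs : Vec 𝔼 (suc k)) s → Head (letrec bs s)

  data Frame : Set where
    appᶠ  : 𝔼 → Frame
    caseᶠ : ∀ T → Vec 𝔼 (size T) → Frame
    seqᶠ  : 𝔼 → Frame

  infixl 8 _⟦_⟧ᶠ
  _⟦_⟧ᶠ : Frame → 𝔼 → 𝔼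
  appᶠ t       ⟦ s ⟧ᶠ = app s t
  caseᶠ T alts ⟦ s ⟧ᶠ = case T s alts
  seqᶠ t       ⟦ s ⟧ᶠ = seq s t

  -- An `AppCtx` exposes its outermost frame, but a redex is formed by the head and the innermost
  -- one; hence this insertion of a frame at the hole.
  _▹_ : AppCtx → Frame → AppCtx
  holeᴬ          ▹ appᶠ t       = appᴬ holeᴬ t
  holeᴬ          ▹ caseᶠ T alts = caseᴬ T holeᴬ alts
  holeᴬ          ▹ seqᶠ t       = seqᴬ holeᴬ t
  appᴬ A t       ▹ f            = appᴬ (A ▹ f) t
  caseᴬ T A alts ▹ f            = caseᴬ T (A ▹ f) alts
  seqᴬ A t       ▹ f            = seqᴬ (A ▹ f) t

  ▹-⟦⟧ : ∀ A f {s} → (A ▹ f) ⟦ s ⟧ᴬ ≡ A ⟦ f ⟦ s ⟧ᶠ ⟧ᴬ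
  ▹-⟦⟧ holeᴬ (appᶠ t)       = refl
  ▹-⟦⟧ holeᴬ (caseᶠ T alts) = refl
  ▹-⟦⟧ holeᴬ (seqᶠ t)       = refl
  ▹-⟦⟧ (appᴬ A t) f         = cong (λ s → app s t) (▹-⟦⟧ A f)
  ▹-⟦⟧ (caseᴬ T A alts) f   = cong (λ s → case T s alts) (▹-⟦⟧ A f)
  ▹-⟦⟧ (seqᴬ A t) f         = cong (λ s → seq s t) (▹-⟦⟧ A f)

  data Focus : 𝔼 → Set where
    bare   : ∀ {h} → Head h → Focus h
    framed : ∀ A f {h} → Head h → Focus (A ⟦ f ⟦ h ⟧ᶠ ⟧ᴬ)

  focus : ∀ s → Focus s
  focus (var x)         = bare (varʰ x)
  focus (lam s)         = bare (lamʰ s)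
  focus (con T c ss)    = bare (conʰ T c ss)
  focus (letrec bs s)   = bare (letrecʰ bs s)
  focus (app s t) with focus s
  ... | bare h       = framed holeᴬ (appᶠ t) h
  ... | framed A f h = framed (appᴬ A t) f h
  focus (seq s t) with focus s
  ... | bare h       = framed holeᴬ (seqᶠ t) h
  ... | framed A f h = framed (seqᴬ A t) f h
  focus (case T s alts) with focus s
  ... | bare h       = framed holeᴬ (caseᶠ T alts) h
  ... | framed A f h = framed (caseᴬ T A alts) f h

  data LetView : 𝔼 → Set where
    below : ∀ L {s} → (∀ {k} {bs : Vec 𝔼 (suc k)} {t} → s ≢ letrec bs t) → LetView (L ⟦ s ⟧ᴸ)

  letView : ∀ s → LetView s
  letView (letrec bs s) with letView s
  ... | below L p = below (letrecᴸ bs L) p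
  letView (var x)         = below holeᴸ λ ()
  letView (lam s)         = below holeᴸ λ ()
  letView (con T c ss)    = below holeᴸ λ ()
  letView (app s t)       = below holeᴸ λ ()
  letView (seq s t)       = below holeᴸ λ ()
  letView (case T s alts) = below holeᴸ λ ()

  -- Resolves the index `x` at the hole of `L`. The equation in `bound` splits `L` at the letrec
  -- that binds `x`, which is the shape that (gcp) requires.
  data Binder (L : LetCtx) (x : ℕ) : Set where
    bound : ∀ L₁ {k} (bs : Vec 𝔼 (suc k)) L₂ (i : Fin (suc k)) →
      (∀ s → L ⟦ s ⟧ᴸ ≡ L₁ ⟦ letrec bs (L₂ ⟦ s ⟧ᴸ) ⟧ᴸ) → x ≡ depthᴸ L₂ + toℕ i → Binder L x
    free  : ∀ y → x ≡ depthᴸ L + y → Binder L x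

  binder : ∀ L x → Binder L x
  binder holeᴸ x = free x refl
  binder (letrecᴸ {k} bs L) x with binder L x
  ... | bound L₁ bs′ L₂ i p q = bound (letrecᴸ bs L₁) bs′ L₂ i (λ s → cong (letrec bs) (p s)) q
  ... | free y p with y <? suc k
  ...   | yes l = bound holeᴸ bs L (fromℕ< l) (λ s → refl) (trans p (cong (depthᴸ L +_) (sym (toℕ-fromℕ< l))))
  ...   | no ¬l = let z , q = m≤n⇒∃[o]m+o≡n (≮⇒≥ ¬l) in
    free z (trans p (trans (cong (depthᴸ L +_) (sym q)) (sym (+-assoc (depthᴸ L) (suc k) z))))

  -- Soundness and adequacy for L_name

  module Name (tick lookupTick : ℕ) where
    open Semantics tick lookupTick

    envᴸ : LetCtx → Env → Env
    envᴸ holeᴸ          ρ = ρ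
    envᴸ (letrecᴸ bs L) ρ = envᴸ L (scope* bs ρ)

    ⦅⦆-L : ∀ L {s ρ} → ⦅ L ⟦ s ⟧ᴸ ⦆ ρ ≡ ⦅ s ⦆ (envᴸ L ρ)
    ⦅⦆-L holeᴸ          = refl
    ⦅⦆-L (letrecᴸ bs L) = ⦅⦆-L L

    envᴸ-tail : ∀ L {ρ} x → envᴸ L ρ (depthᴸ L + x) ≡ ρ x
    envᴸ-tail holeᴸ x = refl
    envᴸ-tail (letrecᴸ {k} bs L) {ρ} x = trans
      (cong (envᴸ L (scope* bs ρ)) (+-assoc (depthᴸ L) (suc k) x))
      (trans (envᴸ-tail L (suc k + x)) (scope-tail (suc k) {⦅ bs ⦆*} x))

    delay-A : ∀ A k {s t ρ} → ⦅ s ⦆ ρ ≈ delay k (⦅ t ⦆ ρ) → ⦅ A ⟦ s ⟧ᴬ ⦆ ρ ≈ delay k (⦅ A ⟦ t ⟧ᴬ ⦆ ρ)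
    delay-A holeᴬ k p = p
    delay-A (appᴬ A t) k p = ≈-trans
      (delay-cong tick (≈-trans (Apply-cong (delay-A A k p) ≈-refl) (Apply-delay k))) (delay-comm tick k)
    delay-A (caseᴬ T A alts) k p = ≈-trans
      (delay-cong tick (≈-trans (Case-cong (delay-A A k p) (λ _ _ → ≈-refl)) (Case-delay k))) (delay-comm tick k)
    delay-A (seqᴬ A t) k p = ≈-trans
      (delay-cong tick (≈-trans (Seq-cong (delay-A A k p) ≈-refl) (Seq-delay k))) (delay-comm tick k)

    delay-L : ∀ L k {s t ρ} → ⦅ s ⦆ (envᴸ L ρ) ≈ delay k (⦅ t ⦆ (envᴸ L ρ)) → ⦅ L ⟦ s ⟧ᴸ ⦆ ρ ≈ delay k (⦅ L ⟦ t ⟧ᴸ ⦆ ρ)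
    delay-L L k p = ≈-trans (≈-reflexive (⦅⦆-L L)) (≈-trans p (delay-cong k (≈-reflexive (sym (⦅⦆-L L)))))

    delay-R : ∀ R k {s t} → (∀ {ρ} → ⦅ s ⦆ ρ ≈ delay k (⦅ t ⦆ ρ)) → ∀ {ρ} → ⦅ R ⟦ s ⟧ᴿ ⦆ ρ ≈ delay k (⦅ R ⟦ t ⟧ᴿ ⦆ ρ)
    delay-R (L ∘ᴿ A) k p = delay-L L k (delay-A A k p)

    cost : ∀ {s t} → s ⟶ⁿ t → ℕ
    cost (betaⁿ R)  = tick
    cost (gcpⁿ L R) = lookupTick
    cost (lappⁿ R)  = 0
    cost (lcaseⁿ R) = 0
    cost (lseqⁿ R)  = 0
    cost (seqⁿ R v) = tick
    cost (caseⁿ R)  = tick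

    -- An exact equation serves both directions: without costs it transports observations backwards
    -- along a reduction, and with costs 1 it shows that every step other than a rearrangement of
    -- letrec lowers the cost.
    step-≈ : ∀ {s t} (r : s ⟶ⁿ t) {ρ} → ⦅ s ⦆ ρ ≈ delay (cost r) (⦅ t ⦆ ρ)
    step-≈ (betaⁿ {s} {t} R) = delay-R R tick
      (≈-trans (β-≈ tt tt s t) (delay-cong tick (≈-sym (subst-≈ (instantiate (t ∷ [])) s λ x →
        ≈-trans (instantiate-≈ (t ∷ []) x) (splice-≋ 1 {E = splice 1 (λ _ → ⦅ t ⦆ _) _} (λ { zero _ → ≈-refl ; (suc _) (s≤s ()) }) (λ _ → ≈-refl) x)))))
    step-≈ (gcpⁿ {bs = bs} {x} L (L′ ∘ᴿ A)) =
      delay-L L lookupTick (delay-L L′ lookupTick (delay-A A lookupTick (≈-trans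
        (≈-reflexive (envᴸ-tail L′ (toℕ x)))
        (≈-trans (scope*-lookup bs x)
                 (delay-cong lookupTick (≈-sym (shift-≈ (depthᴸ L′) (lookup bs x) (envᴸ-tail L′))))))))
    step-≈ (lappⁿ {s = s} {t} {bs} R)     = delay-R R 0 (lapp-≈ bs s t)
    step-≈ (lcaseⁿ {s = s} {alts} {bs} R) = delay-R R 0 (lcase-≈ bs s alts)
    step-≈ (lseqⁿ {s = s} {t} {bs} R)     = delay-R R 0 (lseq-≈ bs s t)
    step-≈ (seqⁿ {s = s} R v)             = delay-R R tick (seq-≈ tt s v)
    step-≈ (caseⁿ {T} {c} {ss} {alts} R)  = delay-R R tick
      (≈-trans (case-≈ tt tt T c ss alts)
               (delay-cong tick (≈-sym (subst-≈ (instantiate ss) (lookup alts c) (instantiate-≈ ss)))))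

    inhabited-A : ∀ A {s ρ} → Inhabited (⦅ A ⟦ s ⟧ᴬ ⦆ ρ) → Inhabited (⦅ s ⦆ ρ)
    inhabited-A holeᴬ p = p
    inhabited-A (appᴬ A t) {s} (τ , n , p) with m , _ , F , q , _ ← delay-elim tick _ p = inhabited-A A {s} (_ , m , q)
    inhabited-A (caseᴬ T A alts) {s} (τ , n , p) with m , _ , a , b , _ , c , F , q , _ ← delay-elim tick _ p =
      inhabited-A A {s} (_ , a , q)
    inhabited-A (seqᴬ A t) {s} (τ , n , p) with m , _ , a , b , _ , (σ , q) , _ ← delay-elim tick _ p =
      inhabited-A A {s} (_ , a , q)

    inhabited-frame : ∀ f {s ρ} → Inhabited (⦅ f ⟦ s ⟧ᶠ ⦆ ρ) → Inhabited (⦅ s ⦆ ρ)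
    inhabited-frame (appᶠ t)       {s} = inhabited-A (appᴬ holeᴬ t) {s}
    inhabited-frame (caseᶠ T alts) {s} = inhabited-A (caseᴬ T holeᴬ alts) {s}
    inhabited-frame (seqᶠ t)       {s} = inhabited-A (seqᴬ holeᴬ t) {s}

    answer-inhabited : ∀ {s ρ} → Answerⁿ s → Inhabited (⦅ s ⦆ ρ)
    answer-inhabited {ρ = ρ} (answer L v) = let σ , p = value-inhabited v {envᴸ L ρ} in
      σ , 0 , to (⊆-reflexive (sym (⦅⦆-L L))) p

    -- Ill-typed redexes are stuck without being answers. Having no observation is what excludes
    -- them from `progress`.
    case-lam-⊥ : ∀ {T s alts ρ} → Inhabited (⦅ case T (lam s) alts ⦆ ρ) → ⊥
    case-lam-⊥ (τ , n , p) with _ , _ , a , b , _ , c , F , () , _ ← delay-elim tick _ p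

    app-con-⊥ : ∀ {T c ss t ρ} → Inhabited (⦅ app (con T c ss) t ⦆ ρ) → ⊥
    app-con-⊥ (τ , n , p) with _ , _ , F , () , _ ← delay-elim tick _ p

    case-con-type : ∀ {T T′ c ss alts ρ} → Inhabited (⦅ case T (con T′ c ss) alts ⦆ ρ) → T′ ≡ T
    case-con-type (τ , n , p) with _ , _ , a , b , _ , c , F , (refl , _) , _ ← delay-elim tick _ p = refl

    progress-var : ∀ L A x → Inhabited (⦅ L ⟦ A ⟦ var x ⟧ᴬ ⟧ᴸ ⦆ ∅ᴱ) → ∃ (L ⟦ A ⟦ var x ⟧ᴬ ⟧ᴸ ⟶ⁿ_)
    progress-var L A x p with binder L x
    ... | bound L₁ bs L₂ i eq refl rewrite eq (A ⟦ var x ⟧ᴬ) = _ , gcpⁿ {x = i} L₁ (L₂ ∘ᴿ A)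
    -- A free variable denotes `∅ᴰ` in `∅ᴱ`, but an expression with an observation has one for the
    -- variable at its evaluation position.
    ... | free y refl with () ← proj₂ (proj₂ (≡-subst Inhabited (envᴸ-tail L y)
                                   (inhabited-A A {var x} (≡-subst Inhabited (⦅⦆-L L) p))))

    progress-framed : ∀ L A f {h} → Head h → Inhabited (⦅ L ⟦ A ⟦ f ⟦ h ⟧ᶠ ⟧ᴬ ⟧ᴸ ⦆ ∅ᴱ) →
      ∃ (L ⟦ A ⟦ f ⟦ h ⟧ᶠ ⟧ᴬ ⟧ᴸ ⟶ⁿ_)
    progress-framed L A f {h} H p = step f H (inhabited-A A {f ⟦ _ ⟧ᶠ} (≡-subst Inhabited (⦅⦆-L L) p)) p
      where
      step : ∀ f {h} → Head h → Inhabited (⦅ f ⟦ h ⟧ᶠ ⦆ (envᴸ L ∅ᴱ)) → Inhabited (⦅ L ⟦ A ⟦ f ⟦ h ⟧ᶠ ⟧ᴬ ⟧ᴸ ⦆ ∅ᴱ) →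
        ∃ (L ⟦ A ⟦ f ⟦ h ⟧ᶠ ⟧ᴬ ⟧ᴸ ⟶ⁿ_)
      step f              (varʰ x)       q p =
        ≡-subst (λ s → ∃ (L ⟦ s ⟧ᴸ ⟶ⁿ_)) (▹-⟦⟧ A f) (progress-var L (A ▹ f) x
          (≡-subst (λ s → Inhabited (⦅ L ⟦ s ⟧ᴸ ⦆ ∅ᴱ)) (sym (▹-⟦⟧ A f)) p))
      step (appᶠ t)       (lamʰ s)       q p = _ , betaⁿ (L ∘ᴿ A)
      step (caseᶠ T alts) (lamʰ s)       q p = ⊥-elim (case-lam-⊥ {s = s} {alts} q)
      step (seqᶠ t)       (lamʰ s)       q p = _ , seqⁿ (L ∘ᴿ A) abstraction
      step (appᶠ t)       (conʰ T c ss)  q p = ⊥-elim (app-con-⊥ {ss = ss} {t} q)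
      step (caseᶠ T alts) (conʰ T′ c ss) q p with refl ← case-con-type {ss = ss} {alts} q = _ , caseⁿ (L ∘ᴿ A)
      step (seqᶠ t)       (conʰ T c ss)  q p = _ , seqⁿ (L ∘ᴿ A) application
      step (appᶠ t)       (letrecʰ bs s) q p = _ , lappⁿ (L ∘ᴿ A)
      step (caseᶠ T alts) (letrecʰ bs s) q p = _ , lcaseⁿ (L ∘ᴿ A)
      step (seqᶠ t)       (letrecʰ bs s) q p = _ , lseqⁿ (L ∘ᴿ A)

    progress : ∀ s → Inhabited (⦅ s ⦆ ∅ᴱ) → Answerⁿ s ⊎ ∃ (s ⟶ⁿ_)
    progress s p with letView s
    ... | below L {s₀} ¬letrec with focus s₀
    ...   | bare (varʰ x)       = inj₂ (progress-var L holeᴬ x p)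
    ...   | bare (lamʰ s)       = inj₁ (answer L abstraction)
    ...   | bare (conʰ T c ss)  = inj₁ (answer L application)
    ...   | bare (letrecʰ bs s) = ⊥-elim (¬letrec refl)
    ...   | framed A f h        = inj₂ (progress-framed L A f h p)

    weight-A : ∀ A s t → weight s < weight t → weight (A ⟦ s ⟧ᴬ) < weight (A ⟦ t ⟧ᴬ)
    weight-A holeᴬ            s t p = p
    weight-A (appᴬ A _)       s t p = double-< (weight-A A s t p)
    weight-A (caseᴬ T A alts) s t p = double-< (weight-A A s t p)
    weight-A (seqᴬ A _)       s t p = double-< (weight-A A s t p)

    weight-R : ∀ R s t → weight s < weight t → weight (R ⟦ s ⟧ᴿ) < weight (R ⟦ t ⟧ᴿ)
    weight-R (holeᴸ        ∘ᴿ A) s t p = weight-A A s t p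
    weight-R (letrecᴸ bs L ∘ᴿ A) s t p = s≤s (+-monoʳ-< (weight* bs) (weight-R (L ∘ᴿ A) s t p))

  name-expansion : ∀ {s} → s ↓ⁿ → Inhabited (Semantics.⦅_⦆ 0 0 s ∅ᴱ)
  name-expansion (v , rs , a) = go rs a
    where
    open Name 0 0
    open Semantics 0 0
    cost-0 : ∀ {s t} (r : s ⟶ⁿ t) → cost r ≡ 0
    cost-0 (betaⁿ R)  = refl
    cost-0 (gcpⁿ L R) = refl
    cost-0 (lappⁿ R)  = refl
    cost-0 (lcaseⁿ R) = refl
    cost-0 (lseqⁿ R)  = refl
    cost-0 (seqⁿ R v) = refl
    cost-0 (caseⁿ R)  = refl
    go : ∀ {s v} → Star _⟶ⁿ_ s v → Answerⁿ v → Inhabited (⦅ s ⦆ ∅ᴱ)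
    go ε a = answer-inhabited a
    go {s} (_◅_ {j = t} r rs) a with τ , n , p ← go rs a =
      τ , n , to (bwd (step-≈ r)) (≡-subst (λ k → has (delay k (⦅ t ⦆ ∅ᴱ)) τ n) (sym (cost-0 r)) p)

  name-adequate : ∀ {s} → Inhabited (Semantics.⦅_⦆ 1 1 s ∅ᴱ) → s ↓ⁿ
  name-adequate = terminates λ {s} {τ} {n} p → decrease p (progress s (τ , n , p))
    where
    open Name 1 1
    open Semantics 1 1
    open Termination 1 1 _⟶ⁿ_ Answerⁿ
    smaller : ∀ {s t τ n} (r : s ⟶ⁿ t) → has (⦅ s ⦆ ∅ᴱ) τ n → Decreasing s τ n t
    smaller {n = n} r p with to (fwd (step-≈ r)) p
    smaller {n = suc n} (betaⁿ R)  _ | q = cheaper ≤-refl q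
    smaller {n = suc n} (gcpⁿ L R) _ | q = cheaper ≤-refl q
    smaller {n = suc n} (seqⁿ R v) _ | q = cheaper ≤-refl q
    smaller {n = suc n} (caseⁿ R)  _ | q = cheaper ≤-refl q
    smaller (lappⁿ {s = s} {t} {bs} R) _ | q =
      lighter q (weight-R R (letrec bs (app s (shift _ t))) (app (letrec bs s) t)
                            (extrusion-weight (weight* bs) (weight s)))
    smaller (lcaseⁿ {T = T} {s} {alts} {bs} R) _ | q =
      lighter q (weight-R R (letrec bs (case T s (shiftAlts T _ alts))) (case T (letrec bs s) alts)
                            (extrusion-weight (weight* bs) (weight s)))
    smaller (lseqⁿ {s = s} {t} {bs} R) _ | q =
      lighter q (weight-R R (letrec bs (seq s (shift _ t))) (seq (letrec bs s) t)
                            (extrusion-weight (weight* bs) (weight s)))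
    decrease : ∀ {s τ n} → has (⦅ s ⦆ ∅ᴱ) τ n → Answerⁿ s ⊎ ∃ (s ⟶ⁿ_) → Progress s τ n
    decrease p (inj₁ a)       = inj₁ a
    decrease p (inj₂ (t , r)) = inj₂ (t , r , smaller r p)

  -- Renaming under contexts, and contexts of evaluation positions

  lookup-rename* : ∀ {n} θ (ss : Vec (Exp A) n) i → lookup (rename* θ ss) i ≡ rename θ (lookup ss i)
  lookup-rename* θ (s ∷ ss) zero    = refl
  lookup-rename* θ (s ∷ ss) (suc i) = lookup-rename* θ ss i

  lookup-renameAlts : ∀ {n} ars θ (ss : Vec (Exp A) n) i →
    lookup (renameAlts ars θ ss) i ≡ rename (ext (ars i) θ) (lookup ss i)
  lookup-renameAlts ars θ (s ∷ ss) zero    = refl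
  lookup-renameAlts ars θ (s ∷ ss) (suc i) = lookup-renameAlts (ars ∘ suc) θ ss i

  rename*-[]≔ : ∀ {n} θ (ss : Vec (Exp A) n) i {s} → rename* θ (ss [ i ]≔ s) ≡ rename* θ ss [ i ]≔ rename θ s
  rename*-[]≔ θ (_ ∷ ss) zero    = refl
  rename*-[]≔ θ (_ ∷ ss) (suc i) = cong (_ ∷_) (rename*-[]≔ θ ss i)

  renameAlts-[]≔ : ∀ {n} ars θ (ss : Vec (Exp A) n) i {s} →
    renameAlts ars θ (ss [ i ]≔ s) ≡ renameAlts ars θ ss [ i ]≔ rename (ext (ars i) θ) s
  renameAlts-[]≔ ars θ (_ ∷ ss) zero    = refl
  renameAlts-[]≔ ars θ (_ ∷ ss) (suc i) = cong (_ ∷_) (renameAlts-[]≔ (ars ∘ suc) θ ss i)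

  ext-+ : ∀ m n θ → ext (m + n) θ ≡ ext m (ext n θ)
  ext-+ zero    n θ = refl
  ext-+ (suc m) n θ = cong ext₁ (ext-+ m n θ)

  ext-tail : ∀ k θ x → ext k θ (k + x) ≡ k + θ x
  ext-tail zero    θ x = refl
  ext-tail (suc k) θ x = cong suc (ext-tail k θ x)

  depth-rename : ∀ θ (C : Ctx A) → depth (renameᶜ θ C) ≡ depth C
  depth-rename θ hole                 = refl
  depth-rename θ (appˡ a C t)         = depth-rename θ C
  depth-rename θ (appʳ a t C)         = depth-rename θ C
  depth-rename θ (lamᵇ a C)           = cong (_+ 1) (depth-rename (ext 1 θ) C)
  depth-rename θ (letrecⁱ {k} a bs C) = cong (_+ suc k) (depth-rename (ext (suc k) θ) C)
  depth-rename θ (letrecᵇ {k} a bs i C t) = cong (_+ suc k) (depth-rename (ext (suc k) θ) C)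
  depth-rename θ (conᵃ a T c ss i C)  = depth-rename θ C
  depth-rename θ (seqˡ a C t)         = depth-rename θ C
  depth-rename θ (seqʳ a t C)         = depth-rename θ C
  depth-rename θ (caseˢ a T C alts)   = depth-rename θ C
  depth-rename θ (caseᵃ a T t alts i C) = cong (_+ ar T i) (depth-rename (ext (ar T i) θ) C)

  rename-plug : ∀ θ (C : Ctx A) s → rename θ (C ⟦ s ⟧) ≡ renameᶜ θ C ⟦ rename (ext (depth C) θ) s ⟧
  rename-plug θ hole s         = refl
  rename-plug θ (appˡ a C t) s = cong (λ u → app^ a u (rename θ t)) (rename-plug θ C s)
  rename-plug θ (appʳ a t C) s = cong (app^ a (rename θ t)) (rename-plug θ C s)
  rename-plug θ (lamᵇ a C) s rewrite ext-+ (depth C) 1 θ = cong (lam^ a) (rename-plug (ext 1 θ) C s)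
  rename-plug θ (letrecⁱ {k} a bs C) s rewrite ext-+ (depth C) (suc k) θ =
    cong (letrec^ a (rename* (ext (suc k) θ) bs)) (rename-plug (ext (suc k) θ) C s)
  rename-plug θ (letrecᵇ {k} a bs i C t) s rewrite ext-+ (depth C) (suc k) θ =
    cong (λ bs → letrec^ a bs (rename (ext (suc k) θ) t))
         (trans (rename*-[]≔ (ext (suc k) θ) bs i) (cong (rename* (ext (suc k) θ) bs [ i ]≔_) (rename-plug (ext (suc k) θ) C s)))
  rename-plug θ (conᵃ a T c ss i C) s =
    cong (con^ a T c) (trans (rename*-[]≔ θ ss i) (cong (rename* θ ss [ i ]≔_) (rename-plug θ C s)))
  rename-plug θ (seqˡ a C t) s = cong (λ u → seq^ a u (rename θ t)) (rename-plug θ C s)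
  rename-plug θ (seqʳ a t C) s = cong (seq^ a (rename θ t)) (rename-plug θ C s)
  rename-plug θ (caseˢ a T C alts) s = cong (λ u → case^ a T u (renameAlts (ar T) θ alts)) (rename-plug θ C s)
  rename-plug θ (caseᵃ a T t alts i C) s rewrite ext-+ (depth C) (ar T i) θ =
    cong (case^ a T (rename θ t)) (trans (renameAlts-[]≔ (ar T) θ alts i)
      (cong (renameAlts (ar T) θ alts [ i ]≔_) (rename-plug (ext (ar T i) θ) C s)))

  data Spine {A : Set} : Ctx A → Set where
    hole  : Spine hole
    appˡ  : ∀ {a} {C : Ctx A} {t} → Spine C → Spine (appˡ a C t)
    seqˡ  : ∀ {a} {C : Ctx A} {t} → Spine C → Spine (seqˡ a C t)
    caseˢ : ∀ {a T} {C : Ctx A} {alts} → Spine C → Spine (caseˢ a T C alts)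

  spine-depth : ∀ {C : Ctx A} → Spine C → depth C ≡ 0
  spine-depth hole      = refl
  spine-depth (appˡ p)  = spine-depth p
  spine-depth (seqˡ p)  = spine-depth p
  spine-depth (caseˢ p) = spine-depth p

  spine-rename : ∀ θ {C : Ctx A} → Spine C → Spine (renameᶜ θ C)
  spine-rename θ hole      = hole
  spine-rename θ (appˡ p)  = appˡ (spine-rename θ p)
  spine-rename θ (seqˡ p)  = seqˡ (spine-rename θ p)
  spine-rename θ (caseˢ p) = caseˢ (spine-rename θ p)

  -- The rules of L_LR as equations

  module Sharing (tick : ℕ) where
    open Semantics tick 0 public

    spine-delay : ∀ k {C : Ctx A} → Spine C → ∀ {s t ρ} → ⦅ s ⦆ ρ ≈ delay k (⦅ t ⦆ ρ) → ⦅ C ⟦ s ⟧ ⦆ ρ ≈ delay k (⦅ C ⟦ t ⟧ ⦆ ρ)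
    spine-delay k hole p = p
    spine-delay k (appˡ c) p = ≈-trans
      (delay-cong tick (≈-trans (Apply-cong (spine-delay k c p) ≈-refl) (Apply-delay k))) (delay-comm tick k)
    spine-delay k (caseˢ c) p = ≈-trans
      (delay-cong tick (≈-trans (Case-cong (spine-delay k c p) (λ _ _ → ≈-refl)) (Case-delay k))) (delay-comm tick k)
    spine-delay k (seqˡ c) p = ≈-trans
      (delay-cong tick (≈-trans (Seq-cong (spine-delay k c p) ≈-refl) (Seq-delay k))) (delay-comm tick k)

    []≔*-≈ : ∀ {n} (ss : Vec (Exp A) n) i {s t ρ ρ′} → ρ ≋ ρ′ → ⦅ s ⦆ ρ ≈ ⦅ t ⦆ ρ′ →
      ⦅ ss [ i ]≔ s ⦆* ρ ≋ ⦅ ss [ i ]≔ t ⦆* ρ′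
    []≔*-≈ (s ∷ ss) zero    p q zero    = q
    []≔*-≈ (s ∷ ss) zero    p q (suc x) = ⦅⦆*-cong ss p x
    []≔*-≈ (s ∷ ss) (suc i) p q zero    = ⦅⦆-cong s p
    []≔*-≈ (s ∷ ss) (suc i) p q (suc x) = []≔*-≈ ss i p q x

    []≔ᵃ-≈ : ∀ {n} (ss : Vec (Exp A) n) ars i {s t ρ} → (∀ δ → ⦅ s ⦆ (splice (ars i) δ ρ) ≈ ⦅ t ⦆ (splice (ars i) δ ρ)) →
      ∀ c δ → ⦅ ss [ i ]≔ s ⦆ᵃ ars ρ c δ ≈ ⦅ ss [ i ]≔ t ⦆ᵃ ars ρ c δ
    []≔ᵃ-≈ (s ∷ ss) ars zero    p zero    δ = p δ
    []≔ᵃ-≈ (s ∷ ss) ars zero    p (suc c) δ = ≈-refl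
    []≔ᵃ-≈ (s ∷ ss) ars (suc i) p zero    δ = ≈-refl
    []≔ᵃ-≈ (s ∷ ss) ars (suc i) p (suc c) δ = []≔ᵃ-≈ ss (ars ∘ suc) i p c δ

    _extends_by_ : Env → Env → ℕ → Set₁
    ρ′ extends ρ by n = ∀ x → ρ′ (n + x) ≡ ρ x

    extends-splice : ∀ n k {δ ρ ρ′} → ρ′ extends splice k δ ρ by n → ρ′ extends ρ by (n + k)
    extends-splice n k {δ} {ρ′ = ρ′} p x = trans (cong ρ′ (+-assoc n k x)) (trans (p (k + x)) (splice-tail k {δ} x))

    -- The equation is demanded only in environments that agree with `ρ` outside the binders of `C`:
    -- copying a binding is an equation only where the variable has the value of that binding.
    ctx-≈ : ∀ (C : Ctx A) {s t ρ} → (∀ {ρ′} → ρ′ extends ρ by depth C → ⦅ s ⦆ ρ′ ≈ ⦅ t ⦆ ρ′) →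
      ⦅ C ⟦ s ⟧ ⦆ ρ ≈ ⦅ C ⟦ t ⟧ ⦆ ρ
    ctx-≈ hole p         = p λ _ → refl
    ctx-≈ (appˡ a C t) p = delay-cong tick (Apply-cong (ctx-≈ C p) ≈-refl)
    ctx-≈ (appʳ a t C) p = delay-cong tick (Apply-cong ≈-refl (ctx-≈ C p))
    ctx-≈ (lamᵇ a C) p   = Lam-cong λ δ → ctx-≈ C (λ {ρ′} e → p (extends-splice (depth C) 1 {δ} {_} {ρ′} e))
    ctx-≈ (letrecⁱ {k} a bs C) {ρ = ρ} p = ctx-≈ C (λ {ρ′} e → p (extends-splice (depth C) (suc k) {_} {ρ} {ρ′} e))
    ctx-≈ (letrecᵇ {k} a bs i C t) {s} {s′} {ρ} p = ⦅⦆-cong t (scope-cong (suc k)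
      {⦅ bs [ i ]≔ C ⟦ s ⟧ ⦆*} {⦅ bs [ i ]≔ C ⟦ s′ ⟧ ⦆*}
      (λ {δ} {δ′} q → []≔*-≈ bs i (splice-cong (suc k) q (λ _ → ≈-refl))
        (≈-trans (⦅⦆-cong (C ⟦ s ⟧) (splice-cong (suc k) q (λ _ → ≈-refl)))
                 (ctx-≈ C (λ {ρ′} e → p (extends-splice (depth C) (suc k) {δ′} {ρ} {ρ′} e)))))
      λ _ → ≈-refl)
    ctx-≈ (conᵃ a T c ss i C) p = Con-cong ([]≔*-≈ ss i (λ _ → ≈-refl) (ctx-≈ C p))
    ctx-≈ (seqˡ a C t) p = delay-cong tick (Seq-cong (ctx-≈ C p) ≈-refl)
    ctx-≈ (seqʳ a t C) p = delay-cong tick (Seq-cong ≈-refl (ctx-≈ C p))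
    ctx-≈ (caseˢ a T C alts) p = delay-cong tick (Case-cong (ctx-≈ C p) λ _ _ → ≈-refl)
    ctx-≈ (caseᵃ a T t alts i C) p = delay-cong tick (Case-cong ≈-refl
      ([]≔ᵃ-≈ alts (ar T) i λ δ → ctx-≈ C (λ {ρ′} e → p (extends-splice (depth C) (ar T i) {δ} {_} {ρ′} e))))

    scope*-tail : ∀ {n} (bs : Vec (Exp A) n) {ρ} x → scope* bs ρ (n + x) ≡ ρ x
    scope*-tail {n = n} bs = scope-tail n {⦅ bs ⦆*}

    -- After the shift no binding mentions a bound variable, so the fixpoint is reached after one
    -- unfolding. As lookups are free, such a letrec has the meaning of a substitution.
    shifted-scope : ∀ {n} (ss : Vec (Exp A) n) {ρ} → scope* (shift* n ss) ρ ≋ splice n (⦅ ss ⦆* ρ) ρ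
    shifted-scope {n = n} ss {ρ} x = ≈-sym (splice-≋ n {E = scope* (shift* n ss) ρ}
      (λ y y<n → ≈-sym (≈-trans (scope-unfold n (continuous* (shift* n ss)) y y<n)
        (rename*-≈ (n +_) ss (λ z → ≈-reflexive (scope*-tail (shift* n ss) z)) y)))
      (λ y → ≈-reflexive (sym (scope*-tail (shift* n ss) y))) x)

    letrec*-≡ : ∀ {n} a (bs : Vec LExp n) t {ρ} → ⦅ letrec* a bs t ⦆ ρ ≡ ⦅ t ⦆ (scope* bs ρ)
    letrec*-≡ a []       t = refl
    letrec*-≡ a (_ ∷ _) t = refl

    lbeta-≈ : ∀ a ℓ b (s : Exp A) t {ρ} →
      ⦅ app^ a (lam^ ℓ s) t ⦆ ρ ≈ delay tick (⦅ letrec^ b (shift 1 t ∷ []) s ⦆ ρ)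
    lbeta-≈ a ℓ b s t {ρ} = ≈-trans (β-≈ a ℓ s t) (delay-cong tick (⦅⦆-cong s λ x →
      ≈-trans (splice-≋ 1 {E = splice 1 (⦅ t ∷ [] ⦆* ρ) ρ} (λ { zero _ → ≈-refl ; (suc _) (s≤s ()) }) (λ _ → ≈-refl) x)
              (≈-sym (shifted-scope (t ∷ []) x))))

    case-c-≈ : ∀ a ℓ T c (ss : Vec LExp (ar T c)) alts {ρ} →
      ⦅ case^ a T (con^ ℓ T c ss) alts ⦆ ρ ≈ delay tick (⦅ letrec* ∅ (shift* (ar T c) ss) (lookup alts c) ⦆ ρ)
    case-c-≈ a ℓ T c ss alts {ρ} = ≈-trans (case-≈ a ℓ T c ss alts) (delay-cong tick
      (≈-trans (⦅⦆-cong (lookup alts c) λ x → ≈-sym (shifted-scope ss x))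
               (≈-reflexive (sym (letrec*-≡ ∅ (shift* (ar T c) ss) (lookup alts c))))))

    solves : ∀ {n} (bs : Vec (Exp A) n) {ρ} i → scope* bs ρ (toℕ i) ≈ ⦅ lookup bs i ⦆ (scope* bs ρ)
    solves = scope*-lookup

    SolvesAt : ∀ {n} → Vec (Exp A) n → Env → Fin n → Set
    SolvesAt bs E i = E (toℕ i) ≈ ⦅ lookup bs i ⦆ E

    -- Each of the two least solutions is closed under the other system, so Park induction applies
    -- both ways. The hypothesis omits the equation of `y`, because the solution of the new system
    -- is not yet known to satisfy the old binding of `y`.
    replace-≋ : ∀ {n} (bs : Vec (Exp A) n) y u →
      (∀ E → (∀ i → i ≢ y → SolvesAt bs E i) → ⦅ lookup bs y ⦆ E ≈ ⦅ u ⦆ E) →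
      ∀ {ρ} → scope* bs ρ ≋ scope* (bs [ y ]≔ u) ρ
    replace-≋ bs y u p {ρ} x = fw x , bw x
      where
      bs′ = bs [ y ]≔ u
      E E′ : Env
      E  = scope* bs ρ
      E′ = scope* bs′ ρ
      E′-solves : ∀ i → i ≢ y → SolvesAt bs E′ i
      E′-solves i i≢y = ≈-trans (solves bs′ i) (≈-reflexive (cong (λ s → ⦅ s ⦆ E′) (lookup∘update′ i≢y bs u)))
      fw : E ⊑ E′
      fw = scope*-least bs E′ step (λ x → ⊆-reflexive (sym (scope*-tail bs′ x)))
        where
        step : ∀ i → ⦅ lookup bs i ⦆ E′ ⊆ E′ (toℕ i)
        step i with i ≟ᶠ y
        ... | no i≢y   = bwd (E′-solves i i≢y)
        ... | yes refl = ⊆-trans (fwd (p E′ E′-solves))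
          (⊆-trans (⊆-reflexive (cong (λ s → ⦅ s ⦆ E′) (sym (lookup∘update i bs u)))) (bwd (solves bs′ i)))
      bw : E′ ⊑ E
      bw = scope*-least bs′ E step (λ x → ⊆-reflexive (sym (scope*-tail bs x)))
        where
        step : ∀ i → ⦅ lookup bs′ i ⦆ E ⊆ E (toℕ i)
        step i with i ≟ᶠ y
        ... | no i≢y   = ⊆-trans (⊆-reflexive (cong (λ s → ⦅ s ⦆ E) (lookup∘update′ i≢y bs u))) (bwd (solves bs i))
        ... | yes refl = ⊆-trans (⊆-reflexive (cong (λ s → ⦅ s ⦆ E) (lookup∘update i bs u)))
          (⊆-trans (bwd (p E (λ j _ → solves bs j))) (bwd (solves bs i)))

    chain-≈ : ∀ {n} {bs : Vec (Exp A) n} {x₁ xₘ xs E} → Chain bs x₁ xₘ xs → (∀ {i} → i ∈ xs → SolvesAt bs E i) →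
      E (toℕ xₘ) ≈ ⦅ lookup bs x₁ ⦆ E
    chain-≈ start p = p (here refl)
    chain-≈ {E = E} (next ch eq) p =
      ≈-trans (p (here refl)) (≈-trans (≈-reflexive (cong (λ s → ⦅ s ⦆ E) eq)) (chain-≈ ch (p ∘ there)))

    -- The meaning of the side condition in (cp-e), (seq-e) and (case-e): the rewritten binding is
    -- off the chain, so the equations along the chain stay available while that of `y` is in
    -- question.
    chain-except : ∀ {n} {bs : Vec (Exp A) n} {x₁ xₘ xs E y} → Chain bs x₁ xₘ xs → y ∉ xs →
      (∀ i → i ≢ y → SolvesAt bs E i) → E (toℕ xₘ) ≈ ⦅ lookup bs x₁ ⦆ E
    chain-except ch y∉ p = chain-≈ ch λ i∈ → p _ λ { refl → y∉ i∈ }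

    copy-≈ : ∀ d (m : A) (v : Exp A) x {E ρ} → E x ≈ ⦅ v ⦆ E → ρ extends E by d → ⦅ var^ m (d + x) ⦆ ρ ≈ ⦅ shift d v ⦆ ρ
    copy-≈ d m v x p e = ≈-trans (≈-reflexive (e x)) (≈-trans p (≈-sym (shift-≈ d v e)))

    cp-in-≈ : ∀ {k a b m xs} {bs : Vec (Exp A) (suc k)} {v x₁ xₘ} C → lookup bs x₁ ≡ v → Chain bs x₁ xₘ xs →
      ∀ {ρ} → ⦅ letrec^ a bs (C ⟦ var^ m (depth C + toℕ xₘ) ⟧) ⦆ ρ ≈ ⦅ letrec^ b bs (C ⟦ shift (depth C) v ⟧) ⦆ ρ
    cp-in-≈ {m = m} {bs = bs} {v} {xₘ = xₘ} C refl ch {ρ} =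
      ctx-≈ C (copy-≈ (depth C) m v (toℕ xₘ) {scope* bs ρ} (chain-≈ {E = scope* bs ρ} ch (λ {i} _ → solves bs i)))

    cp-e-≈ : ∀ {k a b m xs t} {bs : Vec (Exp A) (suc k)} {v x₁ xₘ y} C → lookup bs x₁ ≡ v → Chain bs x₁ xₘ xs → y ∉ xs →
      lookup bs y ≡ C ⟦ var^ m (depth C + toℕ xₘ) ⟧ →
      ∀ {ρ} → ⦅ letrec^ a bs t ⦆ ρ ≈ ⦅ letrec^ b (bs [ y ]≔ C ⟦ shift (depth C) v ⟧) t ⦆ ρ
    cp-e-≈ {m = m} {t = t} {bs} {v} {xₘ = xₘ} {y} C refl ch y∉ eq = ⦅⦆-cong t (replace-≋ bs y _ λ E p →
      ≈-trans (≈-reflexive (cong (λ s → ⦅ s ⦆ E) eq)) (ctx-≈ C (copy-≈ (depth C) m v (toℕ xₘ) {E} (chain-except {E = E} ch y∉ p))))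

    seq-var-≈ : ∀ b {m y} {v s : Exp A} {E ρ} → Value v → ρ y ≈ ⦅ v ⦆ E →
      ⦅ seq^ b (var^ m y) s ⦆ ρ ≈ delay tick (⦅ s ⦆ ρ)
    seq-var-≈ b v p = let σ , q = value-inhabited v in delay-cong tick (Seq-inhabited (σ , to (bwd p) q))

    module Append {A : Set} {m n : ℕ} (as : Vec (Exp A) m) (bs : Vec (Exp A) n) (ρ : Env) where
      env : Env
      env = scope* (as ++ bs) ρ

      front : ∀ i → env (toℕ i) ≈ ⦅ lookup as i ⦆ env
      front i = ≈-trans (≈-reflexive (cong env (sym (toℕ-↑ˡ i n)))) (≈-trans (solves (as ++ bs) (i ↑ˡ n))
        (≈-reflexive (cong (λ s → ⦅ s ⦆ env) (lookup-++ˡ as bs i))))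

      back : ∀ i → env (m + toℕ i) ≈ ⦅ lookup bs i ⦆ env
      back i = ≈-trans (≈-reflexive (cong env (sym (toℕ-↑ʳ m i)))) (≈-trans (solves (as ++ bs) (m ↑ʳ i))
        (≈-reflexive (cong (λ s → ⦅ s ⦆ env) (lookup-++ʳ as bs i))))

      tail : ∀ x → env (m + (n + x)) ≡ ρ x
      tail x = trans (cong env (sym (+-assoc m n x))) (scope*-tail (as ++ bs) x)

      least : ∀ E → (∀ i → ⦅ lookup as i ⦆ E ⊆ E (toℕ i)) → (∀ i → ⦅ lookup bs i ⦆ E ⊆ E (m + toℕ i)) →
        (∀ x → ρ x ⊆ E (m + (n + x))) → env ⊑ E
      least E p q r = scope-least (m + n) (continuous* (as ++ bs))
        (λ x _ → ⊆-trans (⊆-reflexive (⦅⦆*-++ as bs x))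
          (splice-⊑ m {E = E} (λ y _ → ⦅⦆*-⊑ as {E = E} p y) (⦅⦆*-⊑ bs {E = λ y → E (m + y)} q) x))
        (λ x → ⊆-trans (r x) (⊆-reflexive (cong E (sym (+-assoc m n x)))))

    lookup-shift* : ∀ {n} k (bs : Vec (Exp A) n) i {E E′} → (∀ x → E (k + x) ≡ E′ x) →
      ⦅ lookup (shift* k bs) i ⦆ E ≈ ⦅ lookup bs i ⦆ E′
    lookup-shift* k bs i {E} p =
      ≈-trans (≈-reflexive (cong (λ s → ⦅ s ⦆ E) (lookup-rename* (k +_) bs i))) (shift-≈ k (lookup bs i) p)

    -- A simple case of Bekić's law: `bs` does not refer to `as`, so solving `bs` first and `as`
    -- afterwards gives the joint solution.
    llet-in-≋ : ∀ {m n} (as : Vec (Exp A) m) (bs : Vec (Exp A) n) {ρ} →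
      scope* as (scope* bs ρ) ≋ scope* (as ++ shift* m bs) ρ
    llet-in-≋ {m = m} {n} as bs {ρ} x = fw x , bw x
      where
      E Y : Env
      E = scope* bs ρ
      Y = scope* as E
      open Append as (shift* m bs) ρ renaming (env to Z)
      fw : Y ⊑ Z
      fw = scope*-least as Z (bwd ∘ front) (scope*-least bs (λ x → Z (m + x))
        (λ i → ⊆-trans (bwd (lookup-shift* m bs i (λ _ → refl))) (bwd (back i)))
        (λ x → ⊆-reflexive (sym (tail x))))
      bw : Z ⊑ Y
      bw = least Y (bwd ∘ solves as)
        (λ i → ⊆-trans (fwd (lookup-shift* m bs i (scope*-tail as)))
          (⊆-trans (bwd (solves bs i)) (⊆-reflexive (sym (scope*-tail as (toℕ i))))))
        (λ x → ⊆-reflexive (sym (trans (scope*-tail as (n + x)) (scope*-tail bs x))))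

    -- Bekić's law proper: the fixpoint of `as` nested in the binding of `y` is recomputed at every
    -- stage of the outer one and still equals the joint solution. Each inclusion is a Park
    -- induction against the solution of the other system.
    llet-e-≋ : ∀ {k n ℓ s} (as : Vec (Exp A) (suc k)) (bs : Vec (Exp A) n) y → lookup bs y ≡ letrec^ ℓ as s →
      ∀ {ρ} → scope* as (scope* bs ρ) ≋ scope* (as ++ (shift* (suc k) bs [ y ]≔ s)) ρ
    llet-e-≋ {k = k} {n} {s = s} as bs y eq {ρ} x = fw x , bw x
      where
      m = suc k
      cs = shift* m bs [ y ]≔ s
      E Y : Env
      E = scope* bs ρ
      Y = scope* as E
      open Append as cs ρ renaming (env to Z)
      Z⁻ : Env
      Z⁻ x = Z (m + x)
      fw : Y ⊑ Z
      fw = scope*-least as Z (bwd ∘ front) (scope*-least bs Z⁻ step (λ x → ⊆-reflexive (sym (tail x))))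
        where
        step : ∀ i → ⦅ lookup bs i ⦆ Z⁻ ⊆ Z⁻ (toℕ i)
        step i with i ≟ᶠ y
        ... | yes refl = ⊆-trans (⊆-reflexive (cong (λ s → ⦅ s ⦆ Z⁻) eq))
          -- The inner solution over `Z⁻` lies below `Z`, because `Z` is closed under `as`.
          (⊆-trans (mono (continuous s) (scope*-least as Z (bwd ∘ front) (λ _ → ⊆-refl)))
          (⊆-trans (⊆-reflexive (cong (λ s → ⦅ s ⦆ Z) (sym (lookup∘update i (shift* m bs) s)))) (bwd (back i))))
        ... | no i≢y = ⊆-trans (bwd (lookup-shift* m bs i (λ _ → refl)))
          (⊆-trans (⊆-reflexive (cong (λ s → ⦅ s ⦆ Z) (sym (lookup∘update′ i≢y (shift* m bs) s)))) (bwd (back i)))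
      bw : Z ⊑ Y
      bw = least Y (bwd ∘ solves as) (λ i → ⊆-trans (step i) (⊆-reflexive (sym (scope*-tail as (toℕ i)))))
        (λ x → ⊆-reflexive (sym (trans (scope*-tail as (n + x)) (scope*-tail bs x))))
        where
        step : ∀ i → ⦅ lookup cs i ⦆ Y ⊆ E (toℕ i)
        step i with i ≟ᶠ y
        ... | yes refl = ⊆-trans (⊆-reflexive (cong (λ s → ⦅ s ⦆ Y) (lookup∘update i (shift* m bs) s)))
          (⊆-trans (⊆-reflexive (cong (λ s → ⦅ s ⦆ E) (sym eq))) (bwd (solves bs i)))
        ... | no i≢y = ⊆-trans (⊆-reflexive (cong (λ s → ⦅ s ⦆ Y) (lookup∘update′ i≢y (shift* m bs) s)))
          (⊆-trans (fwd (lookup-shift* m bs i (scope*-tail as))) (bwd (solves bs i)))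

    module OpenCon {n : ℕ} {T : Ty} {c : Fin (size T)} {ℓ : Labels} {ss : Vec LExp (ar T c)}
      (bs : Vec LExp n) {x₁ : Fin n} (eq : lookup bs x₁ ≡ con^ ℓ T c ss) where
      K = ar T c
      ys : Vec LExp K
      ys = tabulate λ i → var^ ∅ (toℕ i)
      v : LExp
      v = con^ ∅ T c ys
      cs : Vec LExp n
      cs = shift* K bs [ x₁ ]≔ v
      bs⁺ : Vec LExp (K + n)
      bs⁺ = open-con T c ss (shift* K bs) x₁

      lookup-ys : ∀ i {E} → ⦅ lookup ys i ⦆ E ≡ E (toℕ i)
      lookup-ys i {E} = cong (λ s → ⦅ s ⦆ E) (lookup∘tabulate (λ i → var^ ∅ (toℕ i)) i)

      -- Only the binding of `x₁` is changed, and there `args-closed` puts the fresh variables above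
      -- the components. Stated for a single `i`, so that in (case-e) the binding with the redex can
      -- be treated separately.
      open-con-closed : ∀ {Z : Env} → (∀ i → ⦅ lookup (shift* K ss) i ⦆ Z ⊆ Z (toℕ i)) → ∀ i →
        ⦅ lookup cs i ⦆ Z ⊆ Z (K + toℕ i) → ⦅ lookup bs i ⦆ (λ x → Z (K + x)) ⊆ Z (K + toℕ i)
      open-con-closed {Z} args-closed i closed with i ≟ᶠ x₁
      ... | yes refl = ⊆-trans (⊆-reflexive (cong (λ s → ⦅ s ⦆ (λ x → Z (K + x))) eq)) (⊆-trans (Con-mono args)
        (⊆-trans (⊆-reflexive (cong (λ s → ⦅ s ⦆ Z) (sym (lookup∘update i (shift* K bs) v)))) closed))
        where
        args : ⦅ ss ⦆* (λ x → Z (K + x)) ⊑ ⦅ ys ⦆* Z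
        args = ⦅⦆*-⊑ ss {E = ⦅ ys ⦆* Z} λ j → ⊆-trans (bwd (lookup-shift* K ss j (λ _ → refl)))
          (⊆-trans (args-closed j) (⊆-reflexive (sym (trans (⦅⦆*-lookup ys j) (lookup-ys j)))))
      ... | no i≢x₁ = ⊆-trans (bwd (lookup-shift* K bs i (λ _ → refl)))
        (⊆-trans (⊆-reflexive (cong (λ s → ⦅ s ⦆ Z) (sym (lookup∘update′ i≢x₁ (shift* K bs) v)))) closed)

      module _ (ρ : Env) where
        open Append (shift* K ss) cs ρ renaming (env to Z)
        private
          E Y Z⁻ : Env
          E = scope* bs ρ
          Y = splice K (⦅ ss ⦆* E) E
          Z⁻ x = Z (K + x)

        -- The fresh variables denote the components in the old environment, and the old variables
        -- keep their values: naming a component is invisible because lookups are free.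
        open-con-≋ : Y ≋ scope* bs⁺ ρ
        open-con-≋ x = fw x , bw x
          where
          Y-tail : ∀ x → Y (K + x) ≡ E x
          Y-tail = splice-tail K
          Y-head : ∀ i → Y (toℕ i) ≡ ⦅ lookup ss i ⦆ E
          Y-head i = trans (splice-head K (toℕ i) (toℕ<n i)) (⦅⦆*-lookup ss i)
          E⊑Z⁻ : E ⊑ Z⁻
          E⊑Z⁻ = scope*-least bs Z⁻ (λ i → open-con-closed {Z} (bwd ∘ front) i (bwd (back i)))
            (λ x → ⊆-reflexive (sym (tail x)))
          fw : Y ⊑ Z
          fw = splice-⊑ K {E = Z} (λ x x<K → ≡-subst (λ x → ⦅ ss ⦆* E x ⊆ Z x) (toℕ-fromℕ< x<K) (new (fromℕ< x<K))) E⊑Z⁻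
            where
            new : ∀ i → ⦅ ss ⦆* E (toℕ i) ⊆ Z (toℕ i)
            new i = ⊆-trans (⊆-reflexive (⦅⦆*-lookup ss i)) (⊆-trans (mono (continuous (lookup ss i)) E⊑Z⁻)
              (⊆-trans (bwd (lookup-shift* K ss i (λ _ → refl))) (bwd (front i))))
          bw : Z ⊑ Y
          bw = least Y
            (λ i → ⊆-trans (fwd (lookup-shift* K ss i Y-tail)) (⊆-reflexive (sym (Y-head i))))
            (λ i → ⊆-trans (step i) (⊆-reflexive (sym (Y-tail (toℕ i)))))
            (λ x → ⊆-reflexive (sym (trans (Y-tail (n + x)) (scope*-tail bs x))))
            where
            step : ∀ i → ⦅ lookup cs i ⦆ Y ⊆ E (toℕ i)
            step i with i ≟ᶠ x₁
            ... | yes refl = ⊆-trans (⊆-reflexive (cong (λ s → ⦅ s ⦆ Y) (lookup∘update i (shift* K bs) v)))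
              (⊆-trans (Con-mono (⦅⦆*-⊑ ys {E = ⦅ ss ⦆* E} λ j → ⊆-reflexive
                  (trans (lookup-ys j) (splice-head K (toℕ j) (toℕ<n j)))))
              (⊆-trans (⊆-reflexive (cong (λ s → ⦅ s ⦆ E) (sym eq))) (bwd (solves bs i))))
            ... | no i≢x₁ = ⊆-trans (⊆-reflexive (cong (λ s → ⦅ s ⦆ Y) (lookup∘update′ i≢x₁ (shift* K bs) v)))
              (⊆-trans (fwd (lookup-shift* K bs i Y-tail)) (bwd (solves bs i)))

        open-con-shift : ∀ (t : LExp) → ⦅ t ⦆ E ≈ ⦅ shift K t ⦆ (scope* bs⁺ ρ)
        open-con-shift t = ≈-sym (rename-≈ (K +_) t λ x →
          ≈-trans (≈-sym (open-con-≋ (K + x))) (≈-reflexive (splice-tail K x)))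

      lookup-old : ∀ {i} → i ≢ x₁ → lookup bs⁺ (K ↑ʳ i) ≡ shift K (lookup bs i)
      lookup-old {i} p = trans (lookup-++ʳ (shift* K ss) cs i)
        (trans (lookup∘update′ p (shift* K bs) v) (lookup-rename* (K +_) bs i))

      lookup-x₁ : lookup bs⁺ (K ↑ʳ x₁) ≡ v
      lookup-x₁ = trans (lookup-++ʳ (shift* K ss) cs x₁) (lookup∘update x₁ (shift* K bs) v)

      chain-open-con : ∀ {xₘ xs E} → Chain bs x₁ xₘ xs → (∀ {i} → i ∈ xs → SolvesAt bs⁺ E (K ↑ʳ i)) →
        E (K + toℕ xₘ) ≈ ⦅ v ⦆ E
      chain-open-con {E = E} start p = ≈-trans (≈-reflexive (cong E (sym (toℕ-↑ʳ K x₁))))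
        (≈-trans (p (here refl)) (≈-reflexive (cong (λ s → ⦅ s ⦆ E) lookup-x₁)))
      chain-open-con {E = E} (next {y = y} ch e) p = ≈-trans (≈-reflexive (cong E (sym (toℕ-↑ʳ K y))))
        (≈-trans (p (here refl)) (≈-trans (≈-reflexive (cong (λ s → ⦅ s ⦆ E)
          (trans (lookup-old y≢x₁) (cong (shift K) e)))) (chain-open-con ch (p ∘ there))))
        where
        y≢x₁ : y ≢ x₁
        y≢x₁ refl with () ← trans (sym e) eq

      -- The redex of (case-in) and (case-e) once the arguments of the constructor are shared.
      select-≈ : ∀ b m x d (alts : Vec LExp (size T)) {E ρ} → E (K + x) ≈ ⦅ v ⦆ E → ρ extends E by d →
        ⦅ rename (ext d (K +_)) (case^ b T (var^ m (d + x)) alts) ⦆ ρ ≈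
        delay tick (⦅ letrec* ∅ (tabulate {n = K} λ i → var^ ∅ (K + (d + toℕ i)))
                               (rename (ext (K + d) (K +_)) (lookup alts c)) ⦆ ρ)
      select-≈ b m x d alts {E} {ρ} p e = delay-cong tick
        (≈-trans (Case-cong scrutinee (λ _ _ → ≈-refl))
        (≈-trans (Case-Con (alternative-continuous (renameAlts (ar T) θ alts) (ar T) c))
        (≈-trans (≈-reflexive (trans (⦅⦆ᵃ-lookup (renameAlts (ar T) θ alts) c) (cong (λ s → ⦅ s ⦆ (splice K (⦅ ys ⦆* E) ρ))
                   (trans (lookup-renameAlts (ar T) θ alts c)
                          (cong (λ θ → rename θ (lookup alts c)) (sym (ext-+ K d (K +_))))))))
        (≈-trans (⦅⦆-cong (rename (ext (K + d) (K +_)) (lookup alts c)) (λ y → scoped y))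
                 (≈-reflexive (sym (letrec*-≡ ∅ zs (rename (ext (K + d) (K +_)) (lookup alts c)))))))))
        where
        θ = ext d (K +_)
        zs : Vec LExp K
        zs = tabulate λ i → var^ ∅ (K + (d + toℕ i))
        scrutinee : ρ (θ (d + x)) ≈ Con T c (⦅ ys ⦆* E)
        scrutinee = ≈-trans (≈-reflexive (trans (cong ρ (ext-tail d (K +_) x)) (e (K + x)))) p
        scoped : splice K (⦅ ys ⦆* E) ρ ≋ scope* zs ρ
        scoped = splice-≋ K {E = scope* zs ρ}
          (λ y y<K → ≡-subst (λ y → ⦅ ys ⦆* E y ≈ scope* zs ρ y) (toℕ-fromℕ< y<K) (new (fromℕ< y<K)))
          (λ y → ≈-reflexive (sym (scope*-tail zs y)))
          where
          new : ∀ i → ⦅ ys ⦆* E (toℕ i) ≈ scope* zs ρ (toℕ i)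
          new i = ≈-trans (≈-reflexive (trans (⦅⦆*-lookup ys i) (trans (lookup-ys i) (sym (e (toℕ i))))))
            (≈-sym (≈-trans (solves zs i) (≈-reflexive (trans
              (cong (λ s → ⦅ s ⦆ (scope* zs ρ)) (lookup∘tabulate (λ i → var^ ∅ (K + (d + toℕ i))) i))
              (scope*-tail zs (d + toℕ i))))))

      select-e : ∀ u w → u ≢ x₁ → open-con T c ss (shift* K bs [ u ]≔ w) x₁ ≡ bs⁺ [ K ↑ʳ u ]≔ w
      select-e u w p = trans (cong (shift* K ss ++_) ([]≔-commutes (shift* K bs) u x₁ p))
                             (sym ([]≔-++-↑ʳ (shift* K ss) cs u))

      -- The congruence of the context is a parameter: the cost-free model admits an arbitrary
      -- context with `j = 0`, the costed one a spine, through which the tick moves to the outside.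
      plug-select-≈ : ∀ j (C : LCtx) b m x alts {E} → E (K + x) ≈ ⦅ v ⦆ E →
        (∀ {s t} → (∀ {ρ} → ρ extends E by depth C → ⦅ s ⦆ ρ ≈ delay tick (⦅ t ⦆ ρ)) →
          ⦅ renameᶜ (K +_) C ⟦ s ⟧ ⦆ E ≈ delay j (⦅ renameᶜ (K +_) C ⟦ t ⟧ ⦆ E)) →
        ⦅ shift K (C ⟦ case^ b T (var^ m (depth C + x)) alts ⟧) ⦆ E ≈ delay j (⦅ select T c C alts ⦆ E)
      plug-select-≈ j C b m x alts {E} p cong-C = ≈-trans
        (≈-reflexive (cong (λ s → ⦅ s ⦆ E) (rename-plug (K +_) C _)))
        (cong-C λ e → select-≈ b m x (depth C) alts p e)

      spine-select-≈ : ∀ {C : LCtx} → Spine C → ∀ b m x alts {E} → E (K + x) ≈ ⦅ v ⦆ E →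
        ⦅ shift K (C ⟦ case^ b T (var^ m (depth C + x)) alts ⟧) ⦆ E ≈ delay tick (⦅ select T c C alts ⦆ E)
      spine-select-≈ {C} S b m x alts {E} p = plug-select-≈ tick C b m x alts p λ f →
        spine-delay tick (spine-rename (K +_) S) (f λ y → cong (λ d → E (d + y)) (spine-depth S))

  -- Erasing labels

  erase* : ∀ {n} → Vec LExp n → Vec 𝔼 n
  erase* = mapAnn* (λ _ → tt)

  erase-reannotate : ∀ f l → erase (reannotate f l) ≡ erase l
  erase-reannotate f (var^ _ _)      = refl
  erase-reannotate f (app^ _ _ _)    = refl
  erase-reannotate f (lam^ _ _)      = refl
  erase-reannotate f (letrec^ _ _ _) = refl
  erase-reannotate f (con^ _ _ _ _)  = refl
  erase-reannotate f (seq^ _ _ _)    = refl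
  erase-reannotate f (case^ _ _ _ _) = refl

  mapAnn*-[]≔ : ∀ {n} (f : A → B) (ss : Vec (Exp A) n) i {s} → mapAnn* f (ss [ i ]≔ s) ≡ mapAnn* f ss [ i ]≔ mapAnn f s
  mapAnn*-[]≔ f (_ ∷ ss) zero    = refl
  mapAnn*-[]≔ f (_ ∷ ss) (suc i) = cong (_ ∷_) (mapAnn*-[]≔ f ss i)

  lookup-mapAnn* : ∀ {n} (f : A → B) (ss : Vec (Exp A) n) i → lookup (mapAnn* f ss) i ≡ mapAnn f (lookup ss i)
  lookup-mapAnn* f (s ∷ ss) zero    = refl
  lookup-mapAnn* f (s ∷ ss) (suc i) = lookup-mapAnn* f ss i

  mapAnn*-updateAt : ∀ {n} (f : A → B) (ss : Vec (Exp A) n) i {g} → (∀ s → mapAnn f (g s) ≡ mapAnn f s) →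
    mapAnn* f (updateAt ss i g) ≡ mapAnn* f ss
  mapAnn*-updateAt f (s ∷ ss) zero    p = cong (_∷ _) (p s)
  mapAnn*-updateAt f (s ∷ ss) (suc i) p = cong (_ ∷_) (mapAnn*-updateAt f ss i p)

  []≔-cong : ∀ {n} (f : A → B) (ss : Vec (Exp A) n) i {s t} → mapAnn f s ≡ mapAnn f t →
    mapAnn* f (ss [ i ]≔ s) ≡ mapAnn* f (ss [ i ]≔ t)
  []≔-cong f ss i p = trans (mapAnn*-[]≔ f ss i) (trans (cong (mapAnn* f ss [ i ]≔_) p) (sym (mapAnn*-[]≔ f ss i)))

  []≔-same : ∀ {n} (f : A → B) (ss : Vec (Exp A) n) i {s} → mapAnn f s ≡ mapAnn f (lookup ss i) →
    mapAnn* f (ss [ i ]≔ s) ≡ mapAnn* f ss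
  []≔-same f (_ ∷ ss) zero    p = cong (_∷ _) p
  []≔-same f (_ ∷ ss) (suc i) p = cong (_ ∷_) ([]≔-same f ss i p)

  mapAnn-plug : ∀ (f : A → B) C {s t} → mapAnn f s ≡ mapAnn f t → mapAnn f (C ⟦ s ⟧) ≡ mapAnn f (C ⟦ t ⟧)
  mapAnn-plug f hole p                 = p
  mapAnn-plug f (appˡ a C t) p         = cong (λ s → app^ _ s _) (mapAnn-plug f C p)
  mapAnn-plug f (appʳ a t C) p         = cong (app^ _ _) (mapAnn-plug f C p)
  mapAnn-plug f (lamᵇ a C) p           = cong (lam^ _) (mapAnn-plug f C p)
  mapAnn-plug f (letrecⁱ a bs C) p     = cong (letrec^ _ _) (mapAnn-plug f C p)
  mapAnn-plug f (letrecᵇ a bs i C t) p = cong (λ bs → letrec^ _ bs _) ([]≔-cong f bs i (mapAnn-plug f C p))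
  mapAnn-plug f (conᵃ a T c ss i C) p  = cong (con^ _ T c) ([]≔-cong f ss i (mapAnn-plug f C p))
  mapAnn-plug f (seqˡ a C t) p         = cong (λ s → seq^ _ s _) (mapAnn-plug f C p)
  mapAnn-plug f (seqʳ a t C) p         = cong (seq^ _ _) (mapAnn-plug f C p)
  mapAnn-plug f (caseˢ a T C alts) p   = cong (λ s → case^ _ T s _) (mapAnn-plug f C p)
  mapAnn-plug f (caseᵃ a T t alts i C) p = cong (case^ _ T _) ([]≔-cong f alts i (mapAnn-plug f C p))

  erase-⇝ʳ : ∀ {l l′} → l ⇝ʳ l′ → erase l′ ≡ erase l
  erase-⇝ʳ (top-letrec {s = s} _) = cong (letrec^ _ _) (erase-reannotate _ s)
  erase-⇝ʳ (into-app {s = s} _ _) = cong (λ s → app^ _ s _) (erase-reannotate _ s)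
  erase-⇝ʳ (into-seq {s = s} _ _) = cong (λ s → seq^ _ s _) (erase-reannotate _ s)
  erase-⇝ʳ (into-case {s = s} _ _) = cong (λ s → case^ _ _ s _) (erase-reannotate _ s)
  erase-⇝ʳ (var-in {bs = bs} {x} C _) =
    cong₂ (letrec^ _) (mapAnn*-updateAt _ bs x (erase-reannotate _)) (mapAnn-plug _ C refl)
  erase-⇝ʳ (var-e {bs = bs} {x} {y} C _ _ _ eq) = cong (λ bs → letrec^ _ bs _)
    (trans (mapAnn*-updateAt _ (bs [ y ]≔ _) x (erase-reannotate _))
           ([]≔-same _ bs y (trans (mapAnn-plug _ C refl) (cong erase (sym eq)))))
  erase-⇝ʳ (var-chain {bs = bs} {x} {y} _ _ eq) = cong (λ bs → letrec^ _ bs _)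
    (trans (mapAnn*-updateAt _ (bs [ y ]≔ _) x (erase-reannotate _))
           ([]≔-same _ bs y (cong erase (sym eq))))

  erase-⇝* : ∀ {l l′} → Star _⇝_ l l′ → erase l′ ≡ erase l
  erase-⇝* ε = refl
  erase-⇝* (inside C _ r ◅ rs) = trans (erase-⇝* rs) (mapAnn-plug _ C (erase-⇝ʳ r))

  mutual
    erase-unlabelled : ∀ s → erase (unlabelled s) ≡ s
    erase-unlabelled (var x)         = refl
    erase-unlabelled (app s t)       = cong₂ app (erase-unlabelled s) (erase-unlabelled t)
    erase-unlabelled (lam s)         = cong lam (erase-unlabelled s)
    erase-unlabelled (letrec bs t)   = cong₂ letrec (erase-unlabelled* bs) (erase-unlabelled t)
    erase-unlabelled (con T c ss)    = cong (con T c) (erase-unlabelled* ss)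
    erase-unlabelled (seq s t)       = cong₂ seq (erase-unlabelled s) (erase-unlabelled t)
    erase-unlabelled (case T s alts) = cong₂ (case T) (erase-unlabelled s) (erase-unlabelled* alts)

    erase-unlabelled* : ∀ {n} (ss : Vec 𝔼 n) → erase* (mapAnn* (λ _ → ∅) ss) ≡ ss
    erase-unlabelled* []       = refl
    erase-unlabelled* (s ∷ ss) = cong₂ _∷_ (erase-unlabelled s) (erase-unlabelled* ss)

  erase-labelling : ∀ {s l} → Labelling s l → erase l ≡ s
  erase-labelling {s} (rs , _) =
    trans (erase-⇝* rs) (trans (erase-reannotate _ (unlabelled s)) (erase-unlabelled s))

  -- Reductions of `L_LR` as equations of the cost-free model

  module Expansion where
    open Sharing 0

    -- At cost 0 an equation at the redex extends through every context by `ctx-≈`, whereas a tick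
    -- would travel only along evaluation positions. (cp-e), (seq-e) and (case-e) go through
    -- `replace-≋`, since their redex depends on a sibling binding.
    ▷-≈ : ∀ {l l′} → l ▷ l′ → ∀ {ρ} → ⦅ l ⦆ ρ ≈ ⦅ l′ ⦆ ρ
    ▷-≈ (lbeta {a} {ℓ} {s} {t} C _) = ctx-≈ C λ _ → lbeta-≈ a ℓ ∅ s t
    ▷-≈ (cp-in {a = a} {m = m} C eq _ ch _) = cp-in-≈ {a = a} {a} {m} C eq ch
    ▷-≈ (cp-e {a = a} {t = t} C eq _ ch _ y∉ eq′) = cp-e-≈ {a = a} {a} {t = t} C eq ch y∉ eq′
    ▷-≈ (lapp {a = a} {ℓ} {s} {t} {bs} C _) = ctx-≈ C λ _ → lapp-≈ {a = a} {ℓ} bs s t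
    ▷-≈ (lcase {a = a} {ℓ} {s = s} {alts} {bs} C _) = ctx-≈ C λ _ → lcase-≈ {a = a} {ℓ} bs s alts
    ▷-≈ (lseq {a = a} {ℓ} {s} {t} {bs} C _) = ctx-≈ C λ _ → lseq-≈ {a = a} {ℓ} bs s t
    ▷-≈ (llet-in {s = s} {bs₁} {bs₂} _) = ⦅⦆-cong s (llet-in-≋ bs₂ bs₁)
    ▷-≈ (llet-e {k₂ = k₂} {t = t} {bs₁} {bs₂} {x} eq _) {ρ} = ≈-trans
      (≈-sym (shift-≈ (suc k₂) t (scope*-tail bs₂)))
      (⦅⦆-cong (shift (suc k₂) t) (llet-e-≋ bs₂ bs₁ x eq))
    ▷-≈ (seq-c {a} {s = s} C v _) = ctx-≈ C λ _ → seq-≈ a s v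
    ▷-≈ (seq-in {b = b} {ℓ} {m} {T} {c} {ss} {s} {bs = bs} {x₁ = x₁} C eq _ ch _) {ρ} = ctx-≈ C λ e →
      seq-var-≈ b {m} {v = con^ ℓ T c ss} {s} {scope* bs ρ} application (≈-trans (≈-reflexive (e _))
        (≈-trans (chain-≈ {E = scope* bs ρ} ch (λ {i} _ → solves bs i)) (≈-reflexive (cong (λ s → ⦅ s ⦆ (scope* bs ρ)) eq))))
    ▷-≈ (seq-e {b = b} {ℓ} {m} {T} {c} {ss} {s} {t} {bs = bs} {x₁ = x₁} {y = y} C eq _ ch _ y∉ eq′) = ⦅⦆-cong t
      (replace-≋ bs y _ λ E p → ≈-trans (≈-reflexive (cong (λ s → ⦅ s ⦆ E) eq′)) (ctx-≈ C λ e →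
        seq-var-≈ b {m} {v = con^ ℓ T c ss} {s} {E} application (≈-trans (≈-reflexive (e _))
          (≈-trans (chain-except {E = E} ch y∉ p) (≈-reflexive (cong (λ s → ⦅ s ⦆ E) eq))))))
    ▷-≈ (case-c {a} {ℓ} {T} {c} {ss} {alts} C _) = ctx-≈ C λ _ → case-c-≈ a ℓ T c ss alts
    ▷-≈ (case-in {a = a} {b} {m = m} {T} {c} {ss} {alts} {bs = bs} {xₘ = xₘ} C eq _ ch _) {ρ} =
      ≈-trans (open-con-shift ρ (C ⟦ case^ b T (var^ m (depth C + toℕ xₘ)) alts ⟧)) (≈-trans
        (plug-select-≈ 0 C b m (toℕ xₘ) alts {E⁺} (chain-open-con {E = E⁺} ch λ {i} _ → solves bs⁺ (K ↑ʳ i))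
          (λ {s} {t} f → ctx-≈ (renameᶜ (K +_) C) {s} {t} λ {ρ′} e → f λ x →
            trans (cong (λ d → ρ′ (d + x)) (sym (depth-rename (K +_) C))) (e x)))
        (≈-reflexive (sym (letrec*-≡ a bs⁺ (select T c C alts)))))
      where
      open OpenCon bs eq
      E⁺ = scope* bs⁺ ρ
    ▷-≈ (case-e {a = a} {b} {m = m} {T} {c} {ss} {alts} {r} {bs = bs} {x₁} {xₘ} {u} C eq _ ch _ u∉ eq′) {ρ} =
      ≈-trans (open-con-shift ρ r) (≈-trans
        (⦅⦆-cong (shift K r) (replace-≋ bs⁺ (K ↑ʳ u) (select T c C alts) λ E p → ≈-trans
          (≈-reflexive (cong (λ s → ⦅ s ⦆ E) (trans (lookup-old u≢x₁) (cong (shift K) eq′))))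
          (plug-select-≈ 0 C b m (toℕ xₘ) alts {E} (chain-open-con {E = E} ch λ {i} i∈ → p (K ↑ʳ i)
              λ q → u∉ (≡-subst (_∈ _) (↑ʳ-injective K i u q) i∈))
            (λ {s} {t} f → ctx-≈ (renameᶜ (K +_) C) {s} {t} λ {ρ′} e → f λ x →
              trans (cong (λ d → ρ′ (d + x)) (sym (depth-rename (K +_) C))) (e x)))))
        (≈-reflexive (trans (cong (λ bs → ⦅ shift K r ⦆ (scope* bs ρ)) (sym (select-e u _ u≢x₁)))
          (sym (letrec*-≡ a (open-con T c ss (shift* K bs [ u ]≔ select T c C alts) x₁) (shift K r))))))
      where
      open OpenCon bs eq
      x₁∈ : ∀ {xₘ xs} → Chain bs x₁ xₘ xs → x₁ ∈ xs
      x₁∈ start       = here refl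
      x₁∈ (next ch _) = there (x₁∈ ch)
      u≢x₁ : u ≢ x₁
      u≢x₁ refl = u∉ (x₁∈ ch)

    ⟶ᴸᴿ-≈ : ∀ {s t} → s ⟶ᴸᴿ t → ∀ {ρ} → ⦅ s ⦆ ρ ≈ ⦅ t ⦆ ρ
    ⟶ᴸᴿ-≈ (l , l′ , lab , r , refl) {ρ} = ≈-trans (≈-reflexive (cong (λ s → ⦅ s ⦆ ρ) (sym (erase-labelling lab))))
      (≈-trans (erase-≈ l) (≈-trans (▷-≈ r) (≈-sym (erase-≈ l′))))

    answer-inhabited : ∀ {s ρ} → Answerᴸᴿ s → Inhabited (⦅ s ⦆ ρ)
    answer-inhabited (value v)        = let σ , p = value-inhabited v in σ , 0 , p
    answer-inhabited (letrec-value v) = let σ , p = value-inhabited v in σ , 0 , p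
    answer-inhabited {ρ = ρ} (letrec-con {bs = bs} {T} {c} {ss} eq ch) = let σ , p = value-inhabited (application {ss = ss}) in
      σ , 0 , to (bwd (≈-trans (chain-≈ {E = scope* bs ρ} ch (λ {i} _ → solves bs i))
                               (≈-reflexive (cong (λ s → ⦅ s ⦆ (scope* bs ρ)) eq)))) p

  LR-expansion : ∀ {s} → s ↓ᴸᴿ → Inhabited (Semantics.⦅_⦆ 0 0 s ∅ᴱ)
  LR-expansion (v , rs , a) = go rs a
    where
    open Expansion
    open Semantics 0 0
    go : ∀ {s v} → Star _⟶ᴸᴿ_ s v → Answerᴸᴿ v → Inhabited (⦅ s ⦆ ∅ᴱ)
    go ε a = answer-inhabited a
    go (r ◅ rs) a with τ , n , p ← go rs a = τ , n , to (bwd (⟶ᴸᴿ-≈ r)) p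

  name↓⇐LR↓ : ∀ {s} → s ↓ᴸᴿ → s ↓ⁿ
  name↓⇐LR↓ {s} p with τ , n , q ← LR-expansion p =
    name-adequate (computable-inhabited τ (Transfer.fundamental 1 1 s (λ _ ()) q))

  -- Labelling

  mutual
    Everywhere : (LExp → Set) → LExp → Set
    Everywhere Q l = Q l × Below Q l

    Below : (LExp → Set) → LExp → Set
    Below Q (var^ _ _)         = ⊤
    Below Q (app^ _ s t)       = Everywhere Q s × Everywhere Q t
    Below Q (lam^ _ s)         = Everywhere Q s
    Below Q (letrec^ _ bs t)   = Everywhere* Q bs × Everywhere Q t
    Below Q (con^ _ T c ss)    = Everywhere* Q ss
    Below Q (seq^ _ s t)       = Everywhere Q s × Everywhere Q t
    Below Q (case^ _ T s alts) = Everywhere Q s × Everywhere* Q alts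

    Everywhere* : ∀ {n} → (LExp → Set) → Vec LExp n → Set
    Everywhere* Q []       = ⊤
    Everywhere* Q (s ∷ ss) = Everywhere Q s × Everywhere* Q ss

  everywhere*-lookup : ∀ {Q n} (ss : Vec LExp n) i → Everywhere* Q ss → Everywhere Q (lookup ss i)
  everywhere*-lookup (s ∷ ss) zero    (p , _) = p
  everywhere*-lookup (s ∷ ss) (suc i) (_ , p) = everywhere*-lookup ss i p

  everywhere*-tabulate : ∀ {Q n} (ss : Vec LExp n) → (∀ i → Everywhere Q (lookup ss i)) → Everywhere* Q ss
  everywhere*-tabulate []       p = tt
  everywhere*-tabulate (s ∷ ss) p = p zero , everywhere*-tabulate ss (λ i → p (suc i))

  everywhere*-[]≔ : ∀ {Q n} (ss : Vec LExp n) i {s} → Everywhere* Q (ss [ i ]≔ s) → Everywhere Q s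
  everywhere*-[]≔ (_ ∷ ss) zero    (p , _) = p
  everywhere*-[]≔ (_ ∷ ss) (suc i) (_ , p) = everywhere*-[]≔ ss i p

  everywhere-plug : ∀ {Q} (C : LCtx) {s} → Everywhere Q (C ⟦ s ⟧) → Everywhere Q s
  everywhere-plug hole p                           = p
  everywhere-plug (appˡ a C t) (_ , p , _)         = everywhere-plug C p
  everywhere-plug (appʳ a t C) (_ , _ , p)         = everywhere-plug C p
  everywhere-plug (lamᵇ a C) (_ , p)               = everywhere-plug C p
  everywhere-plug (letrecⁱ a bs C) (_ , _ , p)     = everywhere-plug C p
  everywhere-plug (letrecᵇ a bs i C t) (_ , p , _) = everywhere-plug C (everywhere*-[]≔ bs i p)
  everywhere-plug (conᵃ a T c ss i C) (_ , p)      = everywhere-plug C (everywhere*-[]≔ ss i p)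
  everywhere-plug (seqˡ a C t) (_ , p , _)         = everywhere-plug C p
  everywhere-plug (seqʳ a t C) (_ , _ , p)         = everywhere-plug C p
  everywhere-plug (caseˢ a T C alts) (_ , p , _)   = everywhere-plug C p
  everywhere-plug (caseᵃ a T t alts i C) (_ , _ , p) = everywhere-plug C (everywhere*-[]≔ alts i p)

  mutual
    everywhere-map : ∀ {Q R : LExp → Set} → (∀ l → Q l → R l) → ∀ l → Everywhere Q l → Everywhere R l
    everywhere-map f l (p , q) = f l p , below-map f l q

    below-map : ∀ {Q R : LExp → Set} → (∀ l → Q l → R l) → ∀ l → Below Q l → Below R l
    below-map f (var^ _ _) p             = tt
    below-map f (app^ _ s t) (p , q)     = everywhere-map f s p , everywhere-map f t q
    below-map f (lam^ _ s) p             = everywhere-map f s p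
    below-map f (letrec^ _ bs t) (p , q) = everywhere*-map f bs p , everywhere-map f t q
    below-map f (con^ _ T c ss) p        = everywhere*-map f ss p
    below-map f (seq^ _ s t) (p , q)     = everywhere-map f s p , everywhere-map f t q
    below-map f (case^ _ T s alts) (p , q) = everywhere-map f s p , everywhere*-map f alts q

    everywhere*-map : ∀ {Q R : LExp → Set} {n} → (∀ l → Q l → R l) → ∀ (ls : Vec LExp n) → Everywhere* Q ls → Everywhere* R ls
    everywhere*-map f []       p       = tt
    everywhere*-map f (l ∷ ls) (p , q) = everywhere-map f l p , everywhere*-map f ls q

  unlabelled* : ∀ {n} → Vec 𝔼 n → Vec LExp n
  unlabelled* = mapAnn* (λ _ → ∅)

  module _ {Q : LExp → Set} (plain : ∀ l → annotation l ≡ ∅ → Q l) where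
    mutual
      everywhere-unlabelled : ∀ s → Everywhere Q (unlabelled s)
      everywhere-unlabelled s = plain (unlabelled s) (annotation-unlabelled s) , below-unlabelled s

      below-unlabelled : ∀ s → Below Q (unlabelled s)
      below-unlabelled (var x)         = tt
      below-unlabelled (app s t)       = everywhere-unlabelled s , everywhere-unlabelled t
      below-unlabelled (lam s)         = everywhere-unlabelled s
      below-unlabelled (letrec bs t)   = everywhere-unlabelled* bs , everywhere-unlabelled t
      below-unlabelled (con T c ss)    = everywhere-unlabelled* ss
      below-unlabelled (seq s t)       = everywhere-unlabelled s , everywhere-unlabelled t
      below-unlabelled (case T s alts) = everywhere-unlabelled s , everywhere-unlabelled* alts

      everywhere-unlabelled* : ∀ {n} (ss : Vec 𝔼 n) → Everywhere* Q (unlabelled* ss)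
      everywhere-unlabelled* []       = tt
      everywhere-unlabelled* (s ∷ ss) = everywhere-unlabelled s , everywhere-unlabelled* ss

      annotation-unlabelled : ∀ s → annotation (unlabelled s) ≡ ∅
      annotation-unlabelled (var x)         = refl
      annotation-unlabelled (app s t)       = refl
      annotation-unlabelled (lam s)         = refl
      annotation-unlabelled (letrec bs t)   = refl
      annotation-unlabelled (con T c ss)    = refl
      annotation-unlabelled (seq s t)       = refl
      annotation-unlabelled (case T s alts) = refl

  -- Failure is triggered only by a variable labelled `𝐒`, a labelling step by `𝐒` or `𝐓` at a few
  -- constructs. Holding everywhere, `NoActiveVar` excludes failure and `Settled` excludes further
  -- steps as well.
  NoActiveVar Settled : LExp → Set
  NoActiveVar (var^ ℓ _) = 𝐒 ∉ˢ ℓ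
  NoActiveVar _          = ⊤

  Settled (var^ ℓ _)      = 𝐒 ∉ˢ ℓ
  Settled (app^ ℓ _ _)    = 𝐒 ∉ˢ ℓ × 𝐓 ∉ˢ ℓ
  Settled (lam^ _ _)      = ⊤
  Settled (letrec^ ℓ _ _) = 𝐓 ∉ˢ ℓ
  Settled (con^ _ _ _ _)  = ⊤
  Settled (seq^ ℓ _ _)    = 𝐒 ∉ˢ ℓ × 𝐓 ∉ˢ ℓ
  Settled (case^ ℓ _ _ _) = 𝐒 ∉ˢ ℓ × 𝐓 ∉ˢ ℓ

  settled⇒noActiveVar : ∀ l → Settled l → NoActiveVar l
  settled⇒noActiveVar (var^ _ _)      p = p
  settled⇒noActiveVar (app^ _ _ _)    p = tt
  settled⇒noActiveVar (lam^ _ _)      p = tt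
  settled⇒noActiveVar (letrec^ _ _ _) p = tt
  settled⇒noActiveVar (con^ _ _ _ _)  p = tt
  settled⇒noActiveVar (seq^ _ _ _)    p = tt
  settled⇒noActiveVar (case^ _ _ _ _) p = tt

  settled-plain : ∀ l → annotation l ≡ ∅ → Settled l
  settled-plain (var^ _ _)      refl = ∉⊥
  settled-plain (app^ _ _ _)    refl = ∉⊥ , ∉⊥
  settled-plain (lam^ _ _)      refl = tt
  settled-plain (letrec^ _ _ _) refl = ∉⊥
  settled-plain (con^ _ _ _ _)  refl = tt
  settled-plain (seq^ _ _ _)    refl = ∉⊥ , ∉⊥
  settled-plain (case^ _ _ _ _) refl = ∉⊥ , ∉⊥

  calm : ∀ {l} → Everywhere Settled l → Everywhere NoActiveVar l
  calm = everywhere-map settled⇒noActiveVar _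

  settled : ∀ s → Everywhere Settled (unlabelled s)
  settled = everywhere-unlabelled settled-plain

  settled* : ∀ {n} (ss : Vec 𝔼 n) → Everywhere* Settled (unlabelled* ss)
  settled* = everywhere-unlabelled* settled-plain

  plugged-calm : ∀ {C : LCtx} {l ℓ x} → Everywhere NoActiveVar l → l ≡ C ⟦ var^ ℓ x ⟧ → 𝐒 ∉ˢ ℓ
  plugged-calm {C} p refl = proj₁ (everywhere-plug C p)

  no-Failʳ : ∀ {l} → Everywhere NoActiveVar l → ¬ Failʳ l
  no-Failʳ (_ , p , _) (fail-visited {bs = bs} {y = y} C _ _ S∈ eq) =
    plugged-calm {C} (everywhere*-lookup bs y p) eq S∈
  no-Failʳ (_ , p , _) (fail-self {bs = bs} {x} C S∈ eq) =
    plugged-calm {C} (everywhere*-lookup bs x p) eq S∈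

  no-Fail : ∀ {l} → Everywhere NoActiveVar l → ¬ Fail l
  no-Fail p (inside C f) = no-Failʳ (everywhere-plug C p) f

  settled-normalʳ : ∀ {l l′} → Everywhere Settled l → ¬ (l ⇝ʳ l′)
  settled-normalʳ (p , _) (top-letrec T∈)      = p T∈
  settled-normalʳ (p , _) (into-app isS S∈)    = proj₁ p S∈
  settled-normalʳ (p , _) (into-app isT T∈)    = proj₂ p T∈
  settled-normalʳ (p , _) (into-seq isS S∈)    = proj₁ p S∈
  settled-normalʳ (p , _) (into-seq isT T∈)    = proj₂ p T∈
  settled-normalʳ (p , _) (into-case isS S∈)   = proj₁ p S∈
  settled-normalʳ (p , _) (into-case isT T∈)   = proj₂ p T∈
  settled-normalʳ (_ , _ , p) (var-in C S∈)    = plugged-calm {C} (calm p) refl S∈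
  settled-normalʳ (_ , p , _) (var-e {bs = bs} {y = y} C _ _ S∈ eq) =
    plugged-calm {C} (calm (everywhere*-lookup bs y p)) eq S∈
  settled-normalʳ (_ , p , _) (var-chain {bs = bs} {y = y} _ S∈ eq) =
    plugged-calm {hole} (calm (everywhere*-lookup bs y p)) eq S∈

  settled-normal : ∀ {l} → Everywhere Settled l → ∀ l′ → ¬ (l ⇝ l′)
  settled-normal p _ (inside C _ r) = settled-normalʳ (everywhere-plug C p) r

  visited : Labels
  visited = ⁅ 𝐕 ⁆

  spineᴸ : AppCtx → LCtx
  spineᴸ holeᴬ            = hole
  spineᴸ (appᴬ A t)       = appˡ visited (spineᴸ A) (unlabelled t)
  spineᴸ (caseᴬ T A alts) = caseˢ visited T (spineᴸ A) (unlabelled* alts)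
  spineᴸ (seqᴬ A t)       = seqˡ visited (spineᴸ A) (unlabelled t)

  spineᴸ-spine : ∀ A → Spine (spineᴸ A)
  spineᴸ-spine holeᴬ            = hole
  spineᴸ-spine (appᴬ A t)       = appˡ (spineᴸ-spine A)
  spineᴸ-spine (caseᴬ T A alts) = caseˢ (spineᴸ-spine A)
  spineᴸ-spine (seqᴬ A t)       = seqˡ (spineᴸ-spine A)

  depth-spineᴸ : ∀ A → depth (spineᴸ A) ≡ 0
  depth-spineᴸ A = spine-depth (spineᴸ-spine A)

  frameᴸ : Frame → LExp → LExp
  frameᴸ (appᶠ t) l       = app^ visited l (unlabelled t)
  frameᴸ (caseᶠ T alts) l = case^ visited T l (unlabelled* alts)
  frameᴸ (seqᶠ t) l       = seq^ visited l (unlabelled t)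

  ▹-spineᴸ : ∀ A f {l} → spineᴸ (A ▹ f) ⟦ l ⟧ ≡ spineᴸ A ⟦ frameᴸ f l ⟧
  ▹-spineᴸ holeᴬ (appᶠ t)       = refl
  ▹-spineᴸ holeᴬ (caseᶠ T alts) = refl
  ▹-spineᴸ holeᴬ (seqᶠ t)       = refl
  ▹-spineᴸ (appᴬ A t) f         = cong (λ s → app^ _ s _) (▹-spineᴸ A f)
  ▹-spineᴸ (caseᴬ T A alts) f   = cong (λ s → case^ _ T s _) (▹-spineᴸ A f)
  ▹-spineᴸ (seqᴬ A t) f         = cong (λ s → seq^ _ s _) (▹-spineᴸ A f)

  V-settled : 𝐒 ∉ˢ visited × 𝐓 ∉ˢ visited
  V-settled = (λ ()) , (λ { (there ()) })

  settled-spine : ∀ A {l} → Everywhere Settled l → Everywhere Settled (spineᴸ A ⟦ l ⟧)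
  settled-spine holeᴬ            p = p
  settled-spine (appᴬ A t)       p = V-settled , settled-spine A p , settled t
  settled-spine (caseᴬ T A alts) p = V-settled , settled-spine A p , settled* alts
  settled-spine (seqᴬ A t)       p = V-settled , settled-spine A p , settled t

  active : 𝔼 → LExp
  active s = mark 𝐒 (unlabelled s)

  infix 4 _⇝ᶜ_
  -- A labelling step requires that the whole expression does not fail, which cannot be checked on a
  -- part. Absence of active variables can, so these steps pass to surrounding contexts. The
  -- condition is on the source only: the last step may well put `𝐒` on a variable.
  data _⇝ᶜ_ : LExp → LExp → Set where
    calmly : ∀ C {s t} → Everywhere NoActiveVar (C ⟦ s ⟧) → s ⇝ʳ t → C ⟦ s ⟧ ⇝ᶜ C ⟦ t ⟧

  ⇝ᶜ⇒⇝ : ∀ {l l′} → l ⇝ᶜ l′ → l ⇝ l′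
  ⇝ᶜ⇒⇝ (calmly C p r) = inside C (no-Fail p) r

  app-⇝ᶜ : ∀ {ℓ t l l′} → Everywhere NoActiveVar t → l ⇝ᶜ l′ → app^ ℓ l t ⇝ᶜ app^ ℓ l′ t
  app-⇝ᶜ q (calmly C p r) = calmly (appˡ _ C _) (tt , p , q) r

  seq-⇝ᶜ : ∀ {ℓ t l l′} → Everywhere NoActiveVar t → l ⇝ᶜ l′ → seq^ ℓ l t ⇝ᶜ seq^ ℓ l′ t
  seq-⇝ᶜ q (calmly C p r) = calmly (seqˡ _ C _) (tt , p , q) r

  case-⇝ᶜ : ∀ {ℓ T alts l l′} → Everywhere* NoActiveVar alts → l ⇝ᶜ l′ → case^ ℓ T l alts ⇝ᶜ case^ ℓ T l′ alts
  case-⇝ᶜ q (calmly C p r) = calmly (caseˢ _ _ C _) (tt , p , q) r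

  letrecⁱ-⇝ᶜ : ∀ {k ℓ l l′} {bs : Vec LExp (suc k)} → Everywhere* NoActiveVar bs → l ⇝ᶜ l′ → letrec^ ℓ bs l ⇝ᶜ letrec^ ℓ bs l′
  letrecⁱ-⇝ᶜ q (calmly C p r) = calmly (letrecⁱ _ _ C) (tt , q , p) r

  everywhere*-replace : ∀ {Q n} (ss : Vec LExp n) i {s} → (∀ j → j ≢ i → Everywhere Q (lookup ss j)) → Everywhere Q s →
    Everywhere* Q (ss [ i ]≔ s)
  everywhere*-replace {Q} ss i {s} p q = everywhere*-tabulate _ λ j → at j (j ≟ᶠ i)
    where
    at : ∀ j → Dec (j ≡ i) → Everywhere Q (lookup (ss [ i ]≔ s) j)
    at j (yes refl) = ≡-subst (Everywhere Q) (sym (lookup∘update j ss s)) q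
    at j (no j≢i)   = ≡-subst (Everywhere Q) (sym (lookup∘update′ j≢i ss s)) (p j j≢i)

  letrecᵇ-⇝ᶜ : ∀ {k ℓ t l l′} (bs : Vec LExp (suc k)) y → (∀ z → z ≢ y → Everywhere NoActiveVar (lookup bs z)) →
    Everywhere NoActiveVar t → l ⇝ᶜ l′ → letrec^ ℓ (bs [ y ]≔ l) t ⇝ᶜ letrec^ ℓ (bs [ y ]≔ l′) t
  letrecᵇ-⇝ᶜ bs y q q′ (calmly C p r) =
    calmly (letrecᵇ _ bs y C _) (tt , everywhere*-replace bs y q p , q′) r

  calm-alts : ∀ {n} (ss : Vec 𝔼 n) → Everywhere* NoActiveVar (unlabelled* ss)
  calm-alts ss = everywhere*-map settled⇒noActiveVar _ (settled* ss)

  mutual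
    descend : ∀ A s → Star _⇝ᶜ_ (active (A ⟦ s ⟧ᴬ)) (spineᴸ A ⟦ active s ⟧)
    descend holeᴬ s      = ε
    descend A@(appᴬ _ _)    s = enter isS A s (λ ())
    descend A@(caseᴬ _ _ _) s = enter isS A s (λ ())
    descend A@(seqᴬ _ _)    s = enter isS A s (λ ())

    -- A `𝐓` at the root and an inner `𝐒` differ in the first step only. The context has to be
    -- nonempty, since it is a step that puts `𝐒` on the subexpression.
    enter : ∀ {a} → S∨T a → ∀ A s → A ≢ holeᴬ → Star _⇝ᶜ_ (mark a (unlabelled (A ⟦ s ⟧ᴬ))) (spineᴸ A ⟦ active s ⟧)
    enter _ holeᴬ s ¬hole = ⊥-elim (¬hole refl)
    enter isS (appᴬ A t) s _ = calmly hole (tt , calm (settled (A ⟦ s ⟧ᴬ)) , calm (settled t)) (into-app isS here)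
      ◅ gmap (λ l → app^ _ l _) (app-⇝ᶜ (calm (settled t))) (descend A s)
    enter isT (appᴬ A t) s _ = calmly hole (tt , calm (settled (A ⟦ s ⟧ᴬ)) , calm (settled t)) (into-app isT (there here))
      ◅ gmap (λ l → app^ _ l _) (app-⇝ᶜ (calm (settled t))) (descend A s)
    enter isS (seqᴬ A t) s _ = calmly hole (tt , calm (settled (A ⟦ s ⟧ᴬ)) , calm (settled t)) (into-seq isS here)
      ◅ gmap (λ l → seq^ _ l _) (seq-⇝ᶜ (calm (settled t))) (descend A s)
    enter isT (seqᴬ A t) s _ = calmly hole (tt , calm (settled (A ⟦ s ⟧ᴬ)) , calm (settled t)) (into-seq isT (there here))
      ◅ gmap (λ l → seq^ _ l _) (seq-⇝ᶜ (calm (settled t))) (descend A s)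
    enter isS (caseᴬ T A alts) s _ = calmly hole (tt , calm (settled (A ⟦ s ⟧ᴬ)) , calm-alts alts) (into-case isS here)
      ◅ gmap (λ l → case^ _ T l _) (case-⇝ᶜ (calm-alts alts)) (descend A s)
    enter isT (caseᴬ T A alts) s _ = calmly hole (tt , calm (settled (A ⟦ s ⟧ᴬ)) , calm-alts alts) (into-case isT (there here))
      ◅ gmap (λ l → case^ _ T l _) (case-⇝ᶜ (calm-alts alts)) (descend A s)

  -- Bindings needed by evaluation

  -- Turns a predicate on variables into an environment, so that Park induction can prove it of
  -- every variable that has an observation.
  restrict : D → Set → D
  has (restrict d P) τ n = has d τ n × P
  up (restrict d P) l (p , q) = up d l p , q

  -- Evaluating `y` asks for `z` at once: this is the relation along which labelling moves from
  -- binding to binding.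
  _◁[_]_ : ∀ {n} → Fin n → Vec 𝔼 n → Fin n → Set
  z ◁[ bs ] y = ∃ λ A → lookup bs y ≡ A ⟦ var (toℕ z) ⟧ᴬ

  module Need where
    open Sharing 1
    open Name 1 0 using (inhabited-A; inhabited-frame)

    inhabited-⊆ : ∀ {d e} → d ⊆ e → Inhabited d → Inhabited e
    inhabited-⊆ p (τ , n , q) = τ , n , to p q

    -- Park induction, on the part of the environment that satisfies the claim.
    needs-accessible : ∀ {n} (bs : Vec 𝔼 n) {ρ} y → Inhabited (scope* bs ρ (toℕ y)) → Acc (_◁[ bs ]_) y
    needs-accessible {n} bs {ρ} y (τ , m , p) = proj₂ (to (least (toℕ y)) p) y refl
      where
      E : Env
      E = scope* bs ρ
      P : ℕ → Set
      P x = ∀ i → toℕ i ≡ x → Acc (_◁[ bs ]_) i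
      E′ : Env
      E′ x = restrict (E x) (P x)
      E′⊑E : E′ ⊑ E
      E′⊑E x = incl proj₁
      least : E ⊑ E′
      least = scope*-least bs E′
        (λ i → incl λ p → to (bwd (solves bs i)) (to (mono (continuous (lookup bs i)) E′⊑E) p)
                        , λ j q → ≡-subst (Acc _) (toℕ-injective (sym q)) (acc λ (A , eq) →
                            proj₂ (proj₂ (proj₂ (inhabited-A A (≡-subst (λ s → Inhabited (⦅ s ⦆ E′)) eq (_ , _ , p))))) _ refl))
        (λ x → incl λ p → to (⊆-reflexive (sym (scope*-tail bs x))) p
                        , λ i q → ⊥-elim (<⇒≢ (≤-trans (toℕ<n i) (m≤m+n n x)) q))

    -- Quantitative strictness: evaluating `s` pays for `x` at least once, so a unit saved on `x` is
    -- saved on `s`, provided that nothing else becomes dearer.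
    Strict : Exp A → ℕ → Set₁
    Strict s x = ∀ {ρ ρ′} → ρ ⊑ ρ′ → ρ x ⊆ later (ρ′ x) → ⦅ s ⦆ ρ ⊆ later (⦅ s ⦆ ρ′)

    strict-erase : ∀ {l s x} → erase l ≡ s → Strict s x → Strict l x
    strict-erase {l} refl p q r = ⊆-trans (bwd (mapAnn-≈ _ l λ _ → ≈-refl))
      (⊆-trans (p q r) (later-mono (fwd (mapAnn-≈ _ l λ _ → ≈-refl))))

    strict-A : ∀ A x → Strict (A ⟦ var x ⟧ᴬ) x
    strict-A holeᴬ x p q = q
    strict-A (appᴬ A t) x p q = later-mono (⊆-trans
      (Apply-mono (strict-A A x p q) (mono (continuous t) p)) (fwd (Apply-delay 1)))
    strict-A (caseᴬ T A alts) x p q = later-mono (⊆-trans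
      (Case-mono (strict-A A x p q) (λ c δ → mono (continuousᵃ alts (ar T) c) p)) (fwd (Case-delay 1)))
    strict-A (seqᴬ A t) x p q = later-mono (⊆-trans
      (Seq-mono (strict-A A x p q) (mono (continuous t) p)) (fwd (Seq-delay 1)))

    -- `E` satisfies the bindings as inequations, with one unit to spare at `y`; strictness hands
    -- this unit on to the variables in `On`. Both conclusions are built into `E′` and proved by a
    -- single Park induction.
    strict-least : ∀ {n} (bs : Vec (Exp A) n) {ρ} (E : Env) y →
      (∀ i → i ≢ y → ⦅ lookup bs i ⦆ E ⊆ E (toℕ i)) → ⦅ lookup bs y ⦆ E ⊆ later (E (toℕ y)) →
      (∀ x → ρ x ⊆ E (n + x)) →
      (On : Fin n → Set) → (∀ {i} → On i → i ≡ y ⊎ ∃ λ z → Strict (lookup bs i) (toℕ z) × On z) →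
      scope* bs ρ ⊑ E × (∀ {i} → On i → scope* bs ρ (toℕ i) ⊆ later (E (toℕ i)))
    strict-least {n = n} bs {ρ} E y p q r On next-on = (λ x → ⊆-trans (least x) (E′⊑E x)) , λ o → incl λ h →
      proj₂ (to (least _) h) _ refl o
      where
      E′ : Env
      has (E′ x) τ m = has (E x) τ m × (∀ i → toℕ i ≡ x → On i → has (later (E x)) τ m)
      up (E′ x) l (h , f) = up (E x) l h , λ i e s → up (later (E x)) l (f i e s)
      E′⊑E : E′ ⊑ E
      E′⊑E x = incl proj₁
      weak : ∀ i → ⦅ lookup bs i ⦆ E ⊆ E (toℕ i)
      weak i with i ≟ᶠ y
      ... | yes refl = ⊆-trans q later-⊆
      ... | no i≢y   = p i i≢y
      strong : ∀ i → On i → ⦅ lookup bs i ⦆ E′ ⊆ later (E (toℕ i))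
      strong i o with next-on o
      ... | inj₁ refl         = ⊆-trans (mono (continuous (lookup bs i)) E′⊑E) q
      ... | inj₂ (z , s , o′) = ⊆-trans (s E′⊑E (incl λ h → proj₂ h _ refl o′)) (later-mono (weak i))
      least : scope* bs ρ ⊑ E′
      least = scope*-least bs E′
        (λ i → incl λ {τ} {m} h → to (weak i) (to (mono (continuous (lookup bs i)) E′⊑E) h)
                        , λ j e s → ≡-subst (λ x → has (later (E x)) τ m) e
                            (to (strong j s) (≡-subst (λ j → has (⦅ lookup bs j ⦆ E′) τ m) (toℕ-injective (sym e)) h)))
        (λ x → incl λ h → to (r x) h , λ i e → ⊥-elim (<⇒≢ (≤-trans (toℕ<n i) (m≤m+n n x)) e))

  -- Labelling does not fail at a single active variable

  app-injective : ∀ {a b} {s s′ t t′ : LExp} → app^ a s t ≡ app^ b s′ t′ → s ≡ s′ × t ≡ t′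
  app-injective refl = refl , refl

  seq-injective : ∀ {a b} {s s′ t t′ : LExp} → seq^ a s t ≡ seq^ b s′ t′ → s ≡ s′ × t ≡ t′
  seq-injective refl = refl , refl

  case-injective : ∀ {a b T} {s s′ : LExp} {alts alts′} → case^ a T s alts ≡ case^ b T s′ alts′ → s ≡ s′ × alts ≡ alts′
  case-injective refl = refl , refl

  case-type : ∀ {a b T T′} {s s′ : LExp} {alts alts′} → case^ a T s alts ≡ case^ b T′ s′ alts′ → T ≡ T′
  case-type refl = refl

  -- All side branches of the spine are unlabelled, so an active variable can only be the one at its
  -- hole, below no binder.
  spine-var : ∀ A (C : LCtx) {ℓ₀ ℓ z w} → 𝐒 ∈ˢ ℓ → spineᴸ A ⟦ var^ ℓ₀ z ⟧ ≡ C ⟦ var^ ℓ w ⟧ → depth C ≡ 0 × z ≡ w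
  spine-var holeᴬ hole S∈ refl = refl , refl
  spine-var (appᴬ A t) (appˡ a C t′) S∈ eq = spine-var A C S∈ (proj₁ (app-injective eq))
  spine-var (appᴬ A t) (appʳ a t′ C) S∈ eq =
    ⊥-elim (plugged-calm {C} (calm (settled t)) (proj₂ (app-injective eq)) S∈)
  spine-var (seqᴬ A t) (seqˡ a C t′) S∈ eq = spine-var A C S∈ (proj₁ (seq-injective eq))
  spine-var (seqᴬ A t) (seqʳ a t′ C) S∈ eq =
    ⊥-elim (plugged-calm {C} (calm (settled t)) (proj₂ (seq-injective eq)) S∈)
  spine-var (caseᴬ T A alts) (caseˢ a T′ C alts′) S∈ eq with refl ← case-type eq =
    spine-var A C S∈ (proj₁ (case-injective eq))
  spine-var (caseᴬ T A alts) (caseᵃ a T′ t alts′ i C) S∈ eq with refl ← case-type eq =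
    ⊥-elim (proj₁ (everywhere-plug C (everywhere*-[]≔ alts′ i
      (≡-subst (Everywhere* NoActiveVar) (proj₂ (case-injective eq)) (calm-alts alts)))) S∈)

  fail-position : ∀ {l} → Fail l → ∃₂ λ C r → Failʳ r × C ⟦ r ⟧ ≡ l
  fail-position (inside C f) = C , _ , f , refl

  fail-app : ∀ {a s t} → Everywhere NoActiveVar t → Fail (app^ a s t) → Fail s
  fail-app q f with C , r , f , eq ← fail-position f = go C f eq q
    where
    go : ∀ C {r a s t} → Failʳ r → C ⟦ r ⟧ ≡ app^ a s t → Everywhere NoActiveVar t → Fail s
    go hole ()  refl q
    go (appˡ a C t) f refl q = inside C f
    go (appʳ a t C) f refl q = ⊥-elim (no-Fail q (inside C f))

  fail-seq : ∀ {a s t} → Everywhere NoActiveVar t → Fail (seq^ a s t) → Fail s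
  fail-seq q f with C , r , f , eq ← fail-position f = go C f eq q
    where
    go : ∀ C {r a s t} → Failʳ r → C ⟦ r ⟧ ≡ seq^ a s t → Everywhere NoActiveVar t → Fail s
    go hole ()  refl q
    go (seqˡ a C t) f refl q = inside C f
    go (seqʳ a t C) f refl q = ⊥-elim (no-Fail q (inside C f))

  fail-case : ∀ {a T s alts} → Everywhere* NoActiveVar alts → Fail (case^ a T s alts) → Fail s
  fail-case q f with C , r , f , eq ← fail-position f = go C f eq q
    where
    go : ∀ C {r a T s alts} → Failʳ r → C ⟦ r ⟧ ≡ case^ a T s alts → Everywhere* NoActiveVar alts → Fail s
    go hole ()  refl q
    go (caseˢ a T C alts) f refl q = inside C f
    go (caseᵃ a T t alts i C) f refl q = ⊥-elim (no-Fail (everywhere*-[]≔ alts i q) (inside C f))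

  fail-letrec : ∀ {k a t} {bs : Vec LExp (suc k)} → Fail (letrec^ a bs t) →
    Failʳ (letrec^ a bs t) ⊎ (∃ λ i → Fail (lookup bs i)) ⊎ Fail t
  fail-letrec f with C , r , f , eq ← fail-position f = go C f eq
    where
    go : ∀ {k a t} {bs : Vec LExp (suc k)} C {r} → Failʳ r → C ⟦ r ⟧ ≡ letrec^ a bs t →
      Failʳ (letrec^ a bs t) ⊎ (∃ λ i → Fail (lookup bs i)) ⊎ Fail t
    go hole f refl = inj₁ f
    go (letrecⁱ a bs C) f refl = inj₂ (inj₂ (inside C f))
    go (letrecᵇ a bs i C t) {r} f refl = inj₂ (inj₁ (i , ≡-subst Fail (sym (lookup∘update i bs (C ⟦ r ⟧))) (inside C f)))

  spine-no-Fail : ∀ A {ℓ x} → ¬ Fail (spineᴸ A ⟦ var^ ℓ x ⟧)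
  spine-no-Fail holeᴬ f with C , r , f , eq ← fail-position f = go C f eq
    where
    go : ∀ C {r ℓ x} → Failʳ r → C ⟦ r ⟧ ≡ var^ ℓ x → ⊥
    go hole () refl
  spine-no-Fail (appᴬ A t) f       = spine-no-Fail A (fail-app (calm (settled t)) f)
  spine-no-Fail (caseᴬ T A alts) f = spine-no-Fail A (fail-case (calm-alts alts) f)
  spine-no-Fail (seqᴬ A t) f       = spine-no-Fail A (fail-seq (calm (settled t)) f)

  no-Fail-body : ∀ {k a ℓ x} {bs : Vec LExp (suc k)} A → Everywhere* NoActiveVar bs → ¬ Fail (letrec^ a bs (spineᴸ A ⟦ var^ ℓ x ⟧))
  no-Fail-body {bs = bs} A p f with fail-letrec f
  ... | inj₁ (fail-visited {y = y} C _ _ S∈ eq) = plugged-calm {C} (everywhere*-lookup bs y p) eq S∈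
  ... | inj₁ (fail-self {x = x} C S∈ eq)        = plugged-calm {C} (everywhere*-lookup bs x p) eq S∈
  ... | inj₂ (inj₁ (i , g))                     = no-Fail (everywhere*-lookup bs i p) g
  ... | inj₂ (inj₂ g)                           = spine-no-Fail A g

  -- Only the variable `x` in the binding of `y` can be active. Failure would then require that `x`
  -- is `y` or that the binding of `x` has been visited.
  no-Fail-binding : ∀ {k a ℓ t} {bs : Vec LExp (suc k)} A {x y} → Everywhere NoActiveVar t →
    (∀ z → z ≢ y → Everywhere NoActiveVar (lookup bs z)) → lookup bs y ≡ spineᴸ A ⟦ var^ ℓ (toℕ x) ⟧ →
    x ≢ y → annotation (lookup bs x) ≡ ∅ → ¬ Fail (letrec^ a bs t)
  no-Fail-binding {bs = bs} A {x} {y} q p eq x≢y unvisited f with fail-letrec f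
  ... | inj₁ (fail-visited {x = x′} {y′} C _ seen S∈ eq′) with y′ ≟ᶠ y
  ...   | no y′≢y = plugged-calm {C} (p y′ y′≢y) eq′ S∈
  ...   | yes refl with d , e ← spine-var A C S∈ (trans (sym eq) eq′)
                   with refl ← toℕ-injective (trans e (cong (_+ toℕ x′) d)) = unseen seen
    where
    unseen : ¬ (𝐕 ∈ˢ annotation (lookup bs x) ⊎ 𝐖 ∈ˢ annotation (lookup bs x))
    unseen (inj₁ V∈) = ∉⊥ (≡-subst (𝐕 ∈ˢ_) unvisited V∈)
    unseen (inj₂ W∈) = ∉⊥ (≡-subst (𝐖 ∈ˢ_) unvisited W∈)
  no-Fail-binding {bs = bs} A {x} {y} q p eq x≢y unvisited f | inj₁ (fail-self {x = x′} C S∈ eq′) with x′ ≟ᶠ y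
  ...   | no x′≢y = plugged-calm {C} (p x′ x′≢y) eq′ S∈
  ...   | yes refl with d , e ← spine-var A C S∈ (trans (sym eq) eq′) =
    x≢y (toℕ-injective (trans e (cong (_+ toℕ x′) d)))
  no-Fail-binding {bs = bs} A {y = y} q p eq x≢y unvisited f | inj₂ (inj₁ (i , g)) with i ≟ᶠ y
  ...   | no i≢y   = no-Fail (p i i≢y) g
  ...   | yes refl = spine-no-Fail A (≡-subst Fail eq g)
  no-Fail-binding A q p eq x≢y unvisited f | inj₂ (inj₂ g) = no-Fail q g

  data Shape : AppCtx → Set where
    top   : Shape holeᴬ
    under : ∀ A f → Shape (A ▹ f)

  headed : ∀ s → ∃₂ λ A h → Shape A × Head h × s ≡ A ⟦ h ⟧ᴬ
  headed s with focus s
  ... | bare {h} H       = holeᴬ , h , top , H , refl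
  ... | framed A f {h} H = A ▹ f , h , under A f , H , sym (▹-⟦⟧ A f)

  ▹≢holeᴬ : ∀ A f → A ▹ f ≢ holeᴬ
  ▹≢holeᴬ holeᴬ (appᶠ t)       ()
  ▹≢holeᴬ holeᴬ (caseᶠ T alts) ()
  ▹≢holeᴬ holeᴬ (seqᶠ t)       ()

  ▹≢hole : ∀ A f → spineᴸ (A ▹ f) ≢ hole
  ▹≢hole holeᴬ (appᶠ t)       ()
  ▹≢hole holeᴬ (caseᶠ T alts) ()
  ▹≢hole holeᴬ (seqᶠ t)       ()

  var-in′ : ∀ {k m ℓ} {bs : Vec LExp (suc k)} {x} C → depth C ≡ 0 → 𝐒 ∈ˢ ℓ →
    letrec^ m bs (C ⟦ var^ ℓ (toℕ x) ⟧) ⇝ʳ letrec^ m (updateAt bs x (mark 𝐒)) (C ⟦ var^ (ℓ ⟨ 𝐒 ↦ 𝐕 ⟩) (toℕ x) ⟧)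
  var-in′ {m = m} {ℓ} {bs} {x} C d S∈ = ≡-subst (λ d → letrec^ m bs (C ⟦ var^ ℓ (d + toℕ x) ⟧) ⇝ʳ
    letrec^ m (updateAt bs x (mark 𝐒)) (C ⟦ var^ (ℓ ⟨ 𝐒 ↦ 𝐕 ⟩) (d + toℕ x) ⟧)) d (var-in C S∈)

  var-e′ : ∀ {k m ℓ t} {bs : Vec LExp (suc k)} {x y} C → depth C ≡ 0 → C ≢ hole → x ≢ y → 𝐒 ∈ˢ ℓ →
    lookup bs y ≡ C ⟦ var^ ℓ (toℕ x) ⟧ →
    letrec^ m bs t ⇝ʳ letrec^ m (updateAt (bs [ y ]≔ C ⟦ var^ (ℓ ⟨ 𝐒 ↦ 𝐕 ⟩) (toℕ x) ⟧) x (mark 𝐒)) t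
  var-e′ {m = m} {ℓ} {t} {bs} {x} {y} C d ¬hole x≢y S∈ eq =
    ≡-subst (λ d → letrec^ m bs t ⇝ʳ letrec^ m (updateAt (bs [ y ]≔ C ⟦ var^ (ℓ ⟨ 𝐒 ↦ 𝐕 ⟩) (d + toℕ x) ⟧) x (mark 𝐒)) t) d
      (var-e C ¬hole x≢y S∈ (trans eq (cong (λ d → C ⟦ var^ ℓ (d + toℕ x) ⟧) (sym d))))

  -- The search for the labelled redex

  chain-start : ∀ {A : Set} {n} {bs : Vec (Exp A) n} {x y xs} → Chain bs x y xs → x ∈ xs
  chain-start start       = here refl
  chain-start (next ch _) = there (chain-start ch)

  data Stopped : 𝔼 → Set where
    lamˢ    : ∀ s → Stopped (lam s)
    conˢ    : ∀ T c ss → Stopped (con T c ss)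
    letrecˢ : ∀ {k} (bs : Vec 𝔼 (suc k)) s → Stopped (letrec bs s)

  settled-active : ∀ {h} → Stopped h → Everywhere Settled (active h)
  settled-active (lamˢ s)       = tt , settled s
  settled-active (conˢ T c ss)  = tt , settled* ss
  settled-active (letrecˢ bs s) = (λ { (there ()) }) , settled* bs , settled s

  module Search {k : ℕ} (bs : Vec 𝔼 (suc k)) (t : 𝔼) where
    private
      n = suc k
    open Sharing 1
    open Name 1 0 using (inhabited-A)
    open Need

    E : Env
    E = scope* bs ∅ᴱ

    _◁_ _◁⁺_ : Fin n → Fin n → Set
    _◁_ = _◁[ bs ]_
    _◁⁺_ = TransClosure _◁_

    Needed : Fin n → Set
    Needed x = ∃₂ λ A x₀ → t ≡ A ⟦ var (toℕ x₀) ⟧ᴬ × Star (λ y z → z ◁ y) x₀ x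

    -- The place where the value found by the search will be used: the variable `xₘ` labelled `𝐕`,
    -- together with the chain from it to `x₁`. In `binding` the context is nonempty, for a bare
    -- variable would belong to the chain instead; the last argument serves to keep `u` off the
    -- chain.
    data User (lbs : Vec LExp n) (lt : LExp) (x₁ : Fin n) : Set where
      body : ∀ A {xₘ xs} → Shape A → t ≡ A ⟦ var (toℕ xₘ) ⟧ᴬ → lt ≡ spineᴸ A ⟦ var^ visited (toℕ xₘ) ⟧ →
        Chain bs x₁ xₘ xs → User lbs lt x₁
      binding : ∀ u A f {xₘ xs} → lookup bs u ≡ (A ▹ f) ⟦ var (toℕ xₘ) ⟧ᴬ →
        lookup lbs u ≡ spineᴸ (A ▹ f) ⟦ var^ visited (toℕ xₘ) ⟧ →
        Needed u → Chain bs x₁ xₘ xs → (∀ {z} → z ∈ xs → z ◁⁺ u) → User lbs lt x₁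

    initial : LExp
    initial = mark 𝐓 (unlabelled (letrec bs t))

    -- The moment at which labelling has put `𝐒` on the binding of `x` and explored nothing inside
    -- it. By `history`, every other binding that already carries labels depends on `x`, so meeting
    -- one again would close a cycle.
    record State (x : Fin n) : Set where
      field
        lbs            : Vec LExp n
        lt             : LExp
        reach          : Star _⇝_ initial (letrec^ visited lbs lt)
        current        : lookup lbs x ≡ active (lookup bs x)
        settled-others : ∀ z → z ≢ x → Everywhere Settled (lookup lbs z)
        settled-body   : Everywhere Settled lt
        history        : ∀ z → z ≢ x → lookup lbs z ≡ unlabelled (lookup bs z) ⊎ x ◁⁺ z
        needed         : Needed x
        user           : User lbs lt x

    data Stop : Set where
      at-body : ∀ {A h} → Shape A → Stopped h → t ≡ A ⟦ h ⟧ᴬ →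
        Star _⇝_ initial (letrec^ visited (unlabelled* bs) (spineᴸ A ⟦ active h ⟧)) → Stop
      at-binding : ∀ {A h} x lbs lt → Shape A → Stopped h → lookup bs x ≡ A ⟦ h ⟧ᴬ →
        lookup lbs x ≡ spineᴸ A ⟦ active h ⟧ → Star _⇝_ initial (letrec^ visited lbs lt) →
        (∀ z → z ≢ x → Everywhere Settled (lookup lbs z)) → Everywhere Settled lt → Needed x → User lbs lt x → Stop

    data Headed : 𝔼 → Set where
      bound-var : ∀ x → Headed (var (toℕ {n} x))
      stopped   : ∀ {h} → Stopped h → Headed h

    headed-in : ∀ {h} → Head h → Inhabited (⦅ h ⦆ E) → Headed h
    headed-in (lamʰ s) _       = stopped (lamˢ s)
    headed-in (conʰ T c ss) _  = stopped (conˢ T c ss)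
    headed-in (letrecʰ bs s) _ = stopped (letrecˢ bs s)
    headed-in (varʰ x) p with x <? n
    ... | yes l = ≡-subst (Headed ∘ var^ tt) (toℕ-fromℕ< l) (bound-var (fromℕ< l))
    ... | no ¬l with y , refl ← m≤n⇒∃[o]m+o≡n (≮⇒≥ ¬l)
                with () ← proj₂ (proj₂ (≡-subst Inhabited (scope*-tail bs y) p))

    asymmetric : ∀ {x y} → Acc _◁_ x → y ◁⁺ x → ¬ (x ◁⁺ y)
    asymmetric a p q = acc⇒asym (accessible _ a) q p

    irreflexive : ∀ {x} → Acc _◁_ x → ¬ (x ◁⁺ x)
    irreflexive a p = asymmetric a p p

    unlabelled-lookup : ∀ {n} (ss : Vec 𝔼 n) i → lookup (unlabelled* ss) i ≡ unlabelled (lookup ss i)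
    unlabelled-lookup ss i = lookup-mapAnn* _ ss i

    module _ {x x′ : Fin n} (acc-x : Acc _◁_ x) (S : State x) {A : AppCtx}
      (shape : Shape A) (x≡ : lookup bs x ≡ A ⟦ var (toℕ x′) ⟧ᴬ) where
      open State S
      private
        u₀ : LExp
        u₀ = spineᴸ A ⟦ active (var (toℕ x′)) ⟧
        lbs₁ : Vec LExp n
        lbs₁ = lbs [ x ]≔ u₀
        edge : x′ ◁ x
        edge = A , x≡
        x′≢x : x′ ≢ x
        x′≢x refl = irreflexive acc-x (single edge)
        unvisited : lookup lbs x′ ≡ unlabelled (lookup bs x′)
        unvisited with history x′ x′≢x
        ... | inj₁ p = p
        -- `x′` would depend on `x`, which in turn asks for `x′`: a cycle, against accessibility of
        -- `x`.
        ... | inj₂ p = ⊥-elim (asymmetric acc-x (single edge) p)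
        module After (ℓ : Labels) (𝐒∉ : 𝐒 ∉ˢ ℓ) where
          u₁ = spineᴸ A ⟦ var^ ℓ (toℕ x′) ⟧
          lbs₂ = updateAt (lbs₁ [ x ]≔ u₁) x′ (mark 𝐒)
          at-x : lookup lbs₂ x ≡ u₁
          at-x = trans (lookup∘updateAt′ x x′ (x′≢x ∘ sym) (lbs₁ [ x ]≔ u₁)) (lookup∘update x lbs₁ u₁)
          at-other : ∀ {z} → z ≢ x → z ≢ x′ → lookup lbs₂ z ≡ lookup lbs z
          at-other {z} p q = trans (lookup∘updateAt′ z x′ q (lbs₁ [ x ]≔ u₁))
            (trans (lookup∘update′ p lbs₁ u₁) (lookup∘update′ p lbs u₀))
          at-x′ : lookup lbs₂ x′ ≡ active (lookup bs x′)
          at-x′ = trans (lookup∘updateAt x′ (lbs₁ [ x ]≔ u₁)) (cong (mark 𝐒)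
            (trans (lookup∘update′ x′≢x lbs₁ u₁) (trans (lookup∘update′ x′≢x lbs u₀) unvisited)))
          state : letrec^ visited lbs₁ lt ⇝ letrec^ visited lbs₂ lt → User lbs₂ lt x′ → State x′
          state step user′ = record
            { lbs = lbs₂ ; lt = lt
            ; reach = reach ◅◅ descent ◅◅ (step ◅ ε)
            ; current = at-x′
            ; settled-others = others
            ; settled-body = settled-body
            ; history = past
            ; needed = let B , x₀ , p , q = needed in B , x₀ , p , q ◅◅ (edge ◅ ε)
            ; user = user′ }
            where
            descent : Star _⇝_ (letrec^ visited lbs lt) (letrec^ visited lbs₁ lt)
            descent = ≡-subst (λ bs → Star _⇝_ (letrec^ visited bs lt) (letrec^ visited lbs₁ lt))
              (trans (cong (lbs [ x ]≔_) (trans (cong active (sym x≡)) (sym current))) ([]≔-lookup lbs x))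
              (gmap (λ l → letrec^ visited (lbs [ x ]≔ l) lt)
                (⇝ᶜ⇒⇝ ∘ letrecᵇ-⇝ᶜ lbs x (λ z p → calm (settled-others z p)) (calm settled-body))
                (descend A (var (toℕ x′))))
            others : ∀ z → z ≢ x′ → Everywhere Settled (lookup lbs₂ z)
            others z q with z ≟ᶠ x
            ... | yes refl = ≡-subst (Everywhere Settled) (sym at-x) (settled-spine A (𝐒∉ , tt))
            ... | no p     = ≡-subst (Everywhere Settled) (sym (at-other p q)) (settled-others z p)
            past : ∀ z → z ≢ x′ → lookup lbs₂ z ≡ unlabelled (lookup bs z) ⊎ x′ ◁⁺ z
            past z q with z ≟ᶠ x
            ... | yes refl = inj₂ (single edge)
            ... | no p with history z p
            ...   | inj₁ e = inj₁ (trans (at-other p q) e)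
            ...   | inj₂ e = inj₂ (edge ∷ e)
        calm-step : ∀ {l} → letrec^ visited lbs₁ lt ⇝ʳ l → letrec^ visited lbs₁ lt ⇝ l
        calm-step = inside hole (no-Fail-binding A (calm settled-body)
          (λ z p → calm (≡-subst (Everywhere Settled) (sym (lookup∘update′ p lbs u₀)) (settled-others z p)))
          (lookup∘update x lbs u₀) x′≢x
          (trans (cong annotation (trans (lookup∘update′ x′≢x lbs u₀) unvisited))
                 (annotation-unlabelled settled-plain (lookup bs x′))))

      follow : State x′
      follow = go shape refl
        where
        -- A chain is listed from the use down to the value, so the new start `x′` goes to the end
        -- of the list.
        extend : A ≡ holeᴬ → ∀ {y xs} → Chain bs x y xs → Chain bs x′ y (xs ++ᴸ (x′ ∷ []))
        extend refl start       = next start x≡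
        extend refl (next ch p) = next (extend refl ch) p
        go : ∀ {B} → Shape B → A ≡ B → State x′
        -- Under a frame, `x` becomes the user and a new chain starts at `x′`. A bare variable is
        -- labelled `𝐖` and only lengthens the chain of the present user.
        go (under B f) refl = state
          (calm-step (var-e′ (spineᴸ A) (depth-spineᴸ A) (▹≢hole B f) x′≢x here (lookup∘update x lbs u₀)))
          (binding x B f x≡ at-x needed start λ { (here refl) → single edge })
          where open After visited (proj₁ V-settled)
        go top refl = state (calm-step (var-chain x′≢x here (lookup∘update x lbs u₀))) (still user)
          where
          open After ⁅ 𝐖 ⁆ (λ ())
          still : User lbs lt x → User lbs₂ lt x′
          still (body B S p q ch) = body B S p q (extend refl ch)
          still (binding u B f p q nu ch depends) = binding u B f p (trans (at-other u≢x u≢x′) q) nu (extend refl ch) depends′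
            where
            x◁⁺u : x ◁⁺ u
            x◁⁺u = depends (chain-start ch)
            u≢x : u ≢ x
            u≢x refl = irreflexive acc-x x◁⁺u
            u≢x′ : u ≢ x′
            u≢x′ refl = asymmetric acc-x (single edge) x◁⁺u
            depends′ : ∀ {z} → z ∈ _ ++ᴸ (x′ ∷ []) → z ◁⁺ u
            depends′ {z} i with ∈-++⁻ _ i
            ... | inj₁ j           = depends j
            ... | inj₂ (here refl) = edge ∷ x◁⁺u

    search : ∀ {x} → Acc _◁_ x → State x → Inhabited (E (toℕ x)) → Stop
    search {x} (acc rs) S p = go (headed (lookup bs x))
      where
      open State S
      inh : Inhabited (⦅ lookup bs x ⦆ E)
      inh = inhabited-⊆ (fwd (solves bs x)) p
      go : (∃₂ λ A h → Shape A × Head h × lookup bs x ≡ A ⟦ h ⟧ᴬ) → Stop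
      go (A , h , shape , H , eq) = continue (headed-in H h-inh) eq h-inh
        where
        h-inh : Inhabited (⦅ h ⦆ E)
        h-inh = inhabited-A A {h} (≡-subst (λ s → Inhabited (⦅ s ⦆ E)) eq inh)
        continue : ∀ {h} → Headed h → lookup bs x ≡ A ⟦ h ⟧ᴬ → Inhabited (⦅ h ⦆ E) → Stop
        continue (bound-var x′) eq q = search (rs (A , eq)) (follow (acc rs) S shape eq) q
        continue (stopped {h} H) eq q = at-binding x (lbs [ x ]≔ spineᴸ A ⟦ active h ⟧) lt shape H eq
          (lookup∘update x lbs _)
          (reach ◅◅ ≡-subst (λ bs → Star _⇝_ (letrec^ visited bs lt) (letrec^ visited (lbs [ x ]≔ spineᴸ A ⟦ active h ⟧) lt))
            (trans (cong (lbs [ x ]≔_) (trans (cong active (sym eq)) (sym current))) ([]≔-lookup lbs x))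
            (gmap (λ l → letrec^ visited (lbs [ x ]≔ l) lt)
                (⇝ᶜ⇒⇝ ∘ letrecᵇ-⇝ᶜ lbs x (λ z p → calm (settled-others z p)) (calm settled-body))
                (descend A h)))
          (λ z p → ≡-subst (Everywhere Settled) (sym (lookup∘update′ p lbs _)) (settled-others z p))
          settled-body needed (still user)
          where
          still : User lbs lt x → User (lbs [ x ]≔ spineᴸ A ⟦ active h ⟧) lt x
          still (body B S p q ch) = body B S p q ch
          still (binding u B f p q nu ch depends) =
            binding u B f p (trans (lookup∘update′ u≢x lbs _) q) nu ch depends
            where
            u≢x : u ≢ x
            u≢x refl = irreflexive (acc rs) (depends (chain-start ch))

    stop : Inhabited (⦅ t ⦆ E) → Stop
    stop p = go (headed t)
      where
      go : (∃₂ λ A h → Shape A × Head h × t ≡ A ⟦ h ⟧ᴬ) → Stop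
      go (A , h , shape , H , eq) = continue (headed-in H h-inh) eq h-inh
        where
        h-inh : Inhabited (⦅ h ⦆ E)
        h-inh = inhabited-A A {h} (≡-subst (λ s → Inhabited (⦅ s ⦆ E)) eq p)
        descent : ∀ {h} → t ≡ A ⟦ h ⟧ᴬ → Star _⇝_ initial (letrec^ visited (unlabelled* bs) (spineᴸ A ⟦ active h ⟧))
        descent {h} eq =
          inside hole (no-Fail (tt , calm-alts bs , calm (settled t))) (top-letrec (there here)) ◅
          ≡-subst (λ s → Star _⇝_ (letrec^ visited (unlabelled* bs) (active s)) _) (sym eq)
            (gmap (letrec^ visited (unlabelled* bs)) (⇝ᶜ⇒⇝ ∘ letrecⁱ-⇝ᶜ (calm-alts bs)) (descend A h))
        continue : ∀ {h} → Headed h → t ≡ A ⟦ h ⟧ᴬ → Inhabited (⦅ h ⦆ E) → Stop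
        continue (stopped H) eq q = at-body shape H eq (descent eq)
        continue (bound-var x) eq q = search (needs-accessible bs x q) (record
          { lbs = lbs₂
          ; lt = spineᴸ A ⟦ var^ visited (toℕ x) ⟧
          ; reach = descent eq ◅◅ (inside hole (no-Fail-body A (calm-alts bs)) (var-in′ (spineᴸ A) (depth-spineᴸ A) here) ◅ ε)
          ; current = trans (lookup∘updateAt x (unlabelled* bs)) (cong (mark 𝐒) (unlabelled-lookup bs x))
          ; settled-others = λ z p → ≡-subst (Everywhere Settled) (sym (at-other p)) (settled (lookup bs z))
          ; settled-body = settled-spine A (proj₁ V-settled , tt)
          ; history = λ z p → inj₁ (at-other p)
          ; needed = A , x , eq , ε
          ; user = body A shape eq refl start }) q
          where
          lbs₂ = updateAt (unlabelled* bs) x (mark 𝐒)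
          at-other : ∀ {z} → z ≢ x → lookup lbs₂ z ≡ unlabelled (lookup bs z)
          at-other {z} p = trans (lookup∘updateAt′ z x p (unlabelled* bs)) (unlabelled-lookup bs z)

  -- Adequacy for L_LR

  mutual
    weight-mapAnn : ∀ (f : A → B) s → weight (mapAnn f s) ≡ weight s
    weight-mapAnn f (var^ _ x)         = refl
    weight-mapAnn f (app^ _ s t)       = cong₂ _+_ (weight-mapAnn f s) (weight-mapAnn f s)
    weight-mapAnn f (lam^ _ s)         = refl
    weight-mapAnn f (letrec^ _ bs t)   = cong suc (cong₂ _+_ (weight-mapAnn* f bs) (weight-mapAnn f t))
    weight-mapAnn f (con^ _ T c ss)    = refl
    weight-mapAnn f (seq^ _ s t)       = cong₂ _+_ (weight-mapAnn f s) (weight-mapAnn f s)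
    weight-mapAnn f (case^ _ T s alts) = cong₂ _+_ (weight-mapAnn f s) (weight-mapAnn f s)

    weight-mapAnn* : ∀ {n} (f : A → B) (ss : Vec (Exp A) n) → weight* (mapAnn* f ss) ≡ weight* ss
    weight-mapAnn* f []       = refl
    weight-mapAnn* f (s ∷ ss) = cong₂ _+_ (weight-mapAnn f s) (weight-mapAnn* f ss)

  weight*-++ : ∀ {m n} (ss : Vec (Exp A) m) (ts : Vec (Exp A) n) → weight* (ss ++ ts) ≡ weight* ss + weight* ts
  weight*-++ []       ts = refl
  weight*-++ (s ∷ ss) ts = trans (cong (weight s +_) (weight*-++ ss ts)) (sym (+-assoc (weight s) _ _))

  weight*-[]≔ : ∀ {n} (ss : Vec (Exp A) n) i s → weight* (ss [ i ]≔ s) + weight (lookup ss i) ≡ weight* ss + weight s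
  weight*-[]≔ (t ∷ ss) zero s = begin
    weight s + weight* ss + weight t ≡⟨ +-comm (weight s + weight* ss) (weight t) ⟩
    weight t + (weight s + weight* ss) ≡⟨ cong (weight t +_) (+-comm (weight s) (weight* ss)) ⟩
    weight t + (weight* ss + weight s) ≡⟨ sym (+-assoc (weight t) (weight* ss) (weight s)) ⟩
    weight t + weight* ss + weight s ∎
    where open ≡-Reasoning
  weight*-[]≔ (t ∷ ss) (suc i) s = trans (+-assoc (weight t) _ _)
    (trans (cong (weight t +_) (weight*-[]≔ ss i s)) (sym (+-assoc (weight t) _ _)))

  weight*-< : ∀ {n} (ss : Vec (Exp A) n) i {s} → weight s < weight (lookup ss i) → weight* (ss [ i ]≔ s) < weight* ss
  weight*-< ss i {s} p = +-cancelʳ-< (weight s) _ _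
    (<-≤-trans (+-monoʳ-< (weight* (ss [ i ]≔ s)) p) (≤-reflexive (weight*-[]≔ ss i s)))

  weight-spine : ∀ A l l′ → weight l < weight l′ → weight (spineᴸ A ⟦ l ⟧) < weight (spineᴸ A ⟦ l′ ⟧)
  weight-spine holeᴬ            l l′ p = p
  weight-spine (appᴬ A t)       l l′ p = double-< (weight-spine A l l′ p)
  weight-spine (caseᴬ T A alts) l l′ p = double-< (weight-spine A l l′ p)
  weight-spine (seqᴬ A t)       l l′ p = double-< (weight-spine A l l′ p)

  chain-labelled : ∀ {n} (lbs : Vec LExp n) {x₁ xₘ xs} → Chain (erase* lbs) x₁ xₘ xs → Chain lbs x₁ xₘ xs
  chain-labelled lbs start = start
  chain-labelled lbs (next {y = y} ch eq) =
    next (chain-labelled lbs ch) (proj₂ (relabel (lookup lbs y) (trans (sym (lookup-mapAnn* _ lbs y)) eq)))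
    where
    relabel : ∀ l {x} → erase l ≡ var x → ∃ λ ℓ → l ≡ var^ ℓ x
    relabel (var^ ℓ _) refl = ℓ , refl

  letrec-injective : ∀ {k} {bs bs′ : Vec 𝔼 (suc k)} {t t′} → letrec bs t ≡ letrec bs′ t′ → bs ≡ bs′ × t ≡ t′
  letrec-injective refl = refl , refl

  module Step where
    open Sharing 1
    open Name 1 0 using (inhabited-A; inhabited-frame; case-lam-⊥; app-con-⊥; case-con-type)
    open Need
    open Termination 1 0 _⟶ᴸᴿ_ Answerᴸᴿ

    -- `costly` asks for an inclusion only: a shared redex is paid for at each use, so reducing it
    -- may save more than one unit.
    data Advance (l : LExp) : Set where
      costly : ∀ {l′} → l ▷ l′ → ⦅ l ⦆ ∅ᴱ ⊆ later (⦅ l′ ⦆ ∅ᴱ) → Advance l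
      free   : ∀ {l′} → l ▷ l′ → ⦅ l ⦆ ∅ᴱ ⊆ ⦅ l′ ⦆ ∅ᴱ → weight l′ < weight l → Advance l

    later-elim : ∀ d {τ n} → has (later d) τ n → ∃ λ m → m < n × has d τ m
    later-elim d {n = suc n} p = n , ≤-refl , p

    advance : ∀ {s l τ n} → Labelling s l → Advance l → has (⦅ s ⦆ ∅ᴱ) τ n → Progress s τ n
    advance {l = l} lab (costly {l′} r p) q with refl ← erase-labelling lab =
      let m , m<n , q′ = later-elim (⦅ l′ ⦆ ∅ᴱ) (to p (to (fwd (erase-≈ l)) q)) in
      inj₂ (_ , (_ , l′ , lab , r , refl) , cheaper m<n (to (bwd (erase-≈ l′)) q′))
    advance {l = l} lab (free {l′} r p w) q with refl ← erase-labelling lab =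
      inj₂ (_ , (_ , l′ , lab , r , refl) , lighter (to (bwd (erase-≈ l′)) (to p (to (fwd (erase-≈ l)) q)))
        (≤-trans (s≤s (≤-reflexive (weight-mapAnn _ l′))) (≤-trans w (≤-reflexive (sym (weight-mapAnn _ l))))))

    -- The contexts and environments are quantified, so that one analysis of a redex serves the
    -- root, the body of a letrec and a binding.
    data Local (r : LExp) : Set₁ where
      costly : ∀ {r′} → (∀ C → (C ⟦ r ⟧) ▷ (C ⟦ r′ ⟧)) → (∀ {ρ} → ⦅ r ⦆ ρ ≈ later (⦅ r′ ⦆ ρ)) → Local r
      free   : ∀ {r′} → (∀ C → (C ⟦ r ⟧) ▷ (C ⟦ r′ ⟧)) → (∀ {ρ} → ⦅ r ⦆ ρ ≈ ⦅ r′ ⦆ ρ) → weight r′ < weight r → Local r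

    local : ∀ f {h} → Stopped h → ∀ {E} → Inhabited (⦅ f ⟦ h ⟧ᶠ ⦆ E) → Local (frameᴸ f (active h))
    local (appᶠ t)       (lamˢ s)       p = costly (λ C → lbeta C here) (lbeta-≈ visited (∅ ∪ ⁅ 𝐒 ⁆) ∅ (unlabelled s) (unlabelled t))
    local (caseᶠ T alts) (lamˢ s)       p = ⊥-elim (case-lam-⊥ {s = s} {alts} p)
    local (seqᶠ t)       (lamˢ s)       p = costly (λ C → seq-c C abstraction here) (seq-≈ visited {active (lam s)} (unlabelled t) abstraction)
    local (appᶠ t)       (conˢ T c ss)  p = ⊥-elim (app-con-⊥ {ss = ss} {t} p)
    local (caseᶠ T alts) (conˢ T′ c ss) p with refl ← case-con-type {ss = ss} {alts} p =
      costly (λ C → case-c C here) (case-c-≈ visited (∅ ∪ ⁅ 𝐒 ⁆) T c (unlabelled* ss) (unlabelled* alts))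
    local (seqᶠ t)       (conˢ T c ss)  p = costly (λ C → seq-c C application here) (seq-≈ visited {active (con T c ss)} (unlabelled t) application)
    local (appᶠ t)       (letrecˢ bs s) p = free (λ C → lapp C here) (lapp-≈ {a = visited} {∅ ∪ ⁅ 𝐒 ⁆} (unlabelled* bs) (unlabelled s) (unlabelled t))
      (extrusion-weight (weight* (unlabelled* bs)) (weight (unlabelled s)))
    local (caseᶠ T alts) (letrecˢ bs s) p =
      free (λ C → lcase C here) (lcase-≈ {a = visited} {∅ ∪ ⁅ 𝐒 ⁆} (unlabelled* bs) (unlabelled s) (unlabelled* alts))
      (extrusion-weight (weight* (unlabelled* bs)) (weight (unlabelled s)))
    local (seqᶠ t)       (letrecˢ bs s) p = free (λ C → lseq C here) (lseq-≈ {a = visited} {∅ ∪ ⁅ 𝐒 ⁆} (unlabelled* bs) (unlabelled s) (unlabelled t))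
      (extrusion-weight (weight* (unlabelled* bs)) (weight (unlabelled s)))

    advance-spine : ∀ A {r} → Local r → Advance (spineᴸ A ⟦ r ⟧)
    advance-spine A (costly {r′} r p) = costly (r (spineᴸ A)) (fwd (spine-delay 1 (spineᴸ-spine A) p))
    advance-spine A (free {r′} r p w) = free (r (spineᴸ A)) (fwd (spine-delay 0 (spineᴸ-spine A) p)) (weight-spine A r′ _ w)

    advance-body : ∀ {k ℓ} (lbs : Vec LExp (suc k)) A {r} → Local r → Advance (letrec^ ℓ lbs (spineᴸ A ⟦ r ⟧))
    advance-body lbs A (costly r p) = costly (r (letrecⁱ _ lbs (spineᴸ A))) (fwd (spine-delay 1 (spineᴸ-spine A) p))
    advance-body lbs A (free {r′} r p w) = free (r (letrecⁱ _ lbs (spineᴸ A))) (fwd (spine-delay 0 (spineᴸ-spine A) p))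
      (s≤s (+-monoʳ-< (weight* lbs) (weight-spine A r′ _ w)))

    module _ {k : ℕ} (bs : Vec 𝔼 (suc k)) (t : 𝔼) where
      open Search bs t

      module Labelled {lbs : Vec LExp (suc k)} {lt : LExp} (lbs≡ : erase* lbs ≡ bs) (lt≡ : erase lt ≡ t) where

        -- `On` consists of the bindings from which a path of needs leads to `y`; each is `y` or
        -- strict in its successor. As the body is strict in the first of them, the unit spared at
        -- `y` reaches the whole letrec.
        strict-body : ∀ {ℓ} (E′ : Env) y →
          (∀ i → i ≢ y → ⦅ lookup lbs i ⦆ E′ ⊆ E′ (toℕ i)) → ⦅ lookup lbs y ⦆ E′ ⊆ later (E′ (toℕ y)) →
          (∀ x → ∅ᴱ x ⊆ E′ (suc k + x)) → Needed y → ⦅ letrec^ ℓ lbs lt ⦆ ∅ᴱ ⊆ later (⦅ lt ⦆ E′)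
        strict-body E′ y p q r (A , x₀ , t≡ , path) =
          let weak , strict = strict-least lbs E′ y p q r (λ i → Star (λ y z → z ◁ y) i y) onward in
          strict-erase {lt} (trans lt≡ t≡) (strict-A A (toℕ x₀)) weak (strict path)
          where
          onward : ∀ {i} → Star (λ y z → z ◁ y) i y → i ≡ y ⊎ ∃ λ z → Strict (lookup lbs i) (toℕ z) × Star (λ y z → z ◁ y) z y
          onward ε = inj₁ refl
          onward {i} (_◅_ {j = z} (A , eq) path) = inj₂ (z , strict-erase {lookup lbs i}
            (trans (sym (lookup-mapAnn* _ lbs i)) (trans (cong (λ bs → lookup bs i) lbs≡) eq)) (strict-A A (toℕ z)) , path)

        -- The solution `E′` of the new system satisfies the old bindings, at `y` with one unit to
        -- spare, which is what `strict-body` asks for.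
        later-binding : ∀ {ℓ} y u → (∀ E′ → (∀ i → i ≢ y → SolvesAt lbs E′ i) → ⦅ lookup lbs y ⦆ E′ ≈ later (⦅ u ⦆ E′)) →
          Needed y → ⦅ letrec^ ℓ lbs lt ⦆ ∅ᴱ ⊆ later (⦅ letrec^ ℓ (lbs [ y ]≔ u) lt ⦆ ∅ᴱ)
        later-binding {ℓ} y u p = strict-body {ℓ} E′ y (λ i i≢y → bwd (others i i≢y))
          (⊆-trans (fwd (p E′ others)) (later-mono (⊆-trans
            (⊆-reflexive (cong (λ s → ⦅ s ⦆ E′) (sym (lookup∘update y lbs u)))) (bwd (solves lbs′ y)))))
          (λ x → ⊆-reflexive (sym (scope*-tail lbs′ x)))
          where
          lbs′ = lbs [ y ]≔ u
          E′ : Env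
          E′ = scope* lbs′ ∅ᴱ
          others : ∀ i → i ≢ y → SolvesAt lbs E′ i
          others i i≢y = ≈-trans (solves lbs′ i) (≈-reflexive (cong (λ s → ⦅ s ⦆ E′) (lookup∘update′ i≢y lbs u)))

        advance-binding : ∀ {ℓ} y A {r} → lookup lbs y ≡ spineᴸ A ⟦ r ⟧ → Needed y → Local r → Advance (letrec^ ℓ lbs lt)
        advance-binding {ℓ} y A {r} eq nd loc = go loc
          where
          C = letrecᵇ ℓ lbs y (spineᴸ A) lt
          -- Overwriting the binding of `y` by itself displays the redex inside the context `C`.
          folded : C ⟦ r ⟧ ≡ letrec^ ℓ lbs lt
          folded = cong (λ bs → letrec^ ℓ bs lt) (trans (cong (lbs [ y ]≔_) (sym eq)) ([]≔-lookup lbs y))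
          go : Local r → Advance (letrec^ ℓ lbs lt)
          go (costly {r′} s p) = costly (≡-subst (_▷ (C ⟦ r′ ⟧)) folded (s C))
            (later-binding {ℓ} y (spineᴸ A ⟦ r′ ⟧) (λ E′ _ → ≈-trans (≈-reflexive (cong (λ s → ⦅ s ⦆ E′) eq))
              (spine-delay 1 (spineᴸ-spine A) p)) nd)
          go (free {r′} s p w) = free (≡-subst (_▷ (C ⟦ r′ ⟧)) folded (s C))
            (fwd (⦅⦆-cong lt (replace-≋ lbs y (spineᴸ A ⟦ r′ ⟧) λ E′ _ → ≈-trans (≈-reflexive (cong (λ s → ⦅ s ⦆ E′) eq))
              (spine-delay 0 (spineᴸ-spine A) p))))
            (s≤s (+-monoˡ-< (weight lt) (weight*-< lbs y
              (<-≤-trans (weight-spine A r′ r w) (≤-reflexive (cong weight (sym eq)))))))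

        -- (case-e): the new environment, cut down to the old variables, is a strict improvement at u.
        later-case-e : ∀ {ℓ ℓ′ T c m xs} {ss : Vec LExp (ar T c)} {x₁ xₘ u} A alts b →
          (eq : lookup lbs x₁ ≡ con^ ℓ′ T c ss) → Chain lbs x₁ xₘ xs → u ∉ xs →
          lookup lbs u ≡ spineᴸ A ⟦ case^ b T (var^ m (depth (spineᴸ A) + toℕ xₘ)) alts ⟧ → Needed u →
          ⦅ letrec^ ℓ lbs lt ⦆ ∅ᴱ ⊆ later (⦅ letrec* ℓ (open-con T c ss (shift* (ar T c) lbs [ u ]≔ select T c (spineᴸ A) alts) x₁)
            (shift (ar T c) lt) ⦆ ∅ᴱ)
        later-case-e {ℓ} {T = T} {c} {m} {xs} {ss} {x₁} {xₘ} {u} A alts b eq ch u∉ eq′ nd = ⊆-trans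
          (strict-body {ℓ} Z⁻ u (λ i i≢u → open-con-closed {Z} (bwd ∘ front) i (bwd (back-old i i≢u))) at-u
            (λ x → ⊆-reflexive (sym (tail x))) nd)
          (later-mono (⊆-trans (bwd (shift-≈ K lt (λ _ → refl)))
            (⊆-reflexive (trans (cong (λ bs → ⦅ shift K lt ⦆ (scope* bs ∅ᴱ))
              (cong (shift* K ss ++_) (sym ([]≔-commutes (shift* K lbs) u x₁ u≢x₁))))
              (sym (letrec*-≡ ℓ (open-con T c ss (shift* K lbs [ u ]≔ w) x₁) (shift K lt)))))))
          where
          open OpenCon lbs eq
          w : LExp
          w = select T c (spineᴸ A) alts
          open Append (shift* K ss) (cs [ u ]≔ w) ∅ᴱ renaming (env to Z)
          Z⁻ : Env
          Z⁻ x = Z (K + x)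
          u≢x₁ : u ≢ x₁
          u≢x₁ refl = u∉ (chain-start ch)
          back-old : ∀ i → i ≢ u → Z (K + toℕ i) ≈ ⦅ lookup cs i ⦆ Z
          back-old i i≢u = ≈-trans (back i) (≈-reflexive (cong (λ s → ⦅ s ⦆ Z) (lookup∘update′ i≢u cs w)))
          shared : Z (K + toℕ xₘ) ≈ ⦅ v ⦆ Z
          shared = chain-open-con {E = Z} ch λ {i} i∈ → ≈-trans (≈-reflexive (cong Z (toℕ-↑ʳ K i)))
            (≈-trans (back-old i λ { refl → u∉ i∈ }) (≈-reflexive (cong (λ s → ⦅ s ⦆ Z) (sym (lookup-++ʳ (shift* K ss) cs i)))))
          at-u : ⦅ lookup lbs u ⦆ Z⁻ ⊆ later (Z⁻ (toℕ u))
          at-u = ⊆-trans (bwd (shift-≈ K (lookup lbs u) (λ _ → refl)))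
            (⊆-trans (⊆-reflexive (cong (λ s → ⦅ shift K s ⦆ Z) eq′))
            (⊆-trans (fwd (spine-select-≈ (spineᴸ-spine A) b m (toℕ xₘ) alts {Z} shared))
            (later-mono (⊆-trans (⊆-reflexive (cong (λ s → ⦅ s ⦆ Z) (sym (lookup∘update u cs w)))) (bwd (back u))))))

  -- Progress in `L_LR`

  module Progressing where
    open Sharing 1
    open Name 1 0 using (inhabited-A; inhabited-frame; app-con-⊥; case-con-type)
    open Need
    open Step
    open Termination 1 0 _⟶ᴸᴿ_ Answerᴸᴿ

    V∈ : 𝐕 ∈ˢ visited
    V∈ = there (there here)

    spot : ∀ A x → spineᴸ A ⟦ var^ visited x ⟧ ≡ spineᴸ A ⟦ var^ visited (depth (spineᴸ A) + x) ⟧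
    spot A x = cong (λ d → spineᴸ A ⟦ var^ visited (d + x) ⟧) (sym (depth-spineᴸ A))

    spot-frame : ∀ A f x → spineᴸ (A ▹ f) ⟦ var^ visited x ⟧ ≡ spineᴸ A ⟦ frameᴸ f (var^ visited (depth (spineᴸ A) + x)) ⟧
    spot-frame A f x = trans (▹-spineᴸ A f) (cong (λ d → spineᴸ A ⟦ frameᴸ f (var^ visited (d + x)) ⟧) (sym (depth-spineᴸ A)))

    -- Puts the constructor found by the search in place of the variable that refers to it, so that
    -- the exclusion of ill-typed redexes also covers redexes formed through a chain.
    inhabited-frame-≈ : ∀ f {x h E} → E x ≈ ⦅ h ⦆ E → Inhabited (⦅ f ⟦ var x ⟧ᶠ ⦆ E) → Inhabited (⦅ f ⟦ h ⟧ᶠ ⦆ E)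
    inhabited-frame-≈ (appᶠ t)       p = inhabited-⊆ (fwd (delay-cong 1 (Apply-cong p ≈-refl)))
    inhabited-frame-≈ (caseᶠ T alts) p = inhabited-⊆ (fwd (delay-cong 1 (Case-cong p (λ _ _ → ≈-refl))))
    inhabited-frame-≈ (seqᶠ t)       p = inhabited-⊆ (fwd (delay-cong 1 (Seq-cong p ≈-refl)))

    inhabited-▹ : ∀ A f {h E} → Inhabited (⦅ (A ▹ f) ⟦ h ⟧ᴬ ⦆ E) → Inhabited (⦅ f ⟦ h ⟧ᶠ ⦆ E)
    inhabited-▹ A f {h} {E} p = inhabited-A A {f ⟦ h ⟧ᶠ} (≡-subst (λ s → Inhabited (⦅ s ⦆ E)) (▹-⟦⟧ A f) p)

    llet-in-advance : ∀ {k₁ k₂ ℓ s} (bs₁ : Vec LExp (suc k₁)) (bs₂ : Vec LExp (suc k₂)) → 𝐒 ∈ˢ ℓ →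
      Advance (letrec^ visited bs₁ (letrec^ ℓ bs₂ s))
    llet-in-advance {k₂ = k₂} {s = s} bs₁ bs₂ S∈ = free (llet-in S∈) (fwd (⦅⦆-cong s (llet-in-≋ bs₂ bs₁))) (begin-strict
      suc (weight* (bs₂ ++ shift* (suc k₂) bs₁) + weight s)
        ≡⟨ cong (λ w → suc (w + weight s)) (trans (weight*-++ bs₂ (shift* (suc k₂) bs₁))
             (trans (cong (weight* bs₂ +_) (weight-rename* _ bs₁)) (+-comm (weight* bs₂) (weight* bs₁)))) ⟩
      suc (weight* bs₁ + weight* bs₂ + weight s)   ≡⟨ cong suc (+-assoc (weight* bs₁) (weight* bs₂) (weight s)) ⟩
      suc (weight* bs₁ + (weight* bs₂ + weight s)) <⟨ s≤s (+-monoʳ-< (weight* bs₁) ≤-refl) ⟩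
      suc (weight* bs₁ + suc (weight* bs₂ + weight s)) ∎)
      where open ≤-Reasoning

    llet-e-advance : ∀ {k₁ k₂ ℓ s t} (bs₁ : Vec LExp (suc k₁)) (bs₂ : Vec LExp (suc k₂)) x → lookup bs₁ x ≡ letrec^ ℓ bs₂ s →
      𝐒 ∈ˢ ℓ → Advance (letrec^ visited bs₁ t)
    llet-e-advance {k₂ = k₂} {s = s} {t} bs₁ bs₂ x eq S∈ = free (llet-e eq S∈)
      (fwd (≈-trans (≈-sym (shift-≈ (suc k₂) t (scope*-tail bs₂))) (⦅⦆-cong (shift (suc k₂) t) (llet-e-≋ bs₂ bs₁ x eq))))
      (s≤s (≤-trans (≤-reflexive (cong suc (cong₂ _+_ (weight*-++ bs₂ cs) (weight-rename _ t)))) (+-monoˡ-< (weight t) cs<)))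
      where
      cs = shift* (suc k₂) bs₁ [ x ]≔ s
      cs< : weight* bs₂ + weight* cs < weight* bs₁
      -- The two sides differ by exactly 1, the weight of the letrec node that disappears.
      cs< = ≤-reflexive (+-cancelʳ-≡ (weight s) _ _ (begin
        suc (weight* bs₂ + weight* cs) + weight s  ≡⟨ cong (λ w → suc w + weight s) (+-comm (weight* bs₂) (weight* cs)) ⟩
        suc (weight* cs + weight* bs₂) + weight s  ≡⟨ cong suc (+-assoc (weight* cs) (weight* bs₂) (weight s)) ⟩
        suc (weight* cs + (weight* bs₂ + weight s)) ≡⟨ sym (+-suc (weight* cs) (weight* bs₂ + weight s)) ⟩
        weight* cs + suc (weight* bs₂ + weight s)
          ≡⟨ cong (weight* cs +_) (sym (trans (cong weight (lookup-rename* _ bs₁ x)) (trans (weight-rename _ (lookup bs₁ x)) (cong weight eq)))) ⟩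
        weight* cs + weight (lookup (shift* (suc k₂) bs₁) x) ≡⟨ weight*-[]≔ (shift* (suc k₂) bs₁) x s ⟩
        weight* (shift* (suc k₂) bs₁) + weight s  ≡⟨ cong (_+ weight s) (weight-rename* _ bs₁) ⟩
        weight* bs₁ + weight s ∎))
        where open ≡-Reasoning

    cp-in-advance : ∀ {k ℓ s xs} (lbs : Vec LExp (suc k)) {lt x₁ xₘ} A → lookup lbs x₁ ≡ lam^ ℓ s → 𝐒 ∈ˢ ℓ →
      Chain lbs x₁ xₘ xs → lt ≡ spineᴸ A ⟦ var^ visited (toℕ xₘ) ⟧ → Advance (letrec^ visited lbs lt)
    cp-in-advance {ℓ = ℓ} {s} lbs {xₘ = xₘ} A eq S∈ ch refl rewrite spot A (toℕ xₘ) =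
      free (cp-in (spineᴸ A) eq S∈ ch V∈) (fwd (cp-in-≈ {a = visited} {visited} {visited} (spineᴸ A) eq ch))
        (s≤s (+-monoʳ-< (weight* lbs) (weight-spine A (shift (depth (spineᴸ A)) (lam^ ℓ s)) (var^ visited _) (s≤s z≤n))))

    cp-e-advance : ∀ {k ℓ s xs} (lbs : Vec LExp (suc k)) {lt x₁ xₘ u} A → lookup lbs x₁ ≡ lam^ ℓ s → 𝐒 ∈ˢ ℓ →
      Chain lbs x₁ xₘ xs → u ∉ xs → lookup lbs u ≡ spineᴸ A ⟦ var^ visited (toℕ xₘ) ⟧ → Advance (letrec^ visited lbs lt)
    cp-e-advance {ℓ = ℓ} {s} lbs {lt} {xₘ = xₘ} {u} A eq S∈ ch u∉ eq′ =
      free (cp-e (spineᴸ A) eq S∈ ch V∈ u∉ at-u)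
        (fwd (cp-e-≈ {a = visited} {visited} {visited} {t = lt} (spineᴸ A) eq ch u∉ at-u))
        (s≤s (+-monoˡ-< (weight lt) (weight*-< lbs u (<-≤-trans
          (weight-spine A (shift (depth (spineᴸ A)) (lam^ ℓ s)) (var^ visited (depth (spineᴸ A) + toℕ xₘ)) (s≤s z≤n))
          (≤-reflexive (cong weight (sym at-u)))))))
      where at-u = trans eq′ (spot A (toℕ xₘ))

    seq-in-advance : ∀ {k ℓ T c ss s xs} (lbs : Vec LExp (suc k)) {lt x₁ xₘ} A → lookup lbs x₁ ≡ con^ ℓ T c ss → 𝐒 ∈ˢ ℓ →
      Chain lbs x₁ xₘ xs → lt ≡ spineᴸ A ⟦ seq^ visited (var^ visited (depth (spineᴸ A) + toℕ xₘ)) s ⟧ →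
      Advance (letrec^ visited lbs lt)
    seq-in-advance {ℓ = ℓ} {T} {c} {ss} {s} lbs {xₘ = xₘ} A eq S∈ ch refl =
      costly (seq-in (spineᴸ A) eq S∈ ch V∈) (fwd (spine-delay 1 (spineᴸ-spine A)
        (seq-var-≈ visited {visited} {depth (spineᴸ A) + toℕ xₘ} {v = con^ ℓ T c ss} {s} {E} {E} application
          (≈-trans (≈-reflexive (cong (λ d → E (d + toℕ xₘ)) (depth-spineᴸ A)))
            (≈-trans (chain-≈ {E = E} ch (λ {i} _ → solves lbs i)) (≈-reflexive (cong (λ s → ⦅ s ⦆ E) eq)))))))
      where
      E : Env
      E = scope* lbs ∅ᴱ

    case-in-advance : ∀ {k ℓ T c ss alts xs} (lbs : Vec LExp (suc k)) {lt x₁ xₘ} A → lookup lbs x₁ ≡ con^ ℓ T c ss → 𝐒 ∈ˢ ℓ →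
      Chain lbs x₁ xₘ xs → lt ≡ spineᴸ A ⟦ case^ visited T (var^ visited (depth (spineᴸ A) + toℕ xₘ)) alts ⟧ →
      Advance (letrec^ visited lbs lt)
    case-in-advance {T = T} {c} {alts = alts} lbs {xₘ = xₘ} A eq S∈ ch refl =
      costly (case-in (spineᴸ A) eq S∈ ch V∈) (⊆-trans
        (fwd (open-con-shift ∅ᴱ (spineᴸ A ⟦ case^ visited T (var^ visited (depth (spineᴸ A) + toℕ xₘ)) alts ⟧)))
        (⊆-trans (fwd (spine-select-≈ (spineᴸ-spine A) visited visited (toℕ xₘ) alts {E⁺}
          (chain-open-con {E = E⁺} ch λ {i} _ → solves bs⁺ (K ↑ʳ i))))
        (later-mono (⊆-reflexive (sym (letrec*-≡ visited bs⁺ (select T c (spineᴸ A) alts)))))))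
      where
      open OpenCon lbs eq
      E⁺ : Env
      E⁺ = scope* bs⁺ ∅ᴱ

    module _ {k : ℕ} (bs : Vec 𝔼 (suc k)) (t : 𝔼) where
      open Search bs t

      -- An observation of an expression yields one of whatever stands at its evaluation position;
      -- this is followed along the path of needs.
      needed-inhabited : ∀ {u} → Needed u → Inhabited (⦅ t ⦆ E) → Inhabited (E (toℕ u))
      needed-inhabited (A , x₀ , eq , path) p = go path (inhabited-A A {var (toℕ x₀)} (≡-subst (λ s → Inhabited (⦅ s ⦆ E)) eq p))
        where
        go : ∀ {y u} → Star (λ y z → z ◁ y) y u → Inhabited (E (toℕ y)) → Inhabited (E (toℕ u))
        go ε p = p
        go {y} (_◅_ {j = z} (B , e) path) p = go path (inhabited-A B {var (toℕ z)}
          (≡-subst (λ s → Inhabited (⦅ s ⦆ E)) e (inhabited-⊆ (fwd (solves bs y)) p)))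

      letrec-step : Stop → ∀ {τ n} → has (⦅ letrec bs t ⦆ ∅ᴱ) τ n → Progress (letrec bs t) τ n
      letrec-step (at-body {A} {h} shape H t≡ reach) {τ} {n} p = go shape H t≡ reach
        where
        lbs = unlabelled* bs
        labelling : ∀ {A h} → Stopped h → Star _⇝_ initial (letrec^ visited lbs (spineᴸ A ⟦ active h ⟧)) →
          Labelling (letrec bs t) (letrec^ visited lbs (spineᴸ A ⟦ active h ⟧))
        labelling {A} {h} H reach = reach , no-Fail (calm {letrec^ visited lbs (spineᴸ A ⟦ active h ⟧)} all-settled) , settled-normal all-settled
          where
          all-settled : Everywhere Settled (letrec^ visited lbs (spineᴸ A ⟦ active h ⟧))
          all-settled = proj₂ V-settled , settled* bs , settled-spine A (settled-active H)
        go : ∀ {A h} → Shape A → Stopped h → t ≡ A ⟦ h ⟧ᴬ → Star _⇝_ initial (letrec^ visited lbs (spineᴸ A ⟦ active h ⟧)) →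
          Progress (letrec bs t) τ n
        go top (lamˢ s) refl _      = inj₁ (letrec-value abstraction)
        go top (conˢ T c ss) refl _ = inj₁ (letrec-value application)
        go top H@(letrecˢ bs₂ s) refl r = advance (labelling {holeᴬ} H r) (llet-in-advance lbs (unlabelled* bs₂) here) p
        go (under A f) H refl r = advance (labelling {A ▹ f} H r)
          (≡-subst (λ l → Advance (letrec^ visited lbs l)) (sym (▹-spineᴸ A f))
            (advance-body lbs A (local f H (inhabited-▹ A f (_ , _ , p))))) p
      letrec-step (at-binding x lbs lt shape H bs≡ lbs≡ reach others lt-settled nd user) {τ} {n} p = go shape H bs≡ lbs≡ user
        where
        l : LExp
        l = letrec^ visited lbs lt
        all-settled : Everywhere Settled l
        all-settled = proj₂ V-settled , everywhere*-tabulate lbs each , lt-settled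
          where
          each : ∀ i → Everywhere Settled (lookup lbs i)
          each i with i ≟ᶠ x
          ... | no i≢x   = others i i≢x
          ... | yes refl = ≡-subst (Everywhere Settled) (sym lbs≡) (settled-spine _ (settled-active H))
        labelling : Labelling (letrec bs t) l
        labelling = reach , no-Fail (calm {l} all-settled) , settled-normal all-settled
        erased : erase* lbs ≡ bs × erase lt ≡ t
        erased = letrec-injective (erase-labelling labelling)
        open Labelled bs t {lbs} {lt} (proj₁ erased) (proj₂ erased)
        inh : Inhabited (⦅ t ⦆ E)
        inh = τ , n , p
        proceed : Advance l → Progress (letrec bs t) τ n
        proceed a = advance labelling a p
        relabel : ∀ {x₁ xₘ xs} → Chain bs x₁ xₘ xs → Chain lbs x₁ xₘ xs
        relabel ch = chain-labelled lbs (≡-subst (λ bs → Chain bs _ _ _) (sym (proj₁ erased)) ch)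
        -- The members of the chain are proper dependencies of `u`, so `u` among them would be a
        -- cycle through an accessible binding.
        apart : ∀ {u xs} → Needed u → (∀ {z} → z ∈ xs → z ◁⁺ u) → u ∉ xs
        apart nu f i = irreflexive (needs-accessible bs _ (needed-inhabited nu inh)) (f i)

        go : ∀ {A h} → Shape A → Stopped h → lookup bs x ≡ A ⟦ h ⟧ᴬ → lookup lbs x ≡ spineᴸ A ⟦ active h ⟧ →
          User lbs lt x → Progress (letrec bs t) τ n
        go (under A f) H bs≡ lbs≡ _ = proceed (advance-binding x A (trans lbs≡ (▹-spineᴸ A f)) nd
          (local f H (inhabited-▹ A f (≡-subst (λ s → Inhabited (⦅ s ⦆ E)) bs≡
            (inhabited-⊆ (fwd (solves bs x)) (needed-inhabited nd inh))))))
        go top (letrecˢ bs₂ s) _ lbs≡ _ = proceed (llet-e-advance lbs (unlabelled* bs₂) x lbs≡ here)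
        go top (lamˢ s) _ lbs≡ (body A _ _ lt≡ ch) = proceed (cp-in-advance lbs A lbs≡ here (relabel ch) lt≡)
        go top (lamˢ s) _ lbs≡ (binding u A f _ u≡ nu ch deps) =
          proceed (cp-e-advance lbs (A ▹ f) lbs≡ here (relabel ch) (apart nu deps) u≡)
        go top (conˢ T c ss) bs≡ lbs≡ (body A shape t≡ lt≡ ch) = in-body shape t≡ lt≡ ch
          where
          in-body : ∀ {A xₘ xs} → Shape A → t ≡ A ⟦ var (toℕ xₘ) ⟧ᴬ → lt ≡ spineᴸ A ⟦ var^ visited (toℕ xₘ) ⟧ →
            Chain bs x xₘ xs → Progress (letrec bs t) τ n
          -- The body is itself the end of a chain to a constructor application, which is an answer.
          -- For an abstraction the same position is a (cp-in) redex.
          in-body top refl _ ch = inj₁ (letrec-con bs≡ ch)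
          in-body {xₘ = xₘ} (under A f) t≡ lt≡ ch = enter-frame f refl
            where
            value-inh : ∀ {g} → f ≡ g → Inhabited (⦅ g ⟦ con T c ss ⟧ᶠ ⦆ E)
            value-inh refl = inhabited-frame-≈ f (≈-trans (chain-≈ {E = E} ch (λ {i} _ → solves bs i))
                (≈-reflexive (cong (λ s → ⦅ s ⦆ E) bs≡)))
              (inhabited-▹ A f (≡-subst (λ s → Inhabited (⦅ s ⦆ E)) t≡ inh))
            at : ∀ {g} → f ≡ g → lt ≡ spineᴸ A ⟦ frameᴸ g (var^ visited (depth (spineᴸ A) + toℕ xₘ)) ⟧
            at refl = trans lt≡ (spot-frame A f (toℕ xₘ))
            enter-frame : ∀ g → f ≡ g → Progress (letrec bs t) τ n
            enter-frame (appᶠ s) e        = ⊥-elim (app-con-⊥ {ss = ss} {s} (value-inh e))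
            enter-frame (seqᶠ s) e        = proceed (seq-in-advance lbs A lbs≡ here (relabel ch) (at e))
            enter-frame (caseᶠ T alts) e with refl ← case-con-type {ss = ss} {alts} (value-inh e) =
              proceed (case-in-advance lbs A lbs≡ here (relabel ch) (at e))
        go top (conˢ T c ss) bs≡ lbs≡ (binding u A f {xₘ} u-bs u≡ nu ch deps) = enter-frame f refl
          where
            u∉ = apart nu deps
            value-inh : ∀ {g} → f ≡ g → Inhabited (⦅ g ⟦ con T c ss ⟧ᶠ ⦆ E)
            value-inh refl = inhabited-frame-≈ f (≈-trans (chain-≈ {E = E} ch (λ {i} _ → solves bs i))
                (≈-reflexive (cong (λ s → ⦅ s ⦆ E) bs≡)))
              (inhabited-▹ A f (≡-subst (λ s → Inhabited (⦅ s ⦆ E)) u-bs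
                (inhabited-⊆ (fwd (solves bs u)) (needed-inhabited nu inh))))
            at : ∀ {g} → f ≡ g → lookup lbs u ≡ spineᴸ A ⟦ frameᴸ g (var^ visited (depth (spineᴸ A) + toℕ xₘ)) ⟧
            at refl = trans u≡ (spot-frame A f (toℕ xₘ))
            enter-frame : ∀ g → f ≡ g → Progress (letrec bs t) τ n
            enter-frame (appᶠ s) e        = ⊥-elim (app-con-⊥ {ss = ss} {s} (value-inh e))
            enter-frame (seqᶠ s) e        = proceed (costly (seq-e (spineᴸ A) lbs≡ here (relabel ch) V∈ u∉ (at e))
              (later-binding {visited} u (spineᴸ A ⟦ unlabelled s ⟧) (λ E′ p → ≈-trans (≈-reflexive (cong (λ s → ⦅ s ⦆ E′) (at e)))
                (spine-delay 1 (spineᴸ-spine A) (seq-var-≈ visited {visited} {depth (spineᴸ A) + toℕ xₘ} {v = active (con T c ss)} {unlabelled s} {E′} {E′} application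
                  (≈-trans (≈-reflexive (cong (λ d → E′ (d + toℕ xₘ)) (depth-spineᴸ A)))
                    (≈-trans (chain-except {E = E′} (relabel ch) u∉ p) (≈-reflexive (cong (λ s → ⦅ s ⦆ E′) lbs≡))))))) nu))
            enter-frame (caseᶠ T alts) e with refl ← case-con-type {ss = ss} {alts} (value-inh e) =
              proceed (costly (case-e (spineᴸ A) lbs≡ here (relabel ch) V∈ u∉ (at e))
                (later-case-e {visited} A (unlabelled* alts) visited lbs≡ (relabel ch) u∉ (at e) nu))

    progress : ∀ {s τ n} → has (⦅ s ⦆ ∅ᴱ) τ n → Progress s τ n
    progress {s} {τ} {n} p with headed s
    ... | _ , _ , top , varʰ x , refl with () ← p
    ... | _ , _ , top , lamʰ s , refl         = inj₁ (value abstraction)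
    ... | _ , _ , top , conʰ T c ss , refl    = inj₁ (value application)
    ... | _ , _ , top , letrecʰ bs t , refl   = letrec-step bs t (Search.stop bs t (τ , n , p)) p
    ... | _ , h , under A f , H , refl        = step H (inhabited-▹ A f (τ , n , p))
      where
      go : ∀ {h} → Stopped h → Inhabited (⦅ f ⟦ h ⟧ᶠ ⦆ ∅ᴱ) → has (⦅ (A ▹ f) ⟦ h ⟧ᴬ ⦆ ∅ᴱ) τ n → Progress ((A ▹ f) ⟦ h ⟧ᴬ) τ n
      -- Without an outer letrec, labelling merely descends to the head, and the redex is that head
      -- in its innermost frame.
      go {h} H q p = advance
        ( gmap id ⇝ᶜ⇒⇝ (enter isT (A ▹ f) h (▹≢holeᴬ A f)) , no-Fail (calm all-settled) , settled-normal all-settled)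
        (≡-subst Advance (sym (▹-spineᴸ A f)) (advance-spine A (local f H q))) p
        where all-settled = settled-spine (A ▹ f) (settled-active H)
      step : Head h → Inhabited (⦅ f ⟦ h ⟧ᶠ ⦆ ∅ᴱ) → Progress ((A ▹ f) ⟦ h ⟧ᴬ) τ n
      step (lamʰ s) q       = go (lamˢ s) q p
      step (conʰ T c ss) q  = go (conˢ T c ss) q p
      step (letrecʰ bs s) q = go (letrecˢ bs s) q p
      step (varʰ x) q with () ← proj₂ (proj₂ (inhabited-frame f {var x} q))

  LR↓⇐name↓ : ∀ {s} → s ↓ⁿ → s ↓ᴸᴿ
  LR↓⇐name↓ {s} p with τ , n , q ← name-expansion p =
    Termination.terminates 1 0 _⟶ᴸᴿ_ Answerᴸᴿ Progressing.progress
      (computable-inhabited τ (Transfer.fundamental 1 0 s (λ _ ()) q))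

-- From convergence to the contextual preorders

corollary5p33 : (𝒮 : Signature) → let open Calculi 𝒮 in
    (∀ (s t : 𝔼) → s ≤ᴸᴿ t ⇔ W s ≤ⁿ W t) × IsBijection _∼ᴸᴿ_ _∼ⁿ_ W
corollary5p33 𝒮 = (λ s t → mk⇔ (LR⇒name {s} {t}) (name⇒LR {s} {t})) , record
  { isInjection = record
    { isCongruent = record
      { cong           = λ {s} {t} (p , q) → LR⇒name {s} {t} p , LR⇒name {t} {s} q
      ; isEquivalence₁ = record
        { refl  = (λ _ → id) , (λ _ → id)
        ; sym   = λ (p , q) → q , p
        ; trans = λ (p , q) (p′ , q′) → (λ C → p′ C ∘ p C) , (λ C → q C ∘ q′ C) }
      ; isEquivalence₂ = record
        { refl  = (λ _ → id) , (λ _ → id)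
        ; sym   = λ (p , q) → q , p
        ; trans = λ (p , q) (p′ , q′) → (λ C → p′ C ∘ p C) , (λ C → q C ∘ q′ C) } }
    ; injective = λ {s} {t} (p , q) → name⇒LR {s} {t} p , name⇒LR {t} {s} q }
  ; surjective = λ t → t , λ {s} (p , q) → LR⇒name {s} {t} p , LR⇒name {t} {s} q }
  where
  open Calculi 𝒮
  open Adequacy 𝒮
  -- Both preorders quantify over the same contexts, so it suffices that the two notions of
  -- convergence agree on each expression `C ⟪ s ⟫`.
  LR⇒name : ∀ {s t} → s ≤ᴸᴿ t → s ≤ⁿ t
  LR⇒name p C = name↓⇐LR↓ ∘ p C ∘ LR↓⇐name↓
  name⇒LR : ∀ {s t} → s ≤ⁿ t → s ≤ᴸᴿ t
  name⇒LR p C = LR↓⇐name↓ ∘ p C ∘ name↓⇐LR↓
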